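{- Let $G$ be a connected graph of order $n\geq 10$, and suppose that $\sigma_2(G)\geq n-2$. Then $G$ has a homeomorphically irreducible spanning tree (HIST) if and only if $G$ is not isomorphic to $D_n$.
   Context: All graphs are finite and simple. For a non-complete graph $G$, $\sigma_2(G)=\min\{d_G(u)+d_G(v): u,v\in V(G),\ u\neq v,\ uv\notin E(G)\}$, where $d_G$ denotes degree; if $G$ is complete, $\sigma_2(G)=\infty$. A HIST of $G$ is a spanning tree of $G$ with no vertex of degree $2$. $D_n$ denotes the graph obtained from a complete graph $K$ of order $n-2$ and a path $P$ on $3$ vertices by identifying one vertex of $K$ with an endvertex of $P$ (so $D_n$ has $n$ vertices). -}

module Defs where

open import Data.Nat using (ℕ; _+_; _∸_; _≤_; _<_)
open import Data.Nat.Properties using (_<?_; _≟_)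
open import Data.Fin using (Fin; toℕ)
open import Data.Bool using (Bool; true; false; if_then_else_; _∧_; _∨_)
open import Data.List using (List; []; _∷_; _++_; [_]; length; map; allFin)
open import Data.Nat.ListAction using (sum)
open import Data.List.Relation.Unary.Linked using (Linked)
open import Data.List.Relation.Unary.Unique.Propositional using (Unique)
open import Data.Product using (Σ; _×_; ∃-syntax)
open import Relation.Binary.PropositionalEquality using (_≡_; _≢_)
open import Relation.Nullary using (¬_)
open import Relation.Nullary.Decidable using (⌊_⌋)
open import Function.Bundles using (_↔_; Inverse)

record Graph (n : ℕ) : Set where
  field
    adj    : Fin n → Fin n → Bool
    sym    : ∀ i j → adj i j ≡ adj j i
    irrefl : ∀ i → adj i i ≡ false
open Graph public

Adj : {n : ℕ} → Graph n → Fin n → Fin n → Set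
Adj G u v = adj G u v ≡ true

degree : {n : ℕ} → Graph n → Fin n → ℕ
degree {n} G v = sum (map (λ w → if adj G v w then 1 else 0) (allFin n))

data Walk {n : ℕ} (G : Graph n) : Fin n → Fin n → Set where
  here : ∀ {u} → Walk G u u
  step : ∀ {u w v} → Adj G u w → Walk G w v → Walk G u v

Connected : {n : ℕ} → Graph n → Set
Connected {n} G = ∀ (u v : Fin n) → Walk G u v

-- σ₂(G) ≥ k : every pair of distinct non-adjacent vertices has degree sum ≥ k
-- (vacuous for complete graphs, matching σ₂ = ∞).
σ₂≥ : {n : ℕ} → Graph n → ℕ → Set
σ₂≥ {n} G k = ∀ (u v : Fin n) → u ≢ v → ¬ Adj G u v → k ≤ degree G u + degree G v

-- a cycle: distinct vertices u, m₁, …, mₖ (k ≥ 1), w (so length ≥ 3),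
-- consecutive ones adjacent, and w adjacent to u
HasCycle : {n : ℕ} → Graph n → Set
HasCycle {n} G =
  Σ (Fin n) λ u → Σ (Fin n) λ m → Σ (List (Fin n)) λ ms → Σ (Fin n) λ w →
    let vs = u ∷ m ∷ ms ++ [ w ] in
    Unique vs × Linked (Adj G) vs × Adj G w u

Acyclic : {n : ℕ} → Graph n → Set
Acyclic G = ¬ HasCycle G

IsTree : {n : ℕ} → Graph n → Set
IsTree T = Connected T × Acyclic T

_⊆ᴱ_ : {n : ℕ} → Graph n → Graph n → Set
_⊆ᴱ_ {n} T G = ∀ (u v : Fin n) → Adj T u v → Adj G u v

IsSpanningTree : {n : ℕ} → Graph n → Graph n → Set
IsSpanningTree G T = (T ⊆ᴱ G) × IsTree T

IsHIST : {n : ℕ} → Graph n → Graph n → Set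
IsHIST {n} G T = IsSpanningTree G T × (∀ (v : Fin n) → degree T v ≢ 2)

HasHIST : {n : ℕ} → Graph n → Set
HasHIST {n} G = Σ (Graph n) λ T → IsHIST G T

_≅ᵃ_ : {n : ℕ} → Graph n → (Fin n → Fin n → Bool) → Set
_≅ᵃ_ {n} G H = Σ (Fin n ↔ Fin n) λ f →
  ∀ (u v : Fin n) → adj G u v ≡ H (Inverse.to f u) (Inverse.to f v)

-- D_n: vertices 0 … n-3 form a complete graph K (order n-2);
-- path (n-3) — (n-2) — (n-1) attached at vertex n-3 of K.
Dadj : (n : ℕ) → Fin n → Fin n → Bool
Dadj n i j =
  let a = toℕ i ; b = toℕ j in
  (⌊ a <? n ∸ 2 ⌋ ∧ ⌊ b <? n ∸ 2 ⌋ ∧ Data.Bool.not ⌊ a ≟ b ⌋)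
  ∨ (⌊ a ≟ n ∸ 3 ⌋ ∧ ⌊ b ≟ n ∸ 2 ⌋) ∨ (⌊ a ≟ n ∸ 2 ⌋ ∧ ⌊ b ≟ n ∸ 3 ⌋)
  ∨ (⌊ a ≟ n ∸ 2 ⌋ ∧ ⌊ b ≟ n ∸ 1 ⌋) ∨ (⌊ a ≟ n ∸ 1 ⌋ ∧ ⌊ b ≟ n ∸ 2 ⌋)

{-# OPTIONS --safe #-}

-- Call a subtree without vertices of degree 2 a HIT. If at most (n - 3) / 2 vertices of G fail to be leaves of a HIT T,
-- vertices outside T included, then T spans G, or G = D_n, or T can be enlarged without increasing that number. Indeed,
-- let a leaf x of T have a neighbour w outside, and root T + xw at x. If x is adjacent to a child of a vertex of degree at
-- least 4, or to both children of a vertex of degree 3, then handing these children over to x produces a larger HIT. So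
-- otherwise x has at most 2 + i neighbours, where i is the number of vertices of degree 3 in T; and if x takes just one
-- child from such a vertex q, then the same argument at q shows that q, too, has at most 2 + i neighbours. Together with
-- the non-neighbour w of q this contradicts the degree sum condition, unless x has degree 2 in G and is the only leaf with
-- a neighbour outside T, which forces G = D_n.
--
-- It remains to find one HIT with enough leaves. Let u have maximum degree d. The star at u suffices if 2d is at least
-- n + 3. Otherwise all degrees are close to n / 2, and if n is at least 11, then counting the edges between the neighbours
-- and the non-neighbours of u yields a HIT with at most four internal vertices. For n = 10 a decision tree on the
-- adjacencies of G, found by computer, exhibits a spanning tree in each case.
module Submission where

open import Defs renaming (sym to adj-sym; irrefl to adj-irrefl)
open import Data.Bool using (Bool; true; false; not; _∧_; _∨_; if_then_else_)
open import Data.Bool.Properties using (∧-comm; ∨-comm; ∨-identityʳ)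
open import Data.Empty using (⊥; ⊥-elim)
open import Data.Fin using (Fin; zero; suc; toℕ; fromℕ<)
open import Data.Fin.Permutation using (transpose; _∘ₚ_; _⟨$⟩ʳ_; _⟨$⟩ˡ_; inverseˡ; inverseʳ; permutation) renaming (Permutation′ to Perm)
open import Data.Fin.Properties using (_≟_; toℕ-fromℕ<; toℕ<n; toℕ-injective)
open import Data.List using () renaming (_∷_ to _∷ₗ_; [] to []ₗ)
open import Data.List using (List; []; _∷_; _++_; [_]; length; map; allFin; tabulate; replicate)
open import Data.List.Membership.Propositional using () renaming (_∈_ to _∈ᴸ_)
open import Data.List.Membership.Propositional.Properties using (∈-allFin; ∈-map⁺; ∈-++⁺ˡ; ∈-++⁺ʳ)
open import Data.List.Properties using (map-∘; map-++; length-map; length-++; length-replicate)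
open import Data.List.Relation.Unary.All using (All; []; _∷_) renaming (lookup to All-lookup)
open import Data.List.Relation.Unary.AllPairs using (_∷_)
open import Data.List.Relation.Unary.Any using (here; there)
open import Data.List.Relation.Unary.Linked using (Linked; _∷_)
open import Data.List.Relation.Unary.Unique.Propositional using (Unique)
open import Data.Maybe using (Maybe; just; nothing; _>>=_; is-just) renaming (map to map-Maybe)
open import Data.Maybe.Properties using (just-injective)
open import Data.Nat using (ℕ; zero; suc; _+_; _*_; _∸_; _≤_; _<_; z≤n; s≤s; _≤?_; _<?_; s≤s⁻¹)
open import Data.Nat.DivMod using (_mod_; _/_)
open import Data.Nat.ListAction using () renaming (sum to sumL)
open import Data.Nat.Properties using (≤-refl; ≤-trans; ≤-reflexive; ≤-antisym; ≤-total; <-irrefl; <-trans; <-≤-trans; n≤1+n; m≤m+n; m≤n+m; ≰⇒>; ≮⇒≥; +-mono-≤; +-monoˡ-≤; +-monoʳ-≤; *-monoʳ-≤; +-comm; +-assoc; +-identityʳ; *-zeroʳ; *-comm; *-distribˡ-+; *-identityʳ; m≤n⇒m≤1+n; +-0-commutativeMonoid; suc-injective; <⇒≤; m+[n∸m]≡n; +-cancelˡ-≤; +-cancelʳ-≤; +-cancelˡ-≡; +-suc; m≤n⇒m<n∨m≡n; m+n∸m≡n) renaming (_≟_ to _≟ℕ_)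
open import Data.Nat.Tactic.RingSolver using (solve)
open import Data.Product using (Σ; ∃; _×_; _,_; _,′_; proj₁; proj₂)
open import Data.Sum using (_⊎_; inj₁; inj₂; [_,_]′)
open import Data.Vec using (Vec; []; _∷_) renaming (lookup to lookupᵛ)
open import Function using (_∘_; id; case_of_)
open import Function.Bundles using (_⇔_; mk⇔)
open import Relation.Binary.PropositionalEquality using (_≡_; _≢_; refl; sym; trans; cong; cong₂; subst; subst₂)
open import Relation.Nullary using (¬_; Dec; yes; no; does)
open import Relation.Nullary.Decidable using (⌊_⌋; dec-true; dec-false; from-no; isYes≗does)
open import Algebra.Properties.CommutativeMonoid.Sum +-0-commutativeMonoid using (∑-distrib-+; ∑-comm) renaming (sum to ∑; sum-cong-≗ to ∑-cong)

-- Counting in finite sets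

-- Every estimate is tuned to the bound `2 * nl + 3 ≤ n`. Since vertices outside the tree count as
-- non-leaves, growth is free: when a leaf takes one outside vertex as a child, one leaf is lost and
-- one is gained. So the bound has to be secured for the initial tree only. At a standstill, let i
-- vertices have degree 3 and K lie outside. A tree with degrees 1 and 3 only has 2i + 2 vertices
-- and would break the bound, so some tree vertex has another degree. Hence there are at least i + K
-- + 1 non-leaves, and n is at least 2i + 2K + 5, whereas two non-adjacent vertices with at most 2 +
-- i neighbours each would force n to be at most 2i + 6. The bound also dictates the case
-- distinction. The star at u has n - d non-leaves, which is acceptable exactly when 2d is at least
-- n + 3. Four non-leaves are acceptable exactly when n is at least 11; for n = 10 only three are,
-- and the general constructions do not reach that.

Sub : ℕ → Set
Sub n = Fin n → Bool

infix 4 _∈_ _∉_ _==_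
infixr 6 _∩_ _∖_
infixr 5 _∪_

_∈_ _∉_ : ∀ {n} → Fin n → Sub n → Set
v ∈ P = P v ≡ true
v ∉ P = P v ≡ false

_==_ : ∀ {n} → Fin n → Fin n → Bool
a == b = does (a ≟ b)

==-refl : ∀ {n} (a : Fin n) → (a == a) ≡ true
==-refl a = dec-true (a ≟ a) refl

≡⇒== : ∀ {n} {a b : Fin n} → a ≡ b → (a == b) ≡ true
≡⇒== {a = a} {b} = dec-true (a ≟ b)

==⇒≡ : ∀ {n} {a b : Fin n} → (a == b) ≡ true → a ≡ b
==⇒≡ {a = a} {b} e with a ≟ b
... | yes p = p

==⇒≢ : ∀ {n} {a b : Fin n} → (a == b) ≡ false → a ≢ b
==⇒≢ {a = a} {b} e with a ≟ b
... | no p = p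

≢⇒== : ∀ {n} {a b : Fin n} → a ≢ b → (a == b) ≡ false
≢⇒== {a = a} {b} = dec-false (a ≟ b)

_∩_ _∪_ _∖_ : ∀ {n} → Sub n → Sub n → Sub n
(P ∩ Q) v = P v ∧ Q v
(P ∪ Q) v = P v ∨ Q v
(P ∖ Q) v = P v ∧ not (Q v)

∁ : ∀ {n} → Sub n → Sub n
∁ P v = not (P v)

⁅_⁆ : ∀ {n} → Fin n → Sub n
⁅ a ⁆ v = v == a

true≢false : ∀ {b} → b ≡ true → b ≡ false → ⊥
true≢false refl ()

¬true : ∀ {b} → ¬ (b ≡ true) → b ≡ false
¬true {false} _ = refl
¬true {true} f = ⊥-elim (f refl)

bool : (b : Bool) → (b ≡ true) ⊎ (b ≡ false)
bool true = inj₁ refl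
bool false = inj₂ refl

not-true : ∀ {b} → not b ≡ true → b ≡ false
not-true {false} _ = refl

not-false : ∀ {b} → not b ≡ false → b ≡ true
not-false {true} _ = refl

∧-intro : ∀ {a b} → a ≡ true → b ≡ true → a ∧ b ≡ true
∧-intro refl refl = refl

∧-elim : ∀ {a b} → a ∧ b ≡ true → (a ≡ true) × (b ≡ true)
∧-elim {true} {true} _ = refl , refl

∨-elim : ∀ {a b} → a ∨ b ≡ true → (a ≡ true) ⊎ (b ≡ true)
∨-elim {true} _ = inj₁ refl
∨-elim {false} e = inj₂ e

∨-introˡ : ∀ {a b} → a ≡ true → a ∨ b ≡ true
∨-introˡ refl = refl

∨-introʳ : ∀ {a b} → b ≡ true → a ∨ b ≡ true
∨-introʳ {false} e = e
∨-introʳ {true} e = refl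

∖-intro : ∀ {a b} → a ≡ true → b ≡ false → a ∧ not b ≡ true
∖-intro refl refl = refl

∖-elim : ∀ {a b} → a ∧ not b ≡ true → (a ≡ true) × (b ≡ false)
∖-elim {true} {false} _ = refl , refl

bool-ext : ∀ {a b} → (a ≡ true → b ≡ true) → (b ≡ true → a ≡ true) → a ≡ b
bool-ext {true} f g = sym (f refl)
bool-ext {false} {true} f g = g refl
bool-ext {false} {false} f g = refl

[_]ᵇ : Bool → ℕ
[ true ]ᵇ = 1
[ false ]ᵇ = 0

[]ᵇ-mono : ∀ {a b} → (a ≡ true → b ≡ true) → [ a ]ᵇ ≤ [ b ]ᵇ
[]ᵇ-mono {false} _ = z≤n
[]ᵇ-mono {true} f rewrite f refl = ≤-refl

opaque
  -- Opaque, so that goals show counts instead of unfolded sums; the lemmas that need the sum unfold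
  -- it explicitly.
  # : ∀ {n} → Sub n → ℕ
  # P = ∑ (λ v → [ P v ]ᵇ)

∑-mono : ∀ {n} {f g : Fin n → ℕ} → (∀ v → f v ≤ g v) → ∑ f ≤ ∑ g
∑-mono {zero} _ = z≤n
∑-mono {suc n} h = +-mono-≤ (h zero) (∑-mono (h ∘ suc))

∑-zero : ∀ {n} {f : Fin n → ℕ} → (∀ v → f v ≡ 0) → ∑ f ≡ 0
∑-zero {zero} _ = refl
∑-zero {suc n} h rewrite h zero = ∑-zero (h ∘ suc)

∑-* : ∀ {n} m (f : Fin n → ℕ) → ∑ (λ v → m * f v) ≡ m * ∑ f
∑-* {zero} m f = sym (*-zeroʳ m)
∑-* {suc n} m f rewrite ∑-* m (f ∘ suc) = sym (*-distribˡ-+ m (f zero) _)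

opaque
  unfolding #

  #-∑ : ∀ {n} {P : Sub n} → # P ≡ ∑ (λ v → [ P v ]ᵇ)
  #-∑ = refl

  #-cong : ∀ {n} {P Q : Sub n} → (∀ v → P v ≡ Q v) → # P ≡ # Q
  #-cong h = ∑-cong (cong [_]ᵇ ∘ h)

  #-mono : ∀ {n} {P Q : Sub n} → (∀ v → v ∈ P → v ∈ Q) → # P ≤ # Q
  #-mono h = ∑-mono (λ v → []ᵇ-mono (h v))

  #-full : ∀ {n} {P : Sub n} → (∀ v → v ∈ P) → # P ≡ n
  #-full {zero} _ = refl
  #-full {suc n} h rewrite h zero = cong suc (#-full (h ∘ suc))

  #-empty : ∀ {n} {P : Sub n} → (∀ v → v ∉ P) → # P ≡ 0
  #-empty h = ∑-zero (cong [_]ᵇ ∘ h)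

  #-⁅⁆ : ∀ {n} (a : Fin n) → # ⁅ a ⁆ ≡ 1
  #-⁅⁆ {suc n} zero = cong suc (#-empty {n} {P = λ v → suc v == zero} (λ _ → refl))
  #-⁅⁆ (suc a) = #-⁅⁆ a

  #-+ : ∀ {n} {P Q R : Sub n} → (∀ v → [ R v ]ᵇ ≡ [ P v ]ᵇ + [ Q v ]ᵇ) → # R ≡ # P + # Q
  #-+ {P = P} {Q} h = trans (∑-cong h) (∑-distrib-+ (λ v → [ P v ]ᵇ) (λ v → [ Q v ]ᵇ))

#-split : ∀ {n} (P Q : Sub n) → # P ≡ # (P ∩ Q) + # (P ∖ Q)
#-split P Q = #-+ {P = P ∩ Q} {Q = P ∖ Q} {R = P} (λ v → pt (P v) (Q v))
  where
  pt : ∀ a b → [ a ]ᵇ ≡ [ a ∧ b ]ᵇ + [ a ∧ not b ]ᵇ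
  pt true true = refl
  pt true false = refl
  pt false _ = refl

#-∁ : ∀ {n} (P : Sub n) → # P + # (∁ P) ≡ n
#-∁ P = trans (sym (#-+ {P = P} {Q = ∁ P} {R = λ _ → true} (λ v → pt (P v)))) (#-full {P = λ _ → true} (λ _ → refl))
  where
  pt : ∀ a → 1 ≡ [ a ]ᵇ + [ not a ]ᵇ
  pt true = refl
  pt false = refl

opaque
  unfolding #

  #-∪ : ∀ {n} (P Q : Sub n) → # (P ∪ Q) ≤ # P + # Q
  #-∪ P Q = ≤-trans (∑-mono (λ v → pt (P v) (Q v)))
                    (≤-reflexive (∑-distrib-+ (λ v → [ P v ]ᵇ) (λ v → [ Q v ]ᵇ)))
    where
    pt : ∀ a b → [ a ∨ b ]ᵇ ≤ [ a ]ᵇ + [ b ]ᵇ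
    pt true b = s≤s z≤n
    pt false b = ≤-refl

#-⊎ : ∀ {n} (P Q : Sub n) → (∀ v → v ∈ P → v ∉ Q) → # (P ∪ Q) ≡ # P + # Q
#-⊎ P Q d = #-+ {P = P} {Q = Q} {R = P ∪ Q} (λ v → pt (P v) (Q v) (d v))
  where
  pt : ∀ a b → (a ≡ true → b ≡ false) → [ a ∨ b ]ᵇ ≡ [ a ]ᵇ + [ b ]ᵇ
  pt true b h rewrite h refl = refl
  pt false b h = refl

#-step : ∀ {n} {P Q : Sub n} (z : Fin n) → z ∉ P → z ∈ Q → (∀ v → v ≢ z → Q v ≡ P v) → # Q ≡ suc (# P)
#-step {P = P} {Q} z z∉ z∈ h =
  trans (#-+ {P = ⁅ z ⁆} {Q = P} {R = Q} pt) (cong (_+ # P) (#-⁅⁆ z))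
  where
  pt : ∀ v → [ Q v ]ᵇ ≡ [ v == z ]ᵇ + [ P v ]ᵇ
  pt v with v ≟ z
  ... | yes refl rewrite z∉ | z∈ = refl
  ... | no v≢z = cong [_]ᵇ (h v v≢z)

#-remove : ∀ {n} (P : Sub n) {z} → z ∈ P → # P ≡ suc (# (P ∖ ⁅ z ⁆))
#-remove P {z} z∈ = #-step {P = P ∖ ⁅ z ⁆} {Q = P} z z∉ z∈ agree
  where
  z∉ : z ∉ (P ∖ ⁅ z ⁆)
  z∉ rewrite ==-refl z | z∈ = refl
  agree : ∀ v → v ≢ z → P v ≡ (P ∖ ⁅ z ⁆) v
  agree v v≢z rewrite ≢⇒== v≢z with P v
  ... | true = refl
  ... | false = refl

#-remove-≤ : ∀ {n} (P : Sub n) z → # P ≤ suc (# (P ∖ ⁅ z ⁆))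
#-remove-≤ P z with bool (P z)
... | inj₁ e = ≤-reflexive (#-remove P e)
... | inj₂ e = m≤n⇒m≤1+n (#-mono {P = P} {Q = P ∖ ⁅ z ⁆} λ v v∈ → ∖-intro v∈ (≢⇒== {a = v} λ { refl → true≢false v∈ e }))

search : ∀ {n} (P : Sub n) → (∃ λ v → v ∈ P) ⊎ (∀ v → v ∉ P)
search {zero} P = inj₂ λ ()
search {suc n} P with bool (P zero) | search (P ∘ suc)
... | inj₁ e | _ = inj₁ (zero , e)
... | inj₂ _ | inj₁ (v , e) = inj₁ (suc v , e)
... | inj₂ e | inj₂ h = inj₂ λ { zero → e ; (suc v) → h v }

#>0⇒∃ : ∀ {n} (P : Sub n) → 1 ≤ # P → ∃ λ v → v ∈ P
#>0⇒∃ P h with search P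
... | inj₁ r = r
... | inj₂ e rewrite #-empty {P = P} e with h
... | ()

∈⇒#>0 : ∀ {n} (P : Sub n) {v} → v ∈ P → 1 ≤ # P
∈⇒#>0 P v∈ rewrite #-remove P v∈ = s≤s z≤n

-- Supplies the spare neighbours by which a vertex of a path is brought to degree 3.
pick : ∀ {n} (P : Sub n) xs → length xs < # P → ∃ λ v → v ∈ P × All (v ≢_) xs
pick P [] h with #>0⇒∃ P h
... | v , v∈ = v , v∈ , []
pick P (x ∷ xs) h with pick (P ∖ ⁅ x ⁆) xs (s≤s⁻¹ (≤-trans h (#-remove-≤ P x)))
... | v , v∈ , av = v , proj₁ (∖-elim v∈) , ==⇒≢ (proj₂ (∖-elim {a = P v} v∈)) ∷ av

opaque
  unfolding #

  -- Double counting of the pairs `q`, `v` with `v` in `P` and `f v` equal to `q`. For the parent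
  -- map it counts the non-root vertices of a tree.
  ∑-fibres : ∀ {n} (P : Sub n) (f : Fin n → Fin n) → ∑ (λ q → # (λ v → P v ∧ (f v == q))) ≡ # P
  ∑-fibres {n} P f = trans (∑-comm (λ q v → [ P v ∧ (f v == q) ]ᵇ)) (∑-cong fibre)
    where
    fibre : ∀ v → # (λ q → P v ∧ (f v == q)) ≡ [ P v ]ᵇ
    fibre v with P v
    ... | false = #-empty {n} {P = λ _ → false} (λ _ → refl)
    ... | true = trans (#-cong {P = λ q → f v == q} {Q = ⁅ f v ⁆} λ q → bool-ext
                   (λ e → subst (λ z → (q == z) ≡ true) (sym (==⇒≡ e)) (==-refl q))
                   (λ e → subst (λ z → (f v == z) ≡ true) (sym (==⇒≡ e)) (==-refl (f v))))
                 (#-⁅⁆ (f v))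

#≤1 : ∀ {n} {P : Sub n} → (∀ {u v} → u ∈ P → v ∈ P → u ≡ v) → # P ≤ 1
#≤1 {P = P} h with search P
... | inj₂ e rewrite #-empty {P = P} e = z≤n
... | inj₁ (u , u∈) = ≤-trans (#-mono {P = P} {Q = ⁅ u ⁆} λ v v∈ → subst (λ z → (v == z) ≡ true) (h v∈ u∈) (==-refl v))
                              (≤-reflexive (#-⁅⁆ u))

opaque
  unfolding #

  #-injective : ∀ {n} {P Q : Sub n} (f : Fin n → Fin n) → (∀ v → v ∈ P → f v ∈ Q) →
    (∀ {u v} → u ∈ P → v ∈ P → f u ≡ f v → u ≡ v) → # P ≤ # Q
  #-injective {P = P} {Q} f into inj = subst (_≤ # Q) (∑-fibres P f) (∑-mono bound)
    where
    bound : ∀ q → # (λ v → P v ∧ (f v == q)) ≤ [ Q q ]ᵇ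
    bound q with bool (Q q)
    ... | inj₁ e rewrite e = #≤1 λ u∈ v∈ → inj (proj₁ (∧-elim u∈)) (proj₁ (∧-elim v∈))
            (trans (==⇒≡ (proj₂ (∧-elim {P _} u∈))) (sym (==⇒≡ (proj₂ (∧-elim {P _} v∈)))))
    ... | inj₂ e rewrite e = ≤-reflexive (#-empty λ v → ¬true λ v∈ →
            true≢false (subst (_∈ Q) (==⇒≡ (proj₂ (∧-elim {P v} v∈))) (into v (proj₁ (∧-elim v∈)))) e)

  degree-# : ∀ {n} (G : Graph n) v → degree G v ≡ # (adj G v)
  degree-# {n} G v = go id
    where
    go : ∀ {m} (f : Fin m → Fin n) →
         sumL (map (λ w → if adj G v w then 1 else 0) (tabulate f)) ≡ # (λ i → adj G v (f i))
    go {zero} f = refl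
    go {suc m} f with adj G v (f zero)
    ... | true = cong suc (go (f ∘ suc))
    ... | false = go (f ∘ suc)

-- Rooted subtrees

module Trees {n : ℕ} (G : Graph n) where

  -- The rank may be any function that increases away from the root, so that most changes of the
  -- tree can keep it. By `rk-root` a vertex can be hung directly below the root with its rank
  -- unchanged.
  record Rooted (S : Sub n) (ρ : Fin n) : Set where
    field
      par     : Fin n → Fin n
      rk      : Fin n → ℕ
      root∈   : ρ ∈ S
      par∈    : ∀ {v} → v ∈ S → v ≢ ρ → par v ∈ S
      par~    : ∀ {v} → v ∈ S → v ≢ ρ → Adj G (par v) v
      rk-par  : ∀ {v} → v ∈ S → v ≢ ρ → rk (par v) < rk v
      rk-root : ∀ {v} → v ∈ S → v ≢ ρ → rk ρ < rk v

    child : Fin n → Sub n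
    child q v = (S ∖ ⁅ ρ ⁆) v ∧ (par v == q)

    -- The bit in `deg` is the edge to the parent. A vertex outside `S` has no children and so gets
    -- degree 1, the value that it will have when grafted as a leaf.
    ch deg : Fin n → ℕ
    ch q = # (child q)
    deg q = ch q + [ not (q == ρ) ]ᵇ

    child-intro : ∀ {q v} → v ∈ S → v ≢ ρ → par v ≡ q → v ∈ child q
    child-intro {v = v} v∈ v≢ refl = ∧-intro (∖-intro v∈ (≢⇒== v≢)) (==-refl (par v))

    child-elim : ∀ {q v} → v ∈ child q → v ∈ S × v ≢ ρ × par v ≡ q
    child-elim {q} {v} e with ∧-elim {(S ∖ ⁅ ρ ⁆) v} e
    ... | a , b with ∖-elim {S v} a
    ... | c , d = c , ==⇒≢ d , ==⇒≡ b

    child⇒∈ : ∀ {q v} → v ∈ child q → q ∈ S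
    child⇒∈ e with child-elim e
    ... | v∈ , v≢ , refl = par∈ v∈ v≢

    ch-outside : ∀ {q} → q ∉ S → ch q ≡ 0
    ch-outside {q} q∉ = #-empty {P = child q} λ v → ¬true λ e → true≢false (child⇒∈ e) q∉

    deg-root : deg ρ ≡ ch ρ
    deg-root rewrite ==-refl ρ = +-identityʳ _

    deg-nonroot : ∀ {q} → q ≢ ρ → deg q ≡ suc (ch q)
    deg-nonroot q≢ rewrite ≢⇒== q≢ = +-comm _ 1

    deg-outside : ∀ {q} → q ∉ S → deg q ≡ 1
    deg-outside q∉ = trans (deg-nonroot λ { refl → true≢false root∈ q∉ }) (cong suc (ch-outside q∉))

    ∑ch : ∑ ch ≡ # (S ∖ ⁅ ρ ⁆)
    ∑ch = ∑-fibres (S ∖ ⁅ ρ ⁆) par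

  open Rooted

  root-ch>0 : ∀ {S ρ} (U : Rooted S ρ) {v} → v ∈ S → v ≢ ρ → 1 ≤ ch U (par U v)
  root-ch>0 U v∈ v≢ = ∈⇒#>0 (child U _) (child-intro U v∈ v≢ refl)

  -- Elementary changes of a rooted tree: grafting, regrafting, moving the root

  module _ {S : Sub n} {ρ : Fin n} (U : Rooted S ρ) where

    module Graft (x : Fin n) (x∈ : x ∈ S) (P : Sub n) (new : ∀ {v} → v ∈ P → v ∉ S) (x~ : ∀ {v} → v ∈ P → Adj G x v) where
      private
        par′ : Fin n → Fin n
        par′ v = if P v then x else par U v
        rk′ : Fin n → ℕ
        rk′ v = if P v then suc (rk U x) else rk U v

        P-old : ∀ {v} → v ∈ S → v ∉ P
        P-old v∈ = ¬true λ v∈P → true≢false v∈ (new v∈P)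

        rk-old : ∀ {v} → v ∈ S → rk′ v ≡ rk U v
        rk-old v∈ rewrite P-old v∈ = refl

        old : ∀ {v} → v ∈ S ∪ P → v ∉ P → v ∈ S
        old {v} v∈ v∉ with ∨-elim {S v} v∈
        ... | inj₁ e = e
        ... | inj₂ e = ⊥-elim (true≢false e v∉)

        p∈ : ∀ {v} → v ∈ S ∪ P → v ≢ ρ → par′ v ∈ S
        p∈ {v} v∈ v≢ with bool (P v) | old {v} v∈
        ... | inj₁ e | _ rewrite e = x∈
        ... | inj₂ e | o rewrite e = par∈ U (o refl) v≢

        p~ : ∀ {v} → v ∈ S ∪ P → v ≢ ρ → Adj G (par′ v) v
        p~ {v} v∈ v≢ with bool (P v) | old {v} v∈
        ... | inj₁ e | _ rewrite e = x~ e
        ... | inj₂ e | o rewrite e = par~ U (o refl) v≢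

        r< : ∀ {v} → v ∈ S ∪ P → v ≢ ρ → rk′ (par′ v) < rk′ v
        r< {v} v∈ v≢ rewrite rk-old (p∈ v∈ v≢) with bool (P v) | old {v} v∈
        ... | inj₁ e | _ rewrite e = ≤-refl
        ... | inj₂ e | o rewrite e = rk-par U (o refl) v≢

        x-root : rk U ρ ≤ rk U x
        x-root with x ≟ ρ
        ... | yes refl = ≤-refl
        ... | no x≢ = <⇒≤ (rk-root U x∈ x≢)

        r-root : ∀ {v} → v ∈ S ∪ P → v ≢ ρ → rk′ ρ < rk′ v
        r-root {v} v∈ v≢ rewrite rk-old (root∈ U) with bool (P v) | old {v} v∈
        ... | inj₁ e | _ rewrite e = s≤s x-root
        ... | inj₂ e | o rewrite e = rk-root U (o refl) v≢

      graft : Rooted (S ∪ P) ρ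
      graft = record { par = par′ ; rk = rk′ ; root∈ = ∨-introˡ (root∈ U) ; par∈ = λ v∈ v≢ → ∨-introˡ (p∈ v∈ v≢)
                     ; par~ = p~ ; rk-par = r< ; rk-root = r-root }

      private
        root∉P : ρ ∉ P
        root∉P = P-old (root∈ U)

        P≢ρ : ∀ {v} → v ∈ P → v ≢ ρ
        P≢ρ v∈ refl = true≢false v∈ root∉P

        same : ∀ {q} → q ≢ x → ∀ v → child graft q v ≡ child U q v
        same {q} q≢ v with bool (P v)
        ... | inj₁ e rewrite e | new e | ≢⇒== (P≢ρ e) | ≢⇒== (q≢ ∘ sym) = refl
        ... | inj₂ e rewrite e with S v
        ... | true = refl
        ... | false = refl

        more : ∀ v → [ child graft x v ]ᵇ ≡ [ child U x v ]ᵇ + [ P v ]ᵇ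
        more v with bool (P v)
        ... | inj₁ e rewrite e | new e | ≢⇒== (P≢ρ e) | ==-refl x = refl
        ... | inj₂ e rewrite e with S v
        ... | true = sym (+-identityʳ _)
        ... | false = refl

      graft-deg-at : deg graft x ≡ # P + deg U x
      graft-deg-at rewrite #-+ {P = child U x} {Q = P} {R = child graft x} more =
        trans (cong (_+ [ not (x == ρ) ]ᵇ) (+-comm (ch U x) (# P))) (+-assoc (# P) (ch U x) _)

      graft-deg : ∀ {q} → q ≢ x → deg graft q ≡ deg U q
      graft-deg {q} q≢ rewrite #-cong {P = child graft q} {Q = child U q} (same q≢) = refl

      graft-par-old : ∀ {v} → v ∈ S → par graft v ≡ par U v
      graft-par-old v∈ rewrite P-old v∈ = refl

    -- Only the root receives moved vertices: its rank is the smallest, so no cycle can arise and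
    -- the ranks stay valid. This is why trees are rerooted before vertices are moved.
    module Regraft (z : Fin n) (z∈ : z ∈ S) (z≢ρ : z ≢ ρ) (pz≢ρ : par U z ≢ ρ) (ρ~z : Adj G ρ z) where
      private
        par′ : Fin n → Fin n
        par′ v = if v == z then ρ else par U v

        p∈ : ∀ {v} → v ∈ S → v ≢ ρ → par′ v ∈ S
        p∈ {v} v∈ v≢ with v ≟ z
        ... | yes _ = root∈ U
        ... | no _ = par∈ U v∈ v≢

        p~ : ∀ {v} → v ∈ S → v ≢ ρ → Adj G (par′ v) v
        p~ {v} v∈ v≢ with v ≟ z
        ... | yes refl = ρ~z
        ... | no _ = par~ U v∈ v≢

        r< : ∀ {v} → v ∈ S → v ≢ ρ → rk U (par′ v) < rk U v
        r< {v} v∈ v≢ with v ≟ z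
        ... | yes refl = rk-root U v∈ v≢
        ... | no _ = rk-par U v∈ v≢

      regraft : Rooted S ρ
      regraft = record { par = par′ ; rk = rk U ; root∈ = root∈ U ; par∈ = p∈ ; par~ = p~ ; rk-par = r< ; rk-root = rk-root U }

      regraft-par : ∀ {v} → v ≢ z → par regraft v ≡ par U v
      regraft-par v≢ rewrite ≢⇒== v≢ = refl

      private
        agree : ∀ q v → v ≢ z → child regraft q v ≡ child U q v
        agree q v v≢ rewrite ≢⇒== v≢ = refl

        at : ∀ q → child regraft q z ≡ (ρ == q)
        at q rewrite ==-refl z | z∈ | ≢⇒== z≢ρ = refl

        at-old : ∀ q → child U q z ≡ (par U z == q)
        at-old q rewrite z∈ | ≢⇒== z≢ρ = refl

      regraft-deg-root : deg regraft ρ ≡ suc (deg U ρ)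
      regraft-deg-root = cong (_+ _) (#-step {P = child U ρ} {Q = child regraft ρ} z
        (trans (at-old ρ) (≢⇒== pz≢ρ)) (trans (at ρ) (==-refl ρ)) (agree ρ))

      regraft-deg-old : deg U (par U z) ≡ suc (deg regraft (par U z))
      regraft-deg-old = cong (_+ _) (#-step {P = child regraft (par U z)} {Q = child U (par U z)} z
        (trans (at _) (≢⇒== (pz≢ρ ∘ sym))) (trans (at-old _) (==-refl (par U z))) (λ v v≢ → sym (agree _ v v≢)))

      regraft-deg : ∀ {q} → q ≢ ρ → q ≢ par U z → deg regraft q ≡ deg U q
      regraft-deg {q} q≢ρ q≢p = cong (_+ _) (#-cong {P = child regraft q} {Q = child U q} pt)
        where
        pt : ∀ v → child regraft q v ≡ child U q v
        pt v with v ≟ z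
        ... | no v≢ = refl
        ... | yes refl rewrite z∈ | ≢⇒== z≢ρ | ≢⇒== (q≢ρ ∘ sym) | ≢⇒== (q≢p ∘ sym) = refl

    module Flip (c : Fin n) (c∈ : c ∈ S) (c≢ρ : c ≢ ρ) (pc : par U c ≡ ρ) where
      private
        par′ : Fin n → Fin n
        par′ v = if v == ρ then c else par U v
        rk′ : Fin n → ℕ
        -- The new and the old root take ranks 0 and 1; the shift by 2 keeps all others above them.
        rk′ v = if v == c then 0 else if v == ρ then 1 else 2 + rk U v

        p∈ : ∀ {v} → v ∈ S → v ≢ c → par′ v ∈ S
        p∈ {v} v∈ v≢ with v ≟ ρ
        ... | yes _ = c∈
        ... | no v≢ρ = par∈ U v∈ v≢ρ

        p~ : ∀ {v} → v ∈ S → v ≢ c → Adj G (par′ v) v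
        p~ {v} v∈ v≢ with v ≟ ρ
        ... | yes refl = trans (adj-sym G c ρ) (subst (λ p → Adj G p c) pc (par~ U c∈ c≢ρ))
        ... | no v≢ρ = par~ U v∈ v≢ρ

        rk-small : ∀ v → rk′ v ≤ 2 + rk U v
        rk-small v with v == c | v == ρ
        ... | true | _ = z≤n
        ... | false | true = s≤s z≤n
        ... | false | false = ≤-refl

        r< : ∀ {v} → v ∈ S → v ≢ c → rk′ (par′ v) < rk′ v
        r< {v} v∈ v≢ rewrite ≢⇒== v≢ with v ≟ ρ
        ... | yes refl rewrite ==-refl c = ≤-refl
        ... | no v≢ρ = ≤-trans (s≤s (rk-small (par U v))) (s≤s (s≤s (rk-par U v∈ v≢ρ)))

        r-root : ∀ {v} → v ∈ S → v ≢ c → rk′ c < rk′ v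
        r-root {v} v∈ v≢ rewrite ==-refl c | ≢⇒== v≢ with v ≟ ρ
        ... | yes _ = ≤-refl
        ... | no _ = s≤s z≤n

      flip : Rooted S c
      flip = record { par = par′ ; rk = rk′ ; root∈ = c∈ ; par∈ = p∈ ; par~ = p~ ; rk-par = r< ; rk-root = r-root }

      flip-par : ∀ {v} → v ≢ ρ → par flip v ≡ par U v
      flip-par v≢ rewrite ≢⇒== v≢ = refl

      private
        agree : ∀ q v → v ≢ c → v ≢ ρ → child flip q v ≡ child U q v
        agree q v v≢c v≢ρ rewrite ≢⇒== v≢c | ≢⇒== v≢ρ = refl

        at-c : ∀ q → child flip q c ≡ false
        at-c q rewrite ==-refl c | c∈ = refl

        at-ρ : ∀ q → child flip q ρ ≡ (c == q)
        at-ρ q rewrite ==-refl ρ | root∈ U | ≢⇒== (c≢ρ ∘ sym) = refl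

        old-c : ∀ q → child U q c ≡ (ρ == q)
        old-c q rewrite c∈ | ≢⇒== c≢ρ | pc = refl

        old-ρ : ∀ q → child U q ρ ≡ false
        old-ρ q rewrite ==-refl ρ | root∈ U = refl

        at-new-root : ch flip c ≡ suc (ch U c)
        at-new-root = #-step {P = child U c} {Q = child flip c} ρ (old-ρ c) (trans (at-ρ c) (==-refl c)) pt
          where
          pt : ∀ v → v ≢ ρ → child flip c v ≡ child U c v
          pt v v≢ = case v ≟ c of λ where
            (yes refl) → trans (at-c c) (sym (trans (old-c c) (≢⇒== (c≢ρ ∘ sym))))
            (no v≢c) → agree c v v≢c v≢

        at-old-root : ch U ρ ≡ suc (ch flip ρ)
        at-old-root = #-step {P = child flip ρ} {Q = child U ρ} c (at-c ρ) (trans (old-c ρ) (==-refl ρ)) pt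
          where
          pt : ∀ v → v ≢ c → child U ρ v ≡ child flip ρ v
          pt v v≢ = case v ≟ ρ of λ where
            (yes refl) → trans (old-ρ ρ) (sym (trans (at-ρ ρ) (≢⇒== c≢ρ)))
            (no v≢ρ) → sym (agree ρ v v≢ v≢ρ)

        elsewhere : ∀ {q} → q ≢ ρ → q ≢ c → ch flip q ≡ ch U q
        elsewhere {q} q≢ρ q≢c = #-cong {P = child flip q} {Q = child U q} pt
          where
          pt : ∀ v → child flip q v ≡ child U q v
          pt v = case (v ≟ ρ) , (v ≟ c) of λ where
            (yes refl , _) → trans (at-ρ q) (trans (≢⇒== (q≢c ∘ sym)) (sym (old-ρ q)))
            (no v≢ρ , yes refl) → trans (at-c q) (sym (trans (old-c q) (≢⇒== (q≢ρ ∘ sym))))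
            (no v≢ρ , no v≢c) → agree q v v≢c v≢ρ

      flip-deg : ∀ q → deg flip q ≡ deg U q
      flip-deg q = case (q ≟ ρ) , (q ≟ c) of λ where
        (yes refl , _) → trans (deg-nonroot flip (c≢ρ ∘ sym)) (trans (sym at-old-root) (sym (deg-root U)))
        (no q≢ρ , yes refl) → trans (deg-root flip) (trans at-new-root (sym (deg-nonroot U c≢ρ)))
        (no q≢ρ , no q≢c) → trans (deg-nonroot flip q≢c) (trans (cong suc (elsewhere q≢ρ q≢c)) (sym (deg-nonroot U q≢ρ)))

  -- The field `above` is the induction invariant of `reroot`: once the root has arrived at the
  -- parent of `q`, this is still the parent of `q`, so that the next flip applies.
  record Rerooted {S : Sub n} {ρ : Fin n} (U : Rooted S ρ) (q : Fin n) : Set where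
    field
      tree   : Rooted S q
      degs   : ∀ v → deg tree v ≡ deg U v
      above  : ∀ {v} → v ∈ S → rk U q < rk U v → par tree v ≡ par U v

  -- The recursion brings the root to the parent of `q` and then flips the last edge; it ends
  -- because ranks fall along the way.
  reroot : ∀ {S ρ} (U : Rooted S ρ) {q} → q ∈ S → Rerooted U q
  reroot {S} {ρ} U {q} q∈ = go (suc (rk U q)) q∈ ≤-refl
    where
    go : ∀ m {q} → q ∈ S → rk U q < m → Rerooted U q
    go (suc m) {q} q∈ (s≤s r≤m) with q ≟ ρ
    ... | yes refl = record { tree = U ; degs = λ _ → refl ; above = λ _ _ → refl }
    ... | no q≢ with go m (par∈ U q∈ q≢) (<-≤-trans (rk-par U q∈ q≢) r≤m)
    ... | record { tree = U₁ ; degs = d₁ ; above = a₁ } = record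
          { tree = F.flip
          ; degs = λ v → trans (F.flip-deg v) (d₁ v)
          ; above = λ v∈ r → trans (F.flip-par λ { refl → <-irrefl refl (<-trans (rk-par U q∈ q≢) r) })
                                   (a₁ v∈ (<-trans (rk-par U q∈ q≢) r)) }
      where
      module F = Flip U₁ q q∈ (λ q≡ → <-irrefl (cong (rk U) (sym q≡)) (rk-par U q∈ q≢))
                        (a₁ q∈ (rk-par U q∈ q≢))

walk-trans : ∀ {n} {G : Graph n} {u v w} → Walk G u v → Walk G v w → Walk G u w
walk-trans here q = q
walk-trans (step a p) q = step a (walk-trans p q)

walk-sym : ∀ {n} {G : Graph n} {u v} → Walk G u v → Walk G v u
walk-sym here = here
walk-sym {G = G} (step a p) = walk-trans (walk-sym p) (step (trans (adj-sym G _ _) a) here)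

_isᵇ_ : ℕ → ℕ → Bool
a isᵇ b = does (a ≟ℕ b)

does-true : ∀ {A : Set} (d : Dec A) → does d ≡ true → A
does-true (yes p) _ = p

does-false : ∀ {A : Set} (d : Dec A) → does d ≡ false → ¬ A
does-false (no p) _ = p

isᵇ-elim : ∀ {a b} → a isᵇ b ≡ true → a ≡ b
isᵇ-elim {a} {b} = does-true (a ≟ℕ b)

isᵇ-intro : ∀ {a b} → a ≡ b → a isᵇ b ≡ true
isᵇ-intro {a} {b} = dec-true (a ≟ℕ b)

isᵇ-false : ∀ {a b} → a isᵇ b ≡ false → a ≢ b
isᵇ-false {a} {b} = does-false (a ≟ℕ b)

-- Leaves of rooted trees, and spanning rooted trees as graphs

module HITs {n : ℕ} (G : Graph n) where
  open Trees G public
  open Rooted public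

  leaf : ∀ {S ρ} → Rooted S ρ → Sub n
  leaf {S} U v = S v ∧ (deg U v isᵇ 1)

  nonleaves : ∀ {S ρ} → Rooted S ρ → ℕ
  nonleaves U = # (∁ (leaf U))

  leaf-intro : ∀ {S ρ} (U : Rooted S ρ) {v} → v ∈ S → deg U v ≡ 1 → v ∈ leaf U
  leaf-intro U v∈ d = ∧-intro v∈ (isᵇ-intro d)

  leaf-elim : ∀ {S ρ} (U : Rooted S ρ) {v} → v ∈ leaf U → v ∈ S × deg U v ≡ 1
  leaf-elim {S} U {v} e with ∧-elim {S v} e
  ... | a , b = a , isᵇ-elim b

  Irreducible : ∀ {S ρ} → Rooted S ρ → Set
  Irreducible {S} U = ∀ {v} → v ∈ S → deg U v ≢ 2

  module _ {S ρ} (U : Rooted S ρ) (full : ∀ v → v ∈ S) where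

    private
      no-loop : ∀ v → v ∉ child U v
      no-loop v = ¬true λ e → let (v∈ , v≢ , p) = child-elim U e in
        <-irrefl (cong (rk U) p) (rk-par U v∈ v≢)

      child-rk : ∀ {q v} → v ∈ child U q → rk U q < rk U v
      child-rk e = let (v∈ , v≢ , p) = child-elim U e in subst (λ q → rk U q < rk U _) p (rk-par U v∈ v≢)

      child-par : ∀ {q v} → v ∈ child U q → par U v ≡ q
      child-par e = proj₂ (proj₂ (child-elim U e))

    spanned : Graph n
    spanned = record
      { adj = λ a b → child U a b ∨ child U b a
      ; sym = λ a b → ∨-comm (child U a b) (child U b a)
      ; irrefl = λ a → cong₂ _∨_ (no-loop a) (no-loop a) }

    private
      T = spanned

      edge : ∀ {a b} → Adj T a b → (b ∈ child U a) ⊎ (a ∈ child U b)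
      edge {a} {b} = ∨-elim {child U a b}

      subgraph : T ⊆ᴱ G
      subgraph a b e with edge e
      ... | inj₁ c with child-elim U c
      ... | b∈ , b≢ , refl = par~ U b∈ b≢
      subgraph a b e | inj₂ c with child-elim U c
      ... | a∈ , a≢ , refl = trans (adj-sym G a b) (par~ U a∈ a≢)

      to-root : ∀ m v → rk U v < m → Walk T v ρ
      to-root (suc m) v (s≤s r≤) with v ≟ ρ
      ... | yes refl = here
      ... | no v≢ = step {w = par U v} (∨-introʳ {child U v (par U v)} (child-intro U (full v) v≢ refl))
                         (to-root m (par U v) (<-≤-trans (rk-par U (full v) v≢) r≤))

      connected : Connected T
      connected u v = walk-trans (to-root _ u ≤-refl) (walk-sym (to-root _ v ≤-refl))

      -- A path in a rooted tree first descends towards the root and then ascends.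
      ascending : ∀ a b ms w → Unique (a ∷ b ∷ ms ++ [ w ]) → Linked (Adj T) (a ∷ b ∷ ms ++ [ w ]) →
        b ∈ child U a → rk U a < rk U w × par U w ∈ᴸ b ∷ ms
      ascending a b [] w ((_ ∷ a≢w ∷ _) ∷ _) (_ ∷ bw ∷ _) ab with edge bw
      ... | inj₁ c = <-trans (child-rk ab) (child-rk c) , here (child-par c)
      ... | inj₂ c = ⊥-elim (a≢w (trans (sym (child-par ab)) (child-par c)))
      ascending a b (c ∷ ms) w ((_ ∷ a≢c ∷ _) ∷ uniq) (_ ∷ bc ∷ link) ab with edge bc
      ... | inj₂ d = ⊥-elim (a≢c (trans (sym (child-par ab)) (child-par d)))
      ... | inj₁ d with ascending b c ms w uniq (bc ∷ link) d
      ... | r , p = <-trans (child-rk ab) r , there p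

      -- Either the path runs towards the root until its end, or it turns at some vertex and
      -- `ascending` applies from there.
      descending : ∀ a b ms w → Unique (a ∷ b ∷ ms ++ [ w ]) → Linked (Adj T) (a ∷ b ∷ ms ++ [ w ]) →
        a ∈ child U b → (rk U w < rk U a) ⊎ (par U w ∈ᴸ b ∷ ms)
      descending a b [] w _ (_ ∷ bw ∷ _) ba with edge bw
      ... | inj₁ c = inj₂ (here (child-par c))
      ... | inj₂ c = inj₁ (<-trans (child-rk c) (child-rk ba))
      descending a b (c ∷ ms) w (_ ∷ uniq) (_ ∷ bc ∷ link) ba with edge bc
      ... | inj₁ d = inj₂ (there (proj₂ (ascending b c ms w uniq (bc ∷ link) d)))
      ... | inj₂ d with descending b c ms w uniq (bc ∷ link) d
      ... | inj₁ r = inj₁ (<-trans r (child-rk ba))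
      ... | inj₂ p = inj₂ (there p)

      ∈-init : ∀ {x : Fin n} {y} ms → x ∈ᴸ ms → x ∈ᴸ (ms ++ [ y ])
      ∈-init (m ∷ ms) (here e) = here e
      ∈-init (m ∷ ms) (there e) = there (∈-init ms e)

      ∈-last : ∀ {x : Fin n} ms → x ∈ᴸ (ms ++ [ x ])
      ∈-last [] = here refl
      ∈-last (m ∷ ms) = there (∈-last ms)

      -- The first edge and the closing edge are oriented by parenthood. In each of the four cases
      -- either a rank would be smaller than itself, or the parent of `u` or `w` would be met twice
      -- on the cycle.
      acyclic : Acyclic T
      acyclic (u , m , ms , w , (u≢ ∷ uniq) , (um ∷ link) , wu) with edge um | edge wu
      ... | inj₁ up | inj₁ c = <-irrefl refl (<-trans (proj₁ (ascending u m ms w (u≢ ∷ uniq) (um ∷ link) up)) (child-rk c))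
      ... | inj₁ up | inj₂ c = All-lookup u≢ (∈-init (m ∷ ms) (proj₂ (ascending u m ms w (u≢ ∷ uniq) (um ∷ link) up))) (sym (child-par c))
      acyclic (u , m , ms , w , (u≢ ∷ m≢ ∷ uniq) , (um ∷ link) , wu) | inj₂ dn | inj₁ c =
        All-lookup m≢ (∈-last ms) (trans (sym (child-par dn)) (child-par c))
      acyclic (u , m , ms , w , (u≢ ∷ uniq) , (um ∷ link) , wu) | inj₂ dn | inj₂ c
        with descending u m ms w (u≢ ∷ uniq) (um ∷ link) dn
      ... | inj₁ r = <-irrefl refl (<-trans r (child-rk c))
      ... | inj₂ p = All-lookup u≢ (∈-init (m ∷ ms) p) (sym (child-par c))

      parents : ∀ v → # (λ b → child U b v) ≡ [ not (v == ρ) ]ᵇ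
      parents v = case v ≟ ρ of λ where
        (yes refl) → trans (#-empty {P = λ b → child U b v} λ b → ¬true λ e → proj₁ (proj₂ (child-elim U e)) refl)
                           (cong (λ b → [ not b ]ᵇ) (sym (==-refl v)))
        (no v≢) → trans (#-cong {P = λ b → child U b v} {Q = ⁅ par U v ⁆} λ b → bool-ext
                     (λ e → subst (λ q → (b == q) ≡ true) (sym (child-par e)) (==-refl b))
                     (λ e → child-intro U (full v) v≢ (sym (==⇒≡ e))))
                   (trans (#-⁅⁆ (par U v)) (cong (λ b → [ not b ]ᵇ) (sym (≢⇒== v≢))))

      degree-spanned : ∀ v → degree T v ≡ deg U v
      degree-spanned v = trans (degree-# T v) (trans
        (#-⊎ (child U v) (λ b → child U b v) λ b c → ¬true λ d → <-irrefl refl (<-trans (child-rk c) (child-rk d)))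
        (cong (ch U v +_) (parents v)))

    spanning-HIST : Irreducible U → HasHIST G
    spanning-HIST irr = T , (subgraph , connected , acyclic) , λ v d → irr (full v) (trans (sym (degree-spanned v)) d)

  -- The tree lemma behind all enlargements: a tree whose only vertex of degree 2 is its root can be repaired
  -- without changing its vertex set unless the root has few neighbours in it.
  module Repair {S ρ} (U : Rooted S ρ) (dρ : deg U ρ ≡ 2) (irr : ∀ {v} → v ∈ S → v ≢ ρ → deg U v ≢ 2) where

    private
      -- The candidates for a move to the root.
      far : Sub n
      far z = (S z ∧ adj G ρ z) ∧ not (par U z == ρ)

      cubic : Sub n
      cubic v = (S v ∧ not (v == ρ)) ∧ (deg U v isᵇ 3)

      far-elim : ∀ {z} → z ∈ far → z ∈ S × Adj G ρ z × par U z ≢ ρ × z ≢ ρ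
      far-elim {z} e with ∖-elim {S z ∧ adj G ρ z} e
      ... | a , b with ∧-elim {S z} a
      ... | c , d = c , d , ==⇒≢ b , λ { refl → true≢false d (adj-irrefl G z) }

      par-deg : ∀ {z} → z ∈ far → 3 ≤ deg U (par U z)
      par-deg {z} e with far-elim e
      ... | z∈ , _ , p≢ , z≢ with par∈ U z∈ z≢ | root-ch>0 U z∈ z≢
      ... | p∈ | c with irr p∈ p≢ | deg-nonroot U p≢
      ... | ≢2 | eq with ch U (par U z) | deg U (par U z)
      par-deg e | _ | p∈ | s≤s _ | ≢2 | refl | suc zero | _ = ⊥-elim (≢2 refl)
      par-deg e | _ | p∈ | s≤s _ | ≢2 | refl | suc (suc _) | _ = s≤s (s≤s (s≤s z≤n))

    -- The field `keeps` says that no leaf is lost, so the number of non-leaves does not grow.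
    record Repaired : Set where
      field
        tree  : Rooted S ρ
        irred : Irreducible tree
        keeps : ∀ {v} → v ∈ S → deg U v ≡ 1 → deg tree v ≡ 1

    -- When neither kind of move applies, the parent map sends `far` injectively into `cubic`; the 2
    -- counts the children of the root.
    record Blocked : Set where
      field
        few   : # (S ∩ adj G ρ) ≤ 2 + # cubic
        par-3 : ∀ {z} → z ∈ S → Adj G ρ z → par U z ≢ ρ → deg U (par U z) ≡ 3

    private
      ρ-not-1 : ∀ {v} → deg U v ≡ 1 → v ≢ ρ
      ρ-not-1 d refl with trans (sym d) dρ
      ... | ()

      -- The root rises to degree 3, and the old parent, of degree at least 4, keeps at least 3.
      move-one : ∀ {z} → z ∈ far → deg U (par U z) ≢ 3 → Repaired
      move-one {z} e d≢3 with far-elim e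
      ... | z∈ , ρ~z , p≢ , z≢ = record { tree = R.regraft ; irred = ir ; keeps = kp }
        where
        module R = Regraft U z z∈ z≢ p≢ ρ~z
        ir : Irreducible R.regraft
        ir {v} v∈ d = case (v ≟ ρ) , (v ≟ par U z) of λ where
          (yes refl , _) → case trans (sym (trans R.regraft-deg-root (cong suc dρ))) d of λ ()
          (no v≢ , yes refl) → d≢3 (trans R.regraft-deg-old (cong suc d))
          (no v≢ , no v≢p) → irr v∈ v≢ (trans (sym (R.regraft-deg v≢ v≢p)) d)
        kp : ∀ {v} → v ∈ S → deg U v ≡ 1 → deg R.regraft v ≡ 1
        kp v∈ d = trans (R.regraft-deg (ρ-not-1 d) λ { refl → case subst (3 ≤_) d (par-deg e) of λ { (s≤s ()) } }) d

      -- The root rises to degree 4, and the old parent drops from 3 past 2 to 1 and becomes a leaf.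
      move-two : ∀ {z z'} → z ∈ far → z' ∈ far → z' ≢ z → par U z' ≡ par U z → deg U (par U z) ≡ 3 → Repaired
      move-two {z} {z'} e e' z'≢z pp d3 with far-elim e | far-elim e'
      ... | z∈ , ρ~z , p≢ , z≢ | z'∈ , ρ~z' , p'≢ , z'≢ = record { tree = R'.regraft ; irred = ir ; keeps = kp }
        where
        module R = Regraft U z z∈ z≢ p≢ ρ~z
        p₁ : par R.regraft z' ≡ par U z
        p₁ = trans (R.regraft-par z'≢z) pp
        module R' = Regraft R.regraft z' z'∈ z'≢ (λ q → p≢ (trans (sym p₁) q)) ρ~z'
        d₂ : deg R'.regraft (par U z) ≡ 1
        d₂ = suc-injective (suc-injective (trans (cong suc (subst (λ q → suc (deg R'.regraft q) ≡ deg R.regraft q) p₁ (sym R'.regraft-deg-old)))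
               (trans (sym R.regraft-deg-old) d3)))
        dd : ∀ {v} → v ≢ ρ → v ≢ par U z → deg R'.regraft v ≡ deg U v
        dd v≢ v≢p = trans (R'.regraft-deg v≢ (λ q → v≢p (trans q p₁))) (R.regraft-deg v≢ v≢p)
        ir : Irreducible R'.regraft
        ir {v} v∈ d = case (v ≟ ρ) , (v ≟ par U z) of λ where
          (yes refl , _) → case trans (sym (trans R'.regraft-deg-root (cong suc (trans R.regraft-deg-root (cong suc dρ))))) d of λ ()
          (no v≢ , yes refl) → case trans (sym d₂) d of λ ()
          (no v≢ , no v≢p) → irr v∈ v≢ (trans (sym (dd v≢ v≢p)) d)
        kp : ∀ {v} → v ∈ S → deg U v ≡ 1 → deg R'.regraft v ≡ 1
        kp {v} v∈ d = case v ≟ par U z of λ where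
          (yes refl) → d₂
          (no v≢p) → trans (dd (ρ-not-1 d) v≢p) d

      twin : Fin n → Sub n
      twin z z' = (far z' ∧ (par U z' == par U z)) ∧ not (z' == z)

    repair : Repaired ⊎ Blocked
    repair with search (λ z → far z ∧ not (deg U (par U z) isᵇ 3))
    ... | inj₁ (z , e) = let (a , b) = ∖-elim {far z} e in inj₁ (move-one a (isᵇ-false b))
    ... | inj₂ none = continue
      where
      all3 : ∀ {z} → z ∈ far → deg U (par U z) ≡ 3
      all3 {z} e with bool (deg U (par U z) isᵇ 3)
      ... | inj₁ t = isᵇ-elim t
      ... | inj₂ f = ⊥-elim (true≢false (∖-intro e f) (none z))

      continue : Repaired ⊎ Blocked
      continue with search (λ z → far z ∧ does (1 ≤? # (twin z)))
      ... | inj₁ (z , e) with ∧-elim {far z} e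
      ... | a , b with #>0⇒∃ (twin z) (does-true (1 ≤? # (twin z)) b)
      ... | z' , t with ∖-elim {far z' ∧ (par U z' == par U z)} t
      ... | t₁ , t₂ with ∧-elim {far z'} t₁
      ... | t₃ , t₄ = inj₁ (move-two a t₃ (==⇒≢ t₂) (==⇒≡ t₄) (all3 a))
      continue | inj₂ single = inj₂ (record
        { few = ≤-trans (#-mono {P = S ∩ adj G ρ} {Q = child U ρ ∪ far} cover)
                 (≤-trans (#-∪ (child U ρ) far) (+-mono-≤ (≤-reflexive (trans (sym (deg-root U)) dρ)) far≤))
        ; par-3 = λ z∈ a p≢ → all3 (∖-intro (∧-intro z∈ a) (≢⇒== p≢)) })
        where
        cover : ∀ v → v ∈ S ∩ adj G ρ → v ∈ child U ρ ∪ far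
        cover v e with ∧-elim {S v} e
        ... | v∈ , a = case par U v ≟ ρ of λ where
          (yes p) → ∨-introˡ (child-intro U v∈ (λ { refl → true≢false a (adj-irrefl G v) }) p)
          (no p) → ∨-introʳ {child U ρ v} (∖-intro (∧-intro v∈ a) (≢⇒== p))
        inj : ∀ {u v} → u ∈ far → v ∈ far → par U u ≡ par U v → u ≡ v
        inj {u} {v} a b p = case u ≟ v of λ where
          (yes q) → q
          (no q) → ⊥-elim (true≢false
            (∧-intro b (dec-true (1 ≤? # (twin v)) (∈⇒#>0 (twin v) {u} (∖-intro
              (∧-intro a (subst (λ r → (par U u == r) ≡ true) p (==-refl (par U u)))) (≢⇒== q)))))
            (single v))
        far≤ : # far ≤ # cubic
        far≤ = #-injective {P = far} {Q = cubic} (par U) (λ z e → let (z∈ , _ , p≢ , z≢) = far-elim e in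
                 ∧-intro (∖-intro (par∈ U z∈ z≢) (≢⇒== p≢)) (isᵇ-intro (all3 e))) inj

-- The growth step

infixr 4 _⊕_
_⊕_ : ∀ {a b c d} → a ≤ b → c ≤ d → a + c ≤ b + d
_⊕_ = +-mono-≤

double : ∀ {m n} → m ≤ n → 2 * m ≤ 2 * n
double = *-monoʳ-≤ 2

-- Linear arithmetic by certificate: suitable multiples of the available inequalities are added with
-- `_⊕_` to give `l ≤ r`, and the ring solver confirms that `l` exceeds `r` by `1 + k`.
clash : ∀ {l r} k → l ≤ r → l ≡ suc (k + r) → ⊥
clash {r = r} k h refl = <-irrefl refl (≤-trans (s≤s (m≤n+m r k)) h)

-- Turns a test at each vertex into a dichotomy: success at some vertex, or a property of all of
-- them.
collect : ∀ {n} {A : Set} {B : Fin n → Set} → (∀ v → A ⊎ B v) → A ⊎ (∀ v → B v)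
collect {zero} f = inj₂ λ ()
collect {suc n} f with f zero | collect (f ∘ suc)
... | inj₁ a | _ = inj₁ a
... | inj₂ _ | inj₁ a = inj₁ a
... | inj₂ b | inj₂ g = inj₂ λ { zero → b ; (suc v) → g v }

collect₂ : ∀ {n} {A : Set} {B : Fin n → Fin n → Set} → (∀ u v → A ⊎ B u v) → A ⊎ (∀ u v → B u v)
collect₂ f = collect (λ u → collect (f u))

-- The 2 stands on the right to avoid truncated subtraction.
DegreeSum : ∀ {n} → Graph n → Set
DegreeSum {n} G = ∀ {u v} → u ≢ v → adj G u v ≡ false → n ≤ 2 + # (adj G u) + # (adj G v)

module _ {n : ℕ} (G : Graph n) where

  -- A description of `D_n` without labels: `w` is the end of the path, `x` its middle, and `p` the
  -- clique vertex that carries it.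
  record Pendant : Set where
    field
      w x p   : Fin n
      w≢x     : w ≢ x
      w≢p     : w ≢ p
      x≢p     : x ≢ p
      adj-w   : ∀ v → adj G w v ≡ (v == x)
      adj-x   : ∀ v → adj G x v ≡ (v == w) ∨ (v == p)
      rest    : ∀ {y z} → y ≢ w → y ≢ x → z ≢ w → z ≢ x → y ≢ z → Adj G y z

boundary-edge : ∀ {n} (G : Graph n) (S : Sub n) {u v} → Walk G u v → u ∈ S → v ∉ S →
  ∃ λ a → ∃ λ b → a ∈ S × b ∉ S × Adj G a b
boundary-edge G S here u∈ v∉ = ⊥-elim (true≢false u∈ v∉)
boundary-edge G S {u} (step {w = w} a p) u∈ v∉ with bool (S w)
... | inj₁ w∈ = boundary-edge G S p w∈ v∉
... | inj₂ w∉ = u , w , u∈ , w∉ , a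

module Growth {n : ℕ} (G : Graph n) (σ : DegreeSum G) where

  open HITs G public

  ~-sym : ∀ {u v} → Adj G u v → Adj G v u
  ~-sym {u} {v} e = trans (adj-sym G v u) e

  ~⇒≢ : ∀ {u v} → Adj G u v → u ≢ v
  ~⇒≢ {u} e refl = true≢false e (adj-irrefl G u)

  record HIT : Set where
    field
      S    : Sub n
      ρ    : Fin n
      tree : Rooted S ρ
      irr  : Irreducible tree

    nl out : ℕ
    nl  = nonleaves tree
    out = # (∁ S)

  ∉S-intro : ∀ {S : Sub n} {v} → v ∉ S → v ∈ ∁ S
  ∉S-intro e rewrite e = refl

  module _ {S ρ} (U : Rooted S ρ) {x} (x∈ : x ∈ S) (P : Sub n) (new : ∀ {v} → v ∈ P → v ∉ S)
           (x~ : ∀ {v} → v ∈ P → Adj G x v) where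

    open Graft U x x∈ P new x~

    private
      P≢x : ∀ {v} → v ∈ P → v ≢ x
      P≢x v∈ refl = true≢false x∈ (new v∈)

      still : ∀ {v} → v ≢ x → v ∈ ∁ (leaf graft) → v ∈ ∁ (leaf U) ∖ P
      still {v} v≢ e with bool (P v)
      ... | inj₁ v∈P = ⊥-elim (true≢false (leaf-intro graft (∨-introʳ {S v} v∈P)
                         (trans (graft-deg v≢) (deg-outside U (new v∈P)))) (not-true e))
      ... | inj₂ v∉P with bool (leaf U v)
      ... | inj₁ l = let (v∈ , d) = leaf-elim U l in
                     ⊥-elim (true≢false (leaf-intro graft (∨-introˡ v∈) (trans (graft-deg v≢) d)) (not-true e))
      ... | inj₂ l = ∖-intro (∉S-intro {leaf U} l) v∉P

      P-nonleaf : # P + # (∁ (leaf U) ∖ P) ≡ nonleaves U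
      P-nonleaf = sym (trans (#-split (∁ (leaf U)) P) (cong (_+ # (∁ (leaf U) ∖ P)) (#-cong {P = ∁ (leaf U) ∩ P} {Q = P} λ v → bool-ext
          (λ e → proj₂ (∧-elim {∁ (leaf U) v} e)) (λ e → ∧-intro (P-nl e) e))))
        where
        P-nl : ∀ {v} → v ∈ P → v ∈ ∁ (leaf U)
        P-nl {v} v∈P rewrite new v∈P = refl

    -- The vertices of `P` turn from non-leaves into leaves, and only `x` can turn the other way.
    graft-nl : # P + nonleaves graft ≤ suc (nonleaves U)
    graft-nl = ≤-trans (+-monoʳ-≤ (# P) (≤-trans (#-mono {P = ∁ (leaf graft)} {Q = ⁅ x ⁆ ∪ (∁ (leaf U) ∖ P)} cover)
        (#-∪ ⁅ x ⁆ (∁ (leaf U) ∖ P))))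
        (≤-reflexive (trans (cong (λ k → # P + (k + # (∁ (leaf U) ∖ P))) (#-⁅⁆ x)) (trans (+-suc (# P) _) (cong suc P-nonleaf))))
      where
      cover : ∀ v → v ∈ ∁ (leaf graft) → v ∈ ⁅ x ⁆ ∪ (∁ (leaf U) ∖ P)
      cover v e = case v ≟ x of λ where
        (yes refl) → ∨-introˡ (==-refl v)
        (no v≢) → ∨-introʳ {v == x} (still v≢ e)

    graft-nl-internal : deg U x ≢ 1 → # P + nonleaves graft ≤ nonleaves U
    graft-nl-internal d≢ = ≤-trans (+-monoʳ-≤ (# P) (#-mono {P = ∁ (leaf graft)} {Q = ∁ (leaf U) ∖ P} cover)) (≤-reflexive P-nonleaf)
      where
      cover : ∀ v → v ∈ ∁ (leaf graft) → v ∈ ∁ (leaf U) ∖ P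
      cover v e = case v ≟ x of λ where
        (yes refl) → ∖-intro (∉S-intro {leaf U} (¬true λ l → d≢ (proj₂ (leaf-elim U l)))) (¬true λ v∈ → P≢x v∈ refl)
        (no v≢) → still v≢ e

    graft-out : # P + # (∁ (S ∪ P)) ≡ # (∁ S)
    graft-out = sym (trans (#-split (∁ S) P) (cong₂ _+_
      (#-cong {P = ∁ S ∩ P} {Q = P} λ v → bool-ext (λ e → proj₂ (∧-elim {∁ S v} e)) (λ e → ∧-intro (∉S-intro {S} (new e)) e))
      (#-cong {P = ∁ S ∖ P} {Q = ∁ (S ∪ P)} λ v → de-morgan (S v) (P v))))
      where
      de-morgan : ∀ a b → not a ∧ not b ≡ not (a ∨ b)
      de-morgan true _ = refl
      de-morgan false _ = refl

    graft-irr : (∀ {v} → v ∈ S → v ≢ x → deg U v ≢ 2) → # P + deg U x ≢ 2 → Irreducible graft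
    graft-irr ir d≢ {v} v∈ d = case v ≟ x of λ where
      (yes refl) → d≢ (trans (sym graft-deg-at) d)
      (no v≢) → case ∨-elim {S v} v∈ of λ where
        (inj₁ v∈S) → ir v∈S v≢ (trans (sym (graft-deg v≢)) d)
        (inj₂ v∈P) → case trans (sym (trans (graft-deg v≢) (deg-outside U (new v∈P)))) d of λ ()

  Cubic : ∀ {S ρ} → Rooted S ρ → Sub n
  Cubic {S} U v = S v ∧ (deg U v isᵇ 3)

  module Step (T : HIT) where
    open HIT T

    Progress : Set
    Progress = Σ HIT λ T' → HIT.nl T' ≤ nl × HIT.out T' < out

    private
      i₀ = # (Cubic tree)

      new₁ : ∀ {w} → w ∉ S → ∀ {v} → v ∈ ⁅ w ⁆ → v ∉ S
      new₁ w∉ e = trans (cong S (==⇒≡ e)) w∉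

      adj₁ : ∀ {x w} → Adj G x w → ∀ {v} → v ∈ ⁅ w ⁆ → Adj G x v
      adj₁ {x} a e = trans (cong (adj G x) (==⇒≡ e)) a

    -- A degree other than 1 is raised to a degree other than 2.
    internal-boundary : ∀ x w → x ∈ S → w ∉ S → Adj G x w → deg tree x ≢ 1 → Progress
    internal-boundary x w x∈ w∉ a d≢ = record { tree = Gr.graft ; irr = graft-irr tree x∈ ⁅ w ⁆ new xw (λ v∈ _ → irr v∈) d' }
        , ≤-trans (m≤n+m _ _) (graft-nl-internal tree x∈ ⁅ w ⁆ new xw d≢)
        , ≤-reflexive (trans (cong (_+ # (∁ (S ∪ ⁅ w ⁆))) (sym (#-⁅⁆ w))) (graft-out tree x∈ ⁅ w ⁆ new xw))
      where
      new : ∀ {v} → v ∈ ⁅ w ⁆ → v ∉ S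
      new = new₁ w∉
      xw : ∀ {v} → v ∈ ⁅ w ⁆ → Adj G x v
      xw = adj₁ a
      module Gr = Graft tree x x∈ ⁅ w ⁆ new xw
      d' : # ⁅ w ⁆ + deg tree x ≢ 2
      d' e = d≢ (suc-injective (trans (cong (_+ _) (sym (#-⁅⁆ w))) e))

    -- Both vertices are attached at once, so that the leaf `x` jumps from degree 1 to 3.
    double-boundary : ∀ x w w' → x ∈ S → w ∉ S → w' ∉ S → Adj G x w → Adj G x w' → w ≢ w' → deg tree x ≡ 1 → Progress
    double-boundary x w w' x∈ w∉ w'∉ a a' w≢ d = record { tree = Gr.graft ; irr = graft-irr tree x∈ P new xP (λ v∈ _ → irr v∈) d' }
        , s≤s⁻¹ (≤-trans (≤-trans (n≤1+n _) (≤-reflexive (cong (_+ nonleaves Gr.graft) (sym P2)))) (graft-nl tree x∈ P new xP))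
        , ≤-trans (m≤n+m _ 1) (≤-reflexive (trans (cong (_+ # (∁ (S ∪ P))) (sym P2)) (graft-out tree x∈ P new xP)))
      where
      P : Sub n
      P = ⁅ w ⁆ ∪ ⁅ w' ⁆
      new : ∀ {v} → v ∈ P → v ∉ S
      new {v} e = [ new₁ w∉ , new₁ w'∉ ]′ (∨-elim {v == w} e)
      xP : ∀ {v} → v ∈ P → Adj G x v
      xP {v} e = [ adj₁ a , adj₁ a' ]′ (∨-elim {v == w} e)
      P2 : # P ≡ 2
      P2 = trans (#-⊎ ⁅ w ⁆ ⁅ w' ⁆ λ v e → ≢⇒== {a = v} λ q → w≢ (trans (sym (==⇒≡ e)) q)) (cong₂ _+_ (#-⁅⁆ w) (#-⁅⁆ w'))
      module Gr = Graft tree x x∈ P new xP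
      d' : # P + deg tree x ≢ 2
      d' e rewrite P2 | d = case e of λ ()

    -- The outcome at a leaf that blocks growth. The first alternative arises when `x` can take one
    -- child from `q`; the second says that the tree neighbour of `x` is its only neighbour in the
    -- tree.
    Analysis : Fin n → Set
    Analysis x = # (adj G x) ≤ 2 + i₀ ×
      ((∃ λ q → q ∈ S × deg tree q ≡ 3 × # (adj G q) ≤ 2 + i₀) ⊎
       (Σ (Rerooted tree x) λ R → ∀ z → z ∈ S → Adj G x z → z ∈ child (Rerooted.tree R) x))

    -- The hypotheses `only` and `internal` hold once `double-boundary` and `internal-boundary`
    -- offer no progress. They confine the neighbourhoods of `x` and of internal vertices, so that
    -- bounds within the tree become bounds on degrees in `G`.
    module Leaf {x w} (x∈ : x ∈ S) (w∉ : w ∉ S) (xw : Adj G x w) (dx : deg tree x ≡ 1)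
                (only : ∀ v → v ∉ S → Adj G x v → v ≡ w) (internal : ∀ {q v} → q ∈ S → v ∉ S → Adj G q v → deg tree q ≡ 1) where

      private
        module R = Rerooted (reroot tree x∈)

      X : Rooted S x
      X = R.tree

      private
        module Gr = Graft X x x∈ ⁅ w ⁆ (new₁ w∉) (adj₁ xw)
        S⁺ = S ∪ ⁅ w ⁆
        U = Gr.graft

        x≢w : x ≢ w
        x≢w = ~⇒≢ xw

        U-deg : ∀ {v} → v ≢ x → deg U v ≡ deg tree v
        U-deg v≢ = trans (Gr.graft-deg v≢) (R.degs _)

        U-deg-x : deg U x ≡ 2
        U-deg-x = trans Gr.graft-deg-at (cong₂ _+_ (#-⁅⁆ w) (trans (R.degs x) dx))

        U-deg-w : deg U w ≡ 1
        U-deg-w = trans (Gr.graft-deg (x≢w ∘ sym)) (deg-outside X w∉)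

        in⁺ : ∀ {v} → v ∈ S⁺ → (v ∈ S) ⊎ (v ≡ w)
        in⁺ {v} e = case ∨-elim {S v} e of λ where
          (inj₁ a) → inj₁ a
          (inj₂ b) → inj₂ (==⇒≡ b)

        U-irr : ∀ {v} → v ∈ S⁺ → v ≢ x → deg U v ≢ 2
        U-irr v∈ v≢ d = case in⁺ v∈ of λ where
          (inj₁ v∈S) → irr v∈S (trans (sym (U-deg v≢)) d)
          (inj₂ refl) → case trans (sym U-deg-w) d of λ ()

        out⁺ : suc (# (∁ S⁺)) ≡ out
        out⁺ = trans (cong (_+ # (∁ S⁺)) (sym (#-⁅⁆ w))) (graft-out X x∈ ⁅ w ⁆ (new₁ w∉) (adj₁ xw))

        U-nl : nonleaves U ≤ nl
        U-nl = s≤s⁻¹ (≤-trans (≤-reflexive (cong (_+ nonleaves U) (sym (#-⁅⁆ w))))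
          (≤-trans (graft-nl X x∈ ⁅ w ⁆ (new₁ w∉) (adj₁ xw))
            (s≤s (≤-reflexive (#-cong {P = ∁ (leaf X)} {Q = ∁ (leaf tree)} λ v → cong (λ d → not (S v ∧ (d isᵇ 1))) (R.degs v))))))

        finish : ∀ {ρ'} (V : Rooted S⁺ ρ') → Irreducible V → (∀ {v} → v ∈ S⁺ → deg U v ≡ 1 → deg V v ≡ 1) → Progress
        finish V ir keep = record { tree = V ; irr = ir }
          , ≤-trans (#-mono {P = ∁ (leaf V)} {Q = ∁ (leaf U)} λ v e → ∉S-intro {leaf U} (¬true λ l →
              let (v∈ , d) = leaf-elim U l in true≢false (leaf-intro V v∈ (keep v∈ d)) (not-true e))) U-nl
          , ≤-reflexive out⁺

        finish-repaired : ∀ {ρ'} (V : Rooted S⁺ ρ') (dρ : deg V ρ' ≡ 2) (ir : ∀ {v} → v ∈ S⁺ → v ≢ ρ' → deg V v ≢ 2) →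
          (∀ {v} → v ∈ S⁺ → deg U v ≡ 1 → deg V v ≡ 1) → Repair.Repaired V dρ ir → Progress
        finish-repaired V dρ ir keep r = finish Rp.tree Rp.irred λ v∈ d → Rp.keeps v∈ (keep v∈ d)
          where module Rp = Repair.Repaired r

        module UR = Repair U U-deg-x U-irr

        U-cubic≤ : # (λ v → (S⁺ v ∧ not (v == x)) ∧ (deg U v isᵇ 3)) ≤ i₀
        U-cubic≤ = #-mono {Q = Cubic tree} λ v e → let (a , b) = ∧-elim {S⁺ v ∧ not (v == x)} e
                                                       (c , d) = ∖-elim {S⁺ v} a
                                                       d3 = trans (sym (U-deg (==⇒≢ d))) (isᵇ-elim b) in
          ∧-intro ([ id , (λ { refl → case trans (sym U-deg-w) (isᵇ-elim b) of λ () }) ]′ (in⁺ c)) (isᵇ-intro d3)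

      private
        -- x takes over its neighbour z from the cubic vertex q, leaving q with degree 2.
        module Steal (B : UR.Blocked) {z} (z∈ : z ∈ S) (xz : Adj G x z) (z∉ : z ∉ child X x) where
          z≢x : z ≢ x
          z≢x = ~⇒≢ xz ∘ sym

          q : Fin n
          q = par U z

          q-old : q ≡ par X z
          q-old = Gr.graft-par-old z∈

          q∈ : q ∈ S
          q∈ = subst (_∈ S) (sym q-old) (par∈ X z∈ z≢x)

          q≢x : q ≢ x
          q≢x e = true≢false (child-intro X z∈ z≢x (trans (sym q-old) e)) z∉

          q3 : deg U q ≡ 3
          q3 = UR.Blocked.par-3 B (∨-introˡ z∈) xz q≢x

          module Rg = Regraft U z (∨-introˡ z∈) z≢x q≢x xz

          V₀ = Rg.regraft

          module Rr = Rerooted (reroot V₀ {q} (∨-introˡ q∈))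

          V : Rooted S⁺ q
          V = Rr.tree

          V-deg-q : deg V q ≡ 2
          V-deg-q = trans (Rr.degs q) (suc-injective (trans (sym Rg.regraft-deg-old) q3))

          V-deg-x : deg V x ≡ 3
          V-deg-x = trans (Rr.degs x) (trans Rg.regraft-deg-root (cong suc U-deg-x))

          V-deg : ∀ {v} → v ≢ x → v ≢ q → deg V v ≡ deg U v
          V-deg v≢x v≢q = trans (Rr.degs _) (Rg.regraft-deg v≢x v≢q)

          V-irr : ∀ {v} → v ∈ S⁺ → v ≢ q → deg V v ≢ 2
          V-irr {v} v∈ v≢q d = case v ≟ x of λ where
            (yes refl) → case trans (sym V-deg-x) d of λ ()
            (no v≢x) → U-irr v∈ v≢x (trans (sym (V-deg v≢x v≢q)) d)

          V-keeps : ∀ {v} → v ∈ S⁺ → deg U v ≡ 1 → deg V v ≡ 1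
          V-keeps v∈ d = trans (V-deg (λ { refl → case trans (sym U-deg-x) d of λ () })
                                      (λ { refl → case trans (sym q3) d of λ () })) d

          module VR = Repair V V-deg-q V-irr

          V-cubic = λ v → (S⁺ v ∧ not (v == q)) ∧ (deg V v isᵇ 3)

          q3' : deg tree q ≡ 3
          q3' = trans (sym (U-deg q≢x)) q3

          -- The trade is even: among the vertices of degree 3, `q` is replaced by `x`.
          V-cubic≤ : # V-cubic ≤ i₀
          V-cubic≤ = ≤-trans (#-mono {P = V-cubic} {Q = ⁅ x ⁆ ∪ (Cubic tree ∖ ⁅ q ⁆)} cover)
              (≤-trans (#-∪ ⁅ x ⁆ (Cubic tree ∖ ⁅ q ⁆)) (≤-reflexive (trans (cong (_+ # (Cubic tree ∖ ⁅ q ⁆)) (#-⁅⁆ x))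
                (sym (#-remove (Cubic tree) {q} (∧-intro q∈ (isᵇ-intro q3')))))))
            where
            cover : ∀ v → v ∈ V-cubic → v ∈ ⁅ x ⁆ ∪ (Cubic tree ∖ ⁅ q ⁆)
            cover v e = let (a , b) = ∧-elim {S⁺ v ∧ not (v == q)} e
                            (c , d) = ∖-elim {S⁺ v} a
                            v≢q = ==⇒≢ d in case v ≟ x of λ where
              (yes refl) → ∨-introˡ (==-refl v)
              (no v≢x) → let d3 = trans (sym (V-deg v≢x v≢q)) (isᵇ-elim b) in ∨-introʳ {v == x} (∖-intro
                (∧-intro ([ id , (λ { refl → case trans (sym U-deg-w) d3 of λ () }) ]′ (in⁺ c))
                         (isᵇ-intro (trans (sym (U-deg v≢x)) d3))) (≢⇒== v≢q))

          outcome : Progress ⊎ (∃ λ q → q ∈ S × deg tree q ≡ 3 × # (adj G q) ≤ 2 + i₀)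
          outcome with VR.repair
          ... | inj₁ r = inj₁ (finish-repaired V V-deg-q V-irr V-keeps r)
          ... | inj₂ b = inj₂ (q , q∈ , q3' , ≤-trans (#-mono {P = adj G q} {Q = S⁺ ∩ adj G q} inside)
                           (≤-trans (VR.Blocked.few b) (+-monoʳ-≤ 2 V-cubic≤)))
            where
            inside : ∀ v → v ∈ adj G q → v ∈ S⁺ ∩ adj G q
            inside v a with bool (S v)
            ... | inj₁ v∈ = ∧-intro (∨-introˡ v∈) a
            -- In the original tree `q` has degree 3, so `internal` leaves it no neighbour outside.
            ... | inj₂ v∉ = case trans (sym q3') (internal q∈ v∉ a) of λ ()

      analyse : Progress ⊎ Analysis x
      analyse with UR.repair
      ... | inj₁ r = inj₁ (finish-repaired U U-deg-x U-irr (λ _ d → d) r)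
      ... | inj₂ B = third
        where
        inside : ∀ v → v ∈ adj G x → v ∈ S⁺ ∩ adj G x
        inside v a with bool (S v)
        ... | inj₁ v∈ = ∧-intro (∨-introˡ v∈) a
        ... | inj₂ v∉ = ∧-intro (∨-introʳ {S v} (subst (λ z → (v == z) ≡ true) (only v v∉ a) (==-refl v))) a
        bound : # (adj G x) ≤ 2 + i₀
        bound = ≤-trans (#-mono {P = adj G x} {Q = S⁺ ∩ adj G x} inside)
                  (≤-trans (UR.Blocked.few B) (+-monoʳ-≤ 2 U-cubic≤))
        third : Progress ⊎ Analysis x
        third with search (λ z → (S z ∧ adj G x z) ∧ not (child X x z))
        ... | inj₂ none = inj₂ (bound , inj₂ (reroot tree x∈ , λ z z∈ a → not-false (¬true λ c → true≢false (∧-intro (∧-intro z∈ a) c) (none z))))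
        ... | inj₁ (z , e) with ∖-elim {S z ∧ adj G x z} e
        ... | za , z∉ with ∧-elim {S z} za
        ... | z∈ , a with Steal.outcome B z∈ a z∉
        ... | inj₁ p = inj₁ p
        ... | inj₂ q = inj₂ (bound , inj₁ q)

-- Numerical contradictions for a tree that cannot grow

private
  -- Throughout, `I` is the number of tree vertices of degree 3, `K` that of vertices outside the
  -- tree, `L` that of non-leaves, and `s` the size of the tree; `d` and `d'` are degrees in the
  -- graph.
  counting : ∀ {n I K L s} → s + K ≡ n → s ≤ 2 * I + 2 → I + K ≤ L → 2 * L + 3 ≤ n → ⊥
  counting {n} {I} {K} {L} {s} e a b c = clash K (≤-reflexive (sym e) ⊕ a ⊕ double b ⊕ c)
    (solve (n ∷ₗ I ∷ₗ K ∷ₗ L ∷ₗ s ∷ₗ []ₗ))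

  room : ∀ {n I K L} → suc (I + K) ≤ L → 2 * L + 3 ≤ n → 2 * I + 2 * K + 5 ≤ n
  room {n} {I} {K} {L} a b = ≮⇒≥ less
    where
    less : suc n ≤ 2 * I + 2 * K + 5 → ⊥
    less h = clash 0 (h ⊕ double a ⊕ b) (solve (n ∷ₗ I ∷ₗ K ∷ₗ L ∷ₗ []ₗ))

  two-stuck : ∀ {n I K d d'} → 2 * I + 2 * K + 5 ≤ n → 1 ≤ K → n ≤ 2 + d + d' → d ≤ 2 + I → d' ≤ 2 + I → ⊥
  two-stuck {n} {I} {K} {d} {d'} a b c e f = clash 0 (a ⊕ double b ⊕ c ⊕ e ⊕ f) (solve (n ∷ₗ I ∷ₗ K ∷ₗ d ∷ₗ d' ∷ₗ []ₗ))

  stuck-cubic : ∀ {n I K d d' k x} → 2 * I + 2 * K + 5 ≤ n → suc k ≡ K → n ≤ 2 + d + d' → d ≤ 2 + I → d' ≤ k + (1 + x) →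
    suc x ≤ 2 + I → 1 ≤ K → ⊥
  stuck-cubic {n} {I} {K} {d} {d'} {k} {x} a b c e f g h =
    clash 0 (a ⊕ ≤-reflexive b ⊕ c ⊕ e ⊕ f ⊕ g ⊕ h) (solve (n ∷ₗ I ∷ₗ K ∷ₗ d ∷ₗ d' ∷ₗ k ∷ₗ x ∷ₗ []ₗ))

  second-outsider : ∀ {n I K d d' k} → 2 * I + 2 * K + 5 ≤ n → suc k ≡ K → n ≤ 2 + d + d' → d ≤ 2 → d' ≤ k → ⊥
  second-outsider {n} {I} {K} {d} {d'} {k} a b c e f = clash (2 * I + k + 2) (a ⊕ double (≤-reflexive b) ⊕ c ⊕ e ⊕ f)
    (solve (n ∷ₗ I ∷ₗ K ∷ₗ d ∷ₗ d' ∷ₗ k ∷ₗ []ₗ))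

  tiny : ∀ {n I K s} → 2 * I + 2 * K + 5 ≤ n → s + K ≡ n → s ≤ 2 → ⊥
  tiny {n} {I} {K} {s} a b c = clash (2 * I + K + 2) (a ⊕ ≤-reflexive (sym b) ⊕ c) (solve (n ∷ₗ I ∷ₗ K ∷ₗ s ∷ₗ []ₗ))

  near-full : ∀ {n d d' r} → n ≤ 2 + d + d' → d ≤ 1 → d' ≤ r → 4 + r ≤ n → ⊥
  near-full {n} {d} {d'} {r} a b c e = clash 0 (a ⊕ b ⊕ c ⊕ e) (solve (n ∷ₗ d ∷ₗ d' ∷ₗ r ∷ₗ []ₗ))

-- Growth until the tree spans or the graph is exceptional

module Grown {n : ℕ} (G : Graph n) (σ : DegreeSum G) (conn : Connected G) where

  open Growth G σ public

  module Conclude (T : HIT) (small : 2 * HIT.nl T + 3 ≤ n) (w₀ : Fin n) (w₀∉ : w₀ ∉ HIT.S T) where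
    open HIT T
    open Step T

    private
      I = # (Cubic tree)

      out>0 : 1 ≤ out
      out>0 = ∈⇒#>0 (∁ S) (∉S-intro {S} w₀∉)

      size : # S + out ≡ n
      size = #-∁ S

      nonleaf-cubic : ∀ {v} → v ∈ Cubic tree ∪ ∁ S → v ∈ ∁ (leaf tree)
      nonleaf-cubic {v} e = ∉S-intro {leaf tree} (¬true λ l → let (v∈ , d) = leaf-elim tree l in
        case ∨-elim {Cubic tree v} e of λ where
          (inj₁ c) → case trans (sym d) (isᵇ-elim (proj₂ (∧-elim {S v} c))) of λ ()
          (inj₂ o) → true≢false v∈ (not-true o))

      cubic+out : # (Cubic tree ∪ ∁ S) ≡ I + out
      cubic+out = #-⊎ (Cubic tree) (∁ S) λ v c → cong not (proj₁ (∧-elim {S v} c))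

      unusual : Sub n
      unusual v = S v ∧ (not (deg tree v isᵇ 1) ∧ not (deg tree v isᵇ 3))

      -- If all degrees are 1 or 3 then |S| = 2 + 2 I, too few vertices.
      not-cubic : (∀ v → v ∉ unusual) → ⊥
      not-cubic none = counting {n} {I} {out} {nl} {# S} size S≤ (≤-trans (≤-reflexive (sym cubic+out)) (#-mono λ v → nonleaf-cubic)) small
        where
        one-three : ∀ {v} → v ∈ S → (deg tree v ≡ 1) ⊎ (deg tree v ≡ 3)
        one-three {v} v∈ with bool (deg tree v isᵇ 1) | bool (deg tree v isᵇ 3)
        ... | inj₁ a | _ = inj₁ (isᵇ-elim a)
        ... | inj₂ _ | inj₁ b = inj₂ (isᵇ-elim b)
        ... | inj₂ a | inj₂ b = ⊥-elim (true≢false (∧-intro v∈ (∧-intro (cong not a) (cong not b))) (none v))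

        -- A vertex of degree 3 has two children and a leaf has none; the root, lacking a parent,
        -- has one child more.
        ch≤ : ∀ q → ch tree q ≤ 2 * [ Cubic tree q ]ᵇ + [ q == ρ ]ᵇ
        ch≤ q with bool (S q)
        ... | inj₂ q∉ = ≤-trans (≤-reflexive (ch-outside tree q∉)) z≤n
        ... | inj₁ q∈ = case one-three q∈ , (q ≟ ρ) of λ where
          (inj₁ d , yes refl) → ≤-trans (≤-reflexive (trans (sym (deg-root tree)) (trans d (cong [_]ᵇ (sym (==-refl q)))))) (m≤n+m _ _)
          (inj₁ d , no q≢) → ≤-trans (≤-reflexive (suc-injective (trans (sym (deg-nonroot tree q≢)) d))) z≤n
          (inj₂ d , yes refl) → ≤-reflexive (trans (trans (sym (deg-root tree)) d)
             (cong₂ (λ a b → 2 * [ a ]ᵇ + [ b ]ᵇ) (sym (∧-intro q∈ (isᵇ-intro d))) (sym (==-refl q))))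
          (inj₂ d , no q≢) → ≤-trans (≤-reflexive (trans (suc-injective (trans (sym (deg-nonroot tree q≢)) d))
             (cong (λ a → 2 * [ a ]ᵇ) (sym (∧-intro q∈ (isᵇ-intro d)))))) (m≤m+n _ _)

        S≤ : # S ≤ 2 * I + 2
        S≤ = ≤-trans (≤-reflexive (#-remove S (root∈ tree))) (≤-trans (s≤s (≤-trans (≤-reflexive (sym (∑ch tree))) (≤-trans (∑-mono ch≤)
               (≤-reflexive (trans (∑-distrib-+ (λ q → 2 * [ Cubic tree q ]ᵇ) (λ q → [ q == ρ ]ᵇ))
                 (cong₂ _+_ (trans (∑-* 2 (λ q → [ Cubic tree q ]ᵇ)) (cong (2 *_) (sym (#-∑ {P = Cubic tree}))))
                            (trans (sym (#-∑ {P = ⁅ ρ ⁆})) (#-⁅⁆ ρ))))))))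
               (≤-reflexive (sym (+-suc (2 * I) 1))))

      -- A vertex of degree neither 1 nor 3 is a non-leaf that `I + out` misses, which improves the
      -- bound by 2.
      roomy : 2 * I + 2 * out + 5 ≤ n
      roomy = room {n} {I} {out} {nl} h small
        where
        h : suc (I + out) ≤ nl
        h with search unusual
        ... | inj₂ none = ⊥-elim (not-cubic none)
        ... | inj₁ (v , e) with ∧-elim {S v} e
        ... | v∈ , f with ∖-elim {not (deg tree v isᵇ 1)} f
        ... | d1 , d3 = ≤-trans (s≤s (≤-trans (≤-reflexive (sym cubic+out)) (#-mono {P = Cubic tree ∪ ∁ S} {Q = ∁ (leaf tree) ∖ ⁅ v ⁆} sub)))
            (≤-reflexive (sym (#-remove (∁ (leaf tree)) {v} (∉S-intro {leaf tree} (¬true λ l → isᵇ-false (not-true d1) (proj₂ (leaf-elim tree l)))))))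
          where
          sub : ∀ u → u ∈ Cubic tree ∪ ∁ S → u ∈ ∁ (leaf tree) ∖ ⁅ v ⁆
          sub u c = ∖-intro (nonleaf-cubic c) (≢⇒== {a = u} {v} λ { refl → case ∨-elim {Cubic tree u} c of λ where
            (inj₁ k) → true≢false (proj₂ (∧-elim {S u} k)) d3
            (inj₂ o) → true≢false v∈ (not-true o) })

    -- Reads off the structure of `D_n` from the failure of every growth step.
    module Stuck (internal : ∀ {q v} → q ∈ S → v ∉ S → Adj G q v → deg tree q ≡ 1)
                 (single : ∀ {x v v'} → x ∈ S → v ∉ S → v' ∉ S → Adj G x v → Adj G x v' → v ≡ v')
                 (analysis : ∀ {x w} (x∈ : x ∈ S) (w∉ : w ∉ S) (xw : Adj G x w) →
                    Analysis x) where

      private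
        edge : ∃ λ x → ∃ λ w → x ∈ S × w ∉ S × Adj G x w
        edge = boundary-edge G S (conn ρ w₀) (root∈ tree) w₀∉

      x w : Fin n
      x = proj₁ edge
      w = proj₁ (proj₂ edge)

      private
        x∈ : x ∈ S
        x∈ = proj₁ (proj₂ (proj₂ edge))
        w∉ : w ∉ S
        w∉ = proj₁ (proj₂ (proj₂ (proj₂ edge)))
        xw : Adj G x w
        xw = proj₂ (proj₂ (proj₂ (proj₂ edge)))

        dx : # (adj G x) ≤ 2 + I
        dx = proj₁ (analysis x∈ w∉ xw)

        in≢out : ∀ {a b} → a ∈ S → b ∉ S → a ≢ b
        in≢out a∈ b∉ refl = true≢false a∈ b∉

        -- Both vertices block growth and have at most `2 + I` neighbours, too few for a
        -- non-adjacent pair.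
        stuck-near : ∀ {y v} → y ∈ S → v ∉ S → Adj G y v → (y ≡ x) ⊎ Adj G x y
        stuck-near {y} y∈ v∉ yv with y ≟ x | bool (adj G x y)
        ... | yes e | _ = inj₁ e
        ... | no _ | inj₁ a = inj₂ a
        ... | no y≢ | inj₂ na = ⊥-elim (two-stuck {n} {I} {out} roomy out>0 (σ (y≢ ∘ sym) na) dx (proj₁ (analysis y∈ v∉ yv)))

        out-w : out ≡ suc (# (∁ S ∖ ⁅ w ⁆))
        out-w = #-remove (∁ S) (∉S-intro {S} w∉)

        -- Being internal, `q` is not adjacent to `w`. By `stuck-near` the neighbours of `w` in the
        -- tree are among `x` and the neighbours of `x`, which bounds the degree of `w`.
        no-cubic : (∃ λ q → q ∈ S × deg tree q ≡ 3 × # (adj G q) ≤ 2 + I) → ⊥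
        no-cubic (q , q∈ , d3 , dq) = stuck-cubic {n} {I} {out} {# (adj G q)} {# (adj G w)} roomy (sym out-w)
            (σ (in≢out q∈ w∉) (¬true λ a → case trans (sym d3) (internal q∈ w∉ a) of λ ())) dq
            (≤-trans (#-mono {P = adj G w} {Q = (∁ S ∖ ⁅ w ⁆) ∪ (⁅ x ⁆ ∪ (adj G x ∖ ⁅ w ⁆))} cover)
              (≤-trans (#-∪ (∁ S ∖ ⁅ w ⁆) (⁅ x ⁆ ∪ (adj G x ∖ ⁅ w ⁆))) (+-monoʳ-≤ _ (≤-trans (#-∪ ⁅ x ⁆ (adj G x ∖ ⁅ w ⁆))
                (≤-reflexive (cong (_+ # (adj G x ∖ ⁅ w ⁆)) (#-⁅⁆ x)))))))
            (≤-trans (≤-reflexive (sym (#-remove (adj G x) xw))) dx) out>0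
          where
          cover : ∀ v → v ∈ adj G w → v ∈ (∁ S ∖ ⁅ w ⁆) ∪ (⁅ x ⁆ ∪ (adj G x ∖ ⁅ w ⁆))
          cover v a with bool (S v)
          ... | inj₂ v∉ = ∨-introˡ (∖-intro (∉S-intro {S} v∉) (≢⇒== (~⇒≢ a ∘ sym)))
          ... | inj₁ v∈ = ∨-introʳ {(∁ S ∖ ⁅ w ⁆) v} (case stuck-near v∈ w∉ (~-sym a) of λ where
                  (inj₁ refl) → ∨-introˡ (==-refl v)
                  (inj₂ b) → ∨-introʳ {v == x} (∖-intro b (≢⇒== (in≢out v∈ w∉))))

        rerooted : Σ (Rerooted tree x) λ R → ∀ z → z ∈ S → Adj G x z → z ∈ child (Rerooted.tree R) x
        rerooted with proj₂ (analysis x∈ w∉ xw)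
        ... | inj₁ q = ⊥-elim (no-cubic q)
        ... | inj₂ h = h

        X : Rooted S x
        X = Rerooted.tree (proj₁ rerooted)

        near : ∀ z → z ∈ S → Adj G x z → z ∈ child X x
        near = proj₂ rerooted

        ch-x : ch X x ≡ 1
        ch-x = trans (sym (deg-root X)) (trans (Rerooted.degs (proj₁ rerooted) x) (internal x∈ w∉ xw))

        first : ∃ λ p → p ∈ child X x
        first = #>0⇒∃ (child X x) (≤-reflexive (sym ch-x))

      p : Fin n
      p = proj₁ first

      private
        p∈ : p ∈ S
        p∈ = proj₁ (child-elim X (proj₂ first))

        p≢x : p ≢ x
        p≢x = proj₁ (proj₂ (child-elim X (proj₂ first)))

        xp : Adj G x p
        xp = subst (λ q → Adj G q p) (proj₂ (proj₂ (child-elim X (proj₂ first)))) (par~ X p∈ p≢x)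

        only-p : ∀ {z} → z ∈ child X x → z ≡ p
        only-p {z} c with z ≟ p
        ... | yes e = e
        ... | no z≢ = case ≤-trans (s≤s (∈⇒#>0 (child X x ∖ ⁅ p ⁆) {z} (∖-intro c (≢⇒== z≢))))
                                   (≤-reflexive (trans (sym (#-remove (child X x) (proj₂ first))) ch-x)) of λ { (s≤s ()) }

        nbr-x : ∀ {z} → Adj G x z → (z ≡ w) ⊎ (z ≡ p)
        nbr-x {z} a with bool (S z)
        ... | inj₁ z∈ = inj₂ (only-p (near z z∈ a))
        ... | inj₂ z∉ = inj₁ (single x∈ z∉ w∉ a xw)

        dx2 : # (adj G x) ≤ 2
        dx2 = ≤-trans (#-mono {P = adj G x} {Q = ⁅ w ⁆ ∪ ⁅ p ⁆} λ z a → case nbr-x a of λ where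
                 (inj₁ refl) → ∨-introˡ (==-refl z)
                 (inj₂ refl) → ∨-introʳ {z == w} (==-refl z))
              (≤-trans (#-∪ ⁅ w ⁆ ⁅ p ⁆) (≤-reflexive (cong₂ _+_ (#-⁅⁆ w) (#-⁅⁆ p))))

        -- Otherwise the tree would be the single edge from `x` to `p`, against `roomy`.
        p-not-leaf : deg tree p ≢ 1
        p-not-leaf d = tiny {n} {I} {out} roomy size (≤-trans (#-mono {P = S} {Q = ⁅ x ⁆ ∪ ⁅ p ⁆} λ v v∈ → two-vertices v∈)
            (≤-trans (#-∪ ⁅ x ⁆ ⁅ p ⁆) (≤-reflexive (cong₂ _+_ (#-⁅⁆ x) (#-⁅⁆ p)))))
          where
          ch-p : ch X p ≡ 0
          ch-p = suc-injective (trans (sym (deg-nonroot X p≢x)) (trans (Rerooted.degs (proj₁ rerooted) p) d))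
          climb : ∀ m {v} → v ∈ S → rk X v < m → (v ≡ x) ⊎ (v ≡ p)
          climb (suc m) {v} v∈ (s≤s r) with v ≟ x
          ... | yes e = inj₁ e
          ... | no v≢ with climb m (par∈ X v∈ v≢) (<-≤-trans (rk-par X v∈ v≢) r)
          ... | inj₁ e = inj₂ (only-p (child-intro X v∈ v≢ e))
          ... | inj₂ e = case subst (1 ≤_) ch-p (∈⇒#>0 (child X p) (child-intro X v∈ v≢ e)) of λ ()
          two-vertices : ∀ {v} → v ∈ S → v ∈ ⁅ x ⁆ ∪ ⁅ p ⁆
          two-vertices {v} v∈ = case climb _ v∈ ≤-refl of λ where
            (inj₁ refl) → ∨-introˡ (==-refl v)
            (inj₂ refl) → ∨-introʳ {v == x} (==-refl v)

        -- By `stuck-near` any other such vertex would be adjacent to `x` and hence equal to `p`,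
        -- but `p` is not a leaf.
        only-x : ∀ {y v} → y ∈ S → v ∉ S → Adj G y v → y ≡ x
        only-x y∈ v∉ a with stuck-near y∈ v∉ a
        ... | inj₁ e = e
        ... | inj₂ b with only-p (near _ y∈ b)
        ... | refl = ⊥-elim (p-not-leaf (internal y∈ v∉ a))

        -- A second outsider is not adjacent to `x` by `single`, nor to any other tree vertex by
        -- `only-x`. Its degree and the degree of `x` are then too small.
        only-w : ∀ {v} → v ∉ S → v ≡ w
        only-w {v} v∉ with v ≟ w
        ... | yes e = e
        ... | no v≢ = ⊥-elim (second-outsider {n} {I} {out} {# (adj G x)} {# (adj G v)} roomy (sym (#-remove (∁ S) (∉S-intro {S} v∉)))
                (σ (in≢out x∈ v∉) (¬true λ a → v≢ (single x∈ v∉ w∉ a xw))) dx2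
                (#-mono {P = adj G v} {Q = ∁ S ∖ ⁅ v ⁆} λ z a → ∖-intro (∉S-intro {S} (outside z a)) (≢⇒== (~⇒≢ a ∘ sym))))
          where
          outside : ∀ z → Adj G v z → z ∉ S
          outside z a = ¬true λ z∈ → v≢ (single x∈ v∉ w∉ (subst (λ y → Adj G y v) (only-x z∈ v∉ (~-sym a)) (~-sym a)) xw)

        nbr-w : ∀ {v} → Adj G w v → v ≡ x
        nbr-w {v} a with bool (S v)
        ... | inj₁ v∈ = only-x v∈ w∉ (~-sym a)
        ... | inj₂ v∉ = ⊥-elim (~⇒≢ a (sym (only-w v∉)))

        dw : # (adj G w) ≤ 1
        dw = #≤1 λ a b → trans (nbr-w a) (sym (nbr-w b))

        -- Since `w` has degree at most 1 and is not adjacent to `y`, the degree of `y` is at least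
        -- `n - 3`. As `y` already misses `w`, `x` and itself, it misses nothing else.
        rest-p : ∀ {y z} → y ≢ w → y ≢ x → y ≢ p → z ≢ w → z ≢ x → y ≢ z → Adj G y z
        rest-p {y} {z} y≢w y≢x y≢p z≢w z≢x y≢z = not-false (¬true λ na → near-full {n} {# (adj G w)} {# (adj G y)}
             (σ (y≢w ∘ sym) (¬true λ a → y≢x (nbr-w a))) dw
             (#-mono {P = adj G y} {Q = R} λ v a → in-R a (not-true na)) full)
          where
          R : Sub n
          R = ((((λ _ → true) ∖ ⁅ w ⁆) ∖ ⁅ x ⁆) ∖ ⁅ y ⁆) ∖ ⁅ z ⁆
          in-R : ∀ {v} → Adj G y v → adj G y z ≡ false → v ∈ R
          in-R {v} a na = ∖-intro (∖-intro (∖-intro (∖-intro {true} refl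
             (≢⇒== {a = v} {w} λ { refl → y≢x (nbr-w (~-sym a)) }))
             (≢⇒== {a = v} {x} λ { refl → [ y≢w , y≢p ]′ (nbr-x (~-sym a)) }))
             (≢⇒== {a = v} {y} (~⇒≢ a ∘ sym)))
             (≢⇒== {a = v} {z} λ { refl → true≢false a na })
          full : 4 + # R ≤ n
          full = ≤-reflexive (trans (cong (3 +_) (sym (#-remove _ {z} (∖-intro (∖-intro (∖-intro {true} refl (≢⇒== z≢w)) (≢⇒== z≢x)) (≢⇒== (y≢z ∘ sym))))))
                   (trans (cong (2 +_) (sym (#-remove _ {y} (∖-intro (∖-intro {true} refl (≢⇒== y≢w)) (≢⇒== y≢x)))))
                   (trans (cong suc (sym (#-remove _ {x} (∖-intro {true} refl (≢⇒== (in≢out x∈ w∉))))))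
                   (trans (sym (#-remove (λ _ → true) {w} refl)) (#-full {P = λ _ → true} (λ _ → refl))))))

      pendant : Pendant G
      pendant = record
        { w = w ; x = x ; p = p
        ; w≢x = in≢out x∈ w∉ ∘ sym ; w≢p = in≢out p∈ w∉ ∘ sym ; x≢p = p≢x ∘ sym
        ; adj-w = λ v → bool-ext (λ a → subst (λ y → (v == y) ≡ true) (nbr-w a) (==-refl v)) (λ e → subst (Adj G w) (sym (==⇒≡ e)) (~-sym xw))
        ; adj-x = λ v → bool-ext
            (λ a → case nbr-x a of λ { (inj₁ refl) → ∨-introˡ (==-refl v) ; (inj₂ refl) → ∨-introʳ {v == w} (==-refl v) })
            (λ e → case ∨-elim {v == w} e of λ { (inj₁ a) → subst (Adj G x) (sym (==⇒≡ a)) xw ; (inj₂ a) → subst (Adj G x) (sym (==⇒≡ a)) xp })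
        ; rest = λ {y} {z} y≢w y≢x z≢w z≢x y≢z → case y ≟ p of λ where
            (no y≢p) → rest-p y≢w y≢x y≢p z≢w z≢x y≢z
            -- If `y` is `p`, then `z` is not, and the roles can be exchanged.
            (yes refl) → ~-sym (rest-p z≢w z≢x (y≢z ∘ sym) y≢w y≢x (y≢z ∘ sym)) }

    private
      Internal : Fin n → Fin n → Set
      Internal x w = x ∈ S → w ∉ S → Adj G x w → deg tree x ≡ 1

      Single : Fin n → Set
      Single x = ∀ v v' → x ∈ S → v ∉ S → v' ∉ S → Adj G x v → Adj G x v' → v ≡ v'

      internals : ∀ x w → Progress ⊎ Internal x w
      internals x w with bool (S x) | bool (S w) | bool (adj G x w) | deg tree x ≟ℕ 1
      ... | _ | _ | _ | yes d = inj₂ λ _ _ _ → d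
      ... | inj₂ x∉ | _ | _ | no _ = inj₂ λ x∈ → ⊥-elim (true≢false x∈ x∉)
      ... | inj₁ _ | inj₁ w∈ | _ | no _ = inj₂ λ _ w∉ → ⊥-elim (true≢false w∈ w∉)
      ... | inj₁ _ | inj₂ _ | inj₂ na | no _ = inj₂ λ _ _ a → ⊥-elim (true≢false a na)
      ... | inj₁ x∈ | inj₂ w∉ | inj₁ a | no d = inj₁ (internal-boundary x w x∈ w∉ a d)

      singles : (∀ x w → Internal x w) → ∀ x → Progress ⊎ Single x
      singles F x = collect₂ single
        where
        single : ∀ v v' → Progress ⊎ (x ∈ S → v ∉ S → v' ∉ S → Adj G x v → Adj G x v' → v ≡ v')
        single v v' with v ≟ v' | bool ((S x ∧ adj G x v ∧ adj G x v') ∧ (not (S v) ∧ not (S v')))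
        ... | yes e | _ = inj₂ λ _ _ _ _ _ → e
        ... | no _ | inj₂ f = inj₂ λ x∈ v∉ v'∉ a a' → ⊥-elim (true≢false
               (∧-intro (∧-intro x∈ (∧-intro a a')) (∧-intro (cong not v∉) (cong not v'∉))) f)
        ... | no v≢ | inj₁ t = let (l , r) = ∧-elim {S x ∧ adj G x v ∧ adj G x v'} t
                                   (x∈ , aa) = ∧-elim {S x} l
                                   (a , a') = ∧-elim {adj G x v} aa
                                   (v∉ , v'∉) = ∧-elim {not (S v)} r in
               inj₁ (double-boundary x v v' x∈ (not-true v∉) (not-true v'∉) a a' v≢ (F x v x∈ (not-true v∉) a))

      analyses : (∀ x w → Internal x w) → (∀ x → Single x) → ∀ x w → Progress ⊎ (x ∈ S → w ∉ S → Adj G x w → Analysis x)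
      analyses F F' x w with bool (S x) | bool (S w) | bool (adj G x w)
      ... | inj₂ x∉ | _ | _ = inj₂ λ x∈ → ⊥-elim (true≢false x∈ x∉)
      ... | inj₁ _ | inj₁ w∈ | _ = inj₂ λ _ w∉ → ⊥-elim (true≢false w∈ w∉)
      ... | inj₁ _ | inj₂ _ | inj₂ na = inj₂ λ _ _ a → ⊥-elim (true≢false a na)
      ... | inj₁ x∈ | inj₂ w∉ | inj₁ a
        with Leaf.analyse x∈ w∉ a (F x w x∈ w∉ a) (λ v v∉ b → F' x v w x∈ v∉ w∉ b a) (λ q∈ v∉ b → F _ _ q∈ v∉ b)
      ... | inj₁ pr = inj₁ pr
      ... | inj₂ an = inj₂ λ _ _ _ → an

    advance : Progress ⊎ Pendant G
    advance with collect₂ internals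
    ... | inj₁ pr = inj₁ pr
    ... | inj₂ F with collect (singles F)
    ... | inj₁ pr = inj₁ pr
    ... | inj₂ F' with collect₂ (analyses F F')
    ... | inj₁ pr = inj₁ pr
    ... | inj₂ F'' = inj₂ (Stuck.pendant (λ q∈ v∉ a → F _ _ q∈ v∉ a) (λ x∈ v∉ v'∉ a a' → F' _ _ _ x∈ v∉ v'∉ a a')
                            (λ x∈ w∉ a → F'' _ _ x∈ w∉ a))

  -- The fuel `m` exceeds the number of vertices still outside, which every step lowers.
  grow : ∀ m (T : HIT) → HIT.out T < m → 2 * HIT.nl T + 3 ≤ n → HasHIST G ⊎ Pendant G
  grow (suc m) T (s≤s o) small with search (∁ (HIT.S T))
  ... | inj₂ full = inj₁ (spanning-HIST (HIT.tree T) (λ v → not-false (full v)) (HIT.irr T))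
  ... | inj₁ (w , w∉) with Conclude.advance T small w (not-true w∉)
  ... | inj₂ p = inj₂ p
  ... | inj₁ (T' , nl≤ , out<) = grow m T' (<-≤-trans out< o) (≤-trans (+-monoˡ-≤ 3 (*-monoʳ-≤ 2 nl≤)) small)

-- Initial trees for orders above 10

sumOver : ∀ {n} → Sub n → (Fin n → ℕ) → ℕ
sumOver P f = ∑ (λ v → [ P v ]ᵇ * f v)

sumOver-≤ : ∀ {n} (P : Sub n) {f c} → (∀ {v} → v ∈ P → f v ≤ c) → sumOver P f ≤ c * # P
sumOver-≤ P {f} {c} h = ≤-trans (∑-mono pt) (≤-reflexive (trans (∑-* c (λ v → [ P v ]ᵇ)) (cong (c *_) (sym (#-∑ {P = P})))))
  where
  pt : ∀ v → [ P v ]ᵇ * f v ≤ c * [ P v ]ᵇ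
  pt v with bool (P v)
  ... | inj₁ e rewrite e = ≤-trans (≤-reflexive (+-identityʳ (f v))) (≤-trans (h e) (≤-reflexive (sym (*-identityʳ c))))
  ... | inj₂ e rewrite e = z≤n

sumOver-≥ : ∀ {n} (P : Sub n) {f c} → (∀ {v} → v ∈ P → c ≤ f v) → c * # P ≤ sumOver P f
sumOver-≥ P {f} {c} h = ≤-trans (≤-reflexive (trans (cong (c *_) (#-∑ {P = P})) (sym (∑-* c (λ v → [ P v ]ᵇ))))) (∑-mono pt)
  where
  pt : ∀ v → c * [ P v ]ᵇ ≤ [ P v ]ᵇ * f v
  pt v with bool (P v)
  ... | inj₁ e rewrite e = ≤-trans (≤-reflexive (*-identityʳ c)) (≤-trans (h e) (≤-reflexive (sym (+-identityʳ (f v)))))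
  ... | inj₂ e rewrite e = ≤-reflexive (*-zeroʳ c)

sumOver-+ : ∀ {n} (P : Sub n) f g → sumOver P (λ v → f v + g v) ≡ sumOver P f + sumOver P g
sumOver-+ P f g = trans (∑-cong λ v → *-distribˡ-+ [ P v ]ᵇ (f v) (g v)) (∑-distrib-+ (λ v → [ P v ]ᵇ * f v) (λ v → [ P v ]ᵇ * g v))

sumOver-mono : ∀ {n} (P : Sub n) {f g} → (∀ {v} → v ∈ P → f v ≤ g v) → sumOver P f ≤ sumOver P g
sumOver-mono P {f} {g} h = ∑-mono pt
  where
  pt : ∀ v → [ P v ]ᵇ * f v ≤ [ P v ]ᵇ * g v
  pt v with bool (P v)
  ... | inj₁ e rewrite e = +-monoˡ-≤ 0 (h e)
  ... | inj₂ e rewrite e = z≤n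

sumOver-remove : ∀ {n} (P : Sub n) f {z} → z ∈ P → sumOver P f ≡ f z + sumOver (P ∖ ⁅ z ⁆) f
sumOver-remove P f {z} z∈ = trans (∑-cong pt) (trans (∑-distrib-+ (λ v → [ v == z ]ᵇ * f z) (λ v → [ (P ∖ ⁅ z ⁆) v ]ᵇ * f v))
  (cong (_+ sumOver (P ∖ ⁅ z ⁆) f) (trans (∑-cong λ v → *-comm [ v == z ]ᵇ (f z))
    (trans (∑-* (f z) (λ v → [ v == z ]ᵇ)) (trans (cong (f z *_) (trans (sym (#-∑ {P = ⁅ z ⁆})) (#-⁅⁆ z))) (*-identityʳ (f z)))))))
  where
  pt : ∀ v → [ P v ]ᵇ * f v ≡ [ v == z ]ᵇ * f z + [ (P ∖ ⁅ z ⁆) v ]ᵇ * f v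
  pt v with v ≟ z
  ... | yes refl rewrite z∈ = sym (+-identityʳ (f v + 0))
  ... | no _ with P v
  ... | true = refl
  ... | false = refl

opaque
  unfolding #

  double-count : ∀ {n} (G : Graph n) (P Q : Sub n) →
    sumOver P (λ v → # (Q ∩ adj G v)) ≡ sumOver Q (λ v → # (P ∩ adj G v))
  double-count G P Q = trans (∑-cong λ v → sym (∑-* [ P v ]ᵇ (λ z → [ Q z ∧ adj G v z ]ᵇ)))
    (trans (∑-comm (λ v z → [ P v ]ᵇ * [ Q z ∧ adj G v z ]ᵇ))
      (∑-cong λ z → trans (∑-cong λ v → pt v z) (∑-* [ Q z ]ᵇ (λ v → [ P v ∧ adj G z v ]ᵇ))))
    where
    pt : ∀ v z → [ P v ]ᵇ * [ Q z ∧ adj G v z ]ᵇ ≡ [ Q z ]ᵇ * [ P v ∧ adj G z v ]ᵇ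
    pt v z rewrite adj-sym G v z with P v | Q z
    ... | true | true = refl
    ... | true | false = refl
    ... | false | true = refl
    ... | false | false = refl

argmax : ∀ {n} (f : Fin (suc n) → ℕ) → ∃ λ u → ∀ v → f v ≤ f u
argmax {zero} f = zero , λ { zero → ≤-refl }
argmax {suc n} f with argmax (f ∘ suc)
... | u , h with ≤-total (f zero) (f (suc u))
... | inj₁ a = suc u , λ { zero → a ; (suc v) → h v }
... | inj₂ a = zero , λ { zero → ≤-refl ; (suc v) → ≤-trans (h v) a }

all∈ : ∀ {n} {P Q : Sub n} → (∀ {v} → v ∈ P → v ∈ Q) → # Q ≤ # P → ∀ {v} → v ∈ Q → v ∈ P
all∈ {P = P} {Q} sub le {v} v∈ with bool (P v)
... | inj₁ e = e
... | inj₂ e = ⊥-elim (<-irrefl refl (≤-trans (≤-trans (s≤s (#-mono {P = P} {Q = Q ∖ ⁅ v ⁆} λ z z∈ →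
      ∖-intro (sub z∈) (≢⇒== {a = z} {v} λ { refl → true≢false z∈ e }))) (≤-reflexive (sym (#-remove Q v∈)))) le))

∨-false : ∀ {a b} → a ≡ false → b ≡ false → a ∨ b ≡ false
∨-false refl e = e

pair : ∀ {n} → Fin n → Fin n → Sub n
pair a b = ⁅ a ⁆ ∪ ⁅ b ⁆

pair-elim : ∀ {n} {a b v : Fin n} → v ∈ pair a b → (v ≡ a) ⊎ (v ≡ b)
pair-elim {a = a} {b} {v} e with ∨-elim {v == a} e
... | inj₁ p = inj₁ (==⇒≡ p)
... | inj₂ p = inj₂ (==⇒≡ p)

pair-all : ∀ {n} {R : Fin n → Set} a b → R a → R b → ∀ {v} → v ∈ pair a b → R v
pair-all {R = R} a b ra rb {v} e = [ (λ { refl → ra }) , (λ { refl → rb }) ]′ (pair-elim {a = a} {b} {v} e)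

∈-pairˡ : ∀ {n} (a b : Fin n) → a ∈ pair a b
∈-pairˡ a b = ∨-introˡ (==-refl a)

∈-pairʳ : ∀ {n} (a b : Fin n) → b ∈ pair a b
∈-pairʳ a b = ∨-introʳ {b == a} (==-refl b)

#-pair : ∀ {n} {a b : Fin n} → a ≢ b → # (pair a b) ≡ 2
#-pair {a = a} {b} a≢b = trans (#-⊎ ⁅ a ⁆ ⁅ b ⁆ λ v e → ≢⇒== {a = v} {b} λ q → a≢b (trans (sym (==⇒≡ e)) q)) (cong₂ _+_ (#-⁅⁆ a) (#-⁅⁆ b))

-- Stars and their extension at a leaf

module Build {n : ℕ} (G : Graph n) (σ : DegreeSum G) (conn : Connected G) where

  open Grown G σ conn public

  Goal : Set
  Goal = HasHIST G ⊎ Pendant G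

  done : (T : HIT) → 2 * HIT.nl T + 3 ≤ n → Goal
  done T = grow _ T ≤-refl

  module Star (u : Fin n) (P : Sub n) (3≤P : 3 ≤ # P) (u~P : ∀ {v} → v ∈ P → Adj G u v) where
    private
      dot : Rooted ⁅ u ⁆ u
      dot = record
        { par = id ; rk = λ _ → 0 ; root∈ = ==-refl u
        ; par∈ = λ v∈ v≢ → ⊥-elim (v≢ (==⇒≡ v∈)) ; par~ = λ v∈ v≢ → ⊥-elim (v≢ (==⇒≡ v∈))
        ; rk-par = λ v∈ v≢ → ⊥-elim (v≢ (==⇒≡ v∈)) ; rk-root = λ v∈ v≢ → ⊥-elim (v≢ (==⇒≡ v∈)) }

      dot-deg : deg dot u ≡ 0
      dot-deg = trans (deg-root dot) (#-empty {P = child dot u} λ v → ¬true λ e →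
        let (v∈ , v≢ , _) = child-elim dot {u} {v} e in v≢ (==⇒≡ v∈))

      new : ∀ {v} → v ∈ P → v ∉ ⁅ u ⁆
      new v∈ = ≢⇒== (~⇒≢ (u~P v∈) ∘ sym)

    star : HIT
    star = record
      { tree = Graft.graft dot u (==-refl u) P new u~P
      ; irr = graft-irr dot (==-refl u) P new u~P (λ v∈ v≢ → ⊥-elim (v≢ (==⇒≡ v∈)))
          (λ e → case ≤-trans 3≤P (≤-trans (m≤m+n (# P) (deg dot u)) (≤-reflexive e)) of λ { (s≤s (s≤s ())) }) }

    star-nl : # P + HIT.nl star ≤ n
    star-nl = ≤-trans (graft-nl-internal dot (==-refl u) P new u~P (λ d → case trans (sym dot-deg) d of λ ()))
                (≤-trans (m≤n+m _ (# (leaf dot))) (≤-reflexive (#-∁ (leaf dot))))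

  -- With its parent and two new children, `x` reaches degree 3 whether or not it was a leaf before.
  module Add (T : HIT) (x : Fin n) (x∈ : x ∈ HIT.S T) (x≢ : x ≢ HIT.ρ T) (Q : Sub n) (2≤Q : 2 ≤ # Q)
             (new : ∀ {v} → v ∈ Q → v ∉ HIT.S T) (x~Q : ∀ {v} → v ∈ Q → Adj G x v) where
    open HIT T

    add : HIT
    add = record
      { tree = Graft.graft tree x x∈ Q new x~Q
      ; irr = graft-irr tree x∈ Q new x~Q (λ v∈ _ → irr v∈)
          (λ e → case ≤-trans (2≤Q ⊕ ≤-trans (s≤s z≤n) (≤-reflexive (sym (deg-nonroot tree x≢)))) (≤-reflexive e) of λ { (s≤s (s≤s ())) }) }

    add-nl : # Q + HIT.nl add ≤ suc nl
    add-nl = graft-nl tree x∈ Q new x~Q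

-- Inequalities behind the initial trees

module Ineqs where
  at-least-three : ∀ {n D d} → 2 * D ≤ n + 2 → n ≤ 2 + D + d → 11 ≤ n → 3 ≤ d
  at-least-three {n} {D} {d} a b c = ≮⇒≥ less
    where
    less : suc d ≤ 3 → ⊥
    less h = clash 0 (double h ⊕ a ⊕ double b ⊕ c) (solve (n ∷ₗ D ∷ₗ d ∷ₗ []ₗ))

  -- The origin of the threshold `n + 5`: when a leaf of a star with `D` leaves takes `t` children,
  -- at most `n + 1 - D - t` non-leaves remain.
  few-nonleaves-A : ∀ {n D t l₀ l} → n + 5 ≤ 2 * t + 2 * D → D + l₀ ≤ n → t + l ≤ suc l₀ → 2 * l + 3 ≤ n
  few-nonleaves-A {n} {D} {t} {l₀} {l} a b c = ≮⇒≥ less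
    where
    less : suc n ≤ 2 * l + 3 → ⊥
    less h = clash 0 (h ⊕ a ⊕ double b ⊕ double c) (solve (n ∷ₗ D ∷ₗ t ∷ₗ l₀ ∷ₗ l ∷ₗ []ₗ))

  at-least-two : ∀ {n D t} → n + 5 ≤ 2 * t + 2 * D → 2 * D ≤ n + 2 → 2 ≤ t
  at-least-two {n} {D} {t} a b = ≮⇒≥ less
    where
    less : suc t ≤ 2 → ⊥
    less h = clash 0 (double h ⊕ a ⊕ b) (solve (n ∷ₗ D ∷ₗ t ∷ₗ []ₗ))

  few-nonleaves-B : ∀ {n D j s l} → n + 5 ≤ 2 * j + 2 * D → D + j ≤ suc s → s + l ≤ n → 2 * l + 3 ≤ n
  few-nonleaves-B {n} {D} {j} {s} {l} a b c = ≮⇒≥ less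
    where
    less : suc n ≤ 2 * l + 3 → ⊥
    less h = clash 0 (h ⊕ a ⊕ double b ⊕ double c) (solve (n ∷ₗ D ∷ₗ j ∷ₗ s ∷ₗ l ∷ₗ []ₗ))

  chain : ∀ {n p q l₀ l₁ l₂} → p + l₀ ≤ n → 2 + l₁ ≤ suc l₀ → q + l₂ ≤ suc l₁ → p + q + l₂ ≤ n
  chain {p = p} {q} {l₂ = l₂} c d e = ≤-trans (≤-reflexive (+-assoc p q l₂)) (≤-trans (+-monoʳ-≤ p (≤-trans e (s≤s⁻¹ d))) c)

  at-most-4 : ∀ {n l} → l ≤ 4 → 11 ≤ n → 2 * l + 3 ≤ n
  at-most-4 a b = ≤-trans (double a ⊕ ≤-refl {3}) b

  few-nonleaves-C : ∀ {n p r l₀ l₁ l₂} → n ≤ 5 + p + r → r ≤ 1 → p + l₀ ≤ n → 2 + l₁ ≤ suc l₀ → 2 + l₂ ≤ suc l₁ → 11 ≤ n → 2 * l₂ + 3 ≤ n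
  few-nonleaves-C {n} {p} {r} {l₀} {l₁} {l₂} a b c d e = at-most-4 (arith (≤-trans (+-monoʳ-≤ p (≤-trans e (s≤s⁻¹ d))) (≤-trans c a)) b)
    where
    arith : ∀ {p r l} → p + (2 + l) ≤ 5 + p + r → r ≤ 1 → l ≤ 4
    arith {p} {r} {l} a b = ≮⇒≥ less
      where
      less : suc 4 ≤ l → ⊥
      less h = clash 0 (h ⊕ a ⊕ b) (solve (p ∷ₗ r ∷ₗ l ∷ₗ []ₗ))

  few-nonleaves-D : ∀ {n p r l₀ l₁ l₂ l₃} → n ≤ 5 + p + r → p + l₀ ≤ n → 2 + l₁ ≤ suc l₀ → 2 + l₂ ≤ suc l₁ → r + l₃ ≤ suc l₂ → 11 ≤ n →
    2 * l₃ + 3 ≤ n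
  few-nonleaves-D {n} {p} {r} {l₀} {l₁} {l₂} {l₃} a c d e f =
      at-most-4 (arith (≤-trans (+-monoʳ-≤ p (≤-trans (s≤s (≤-trans f (s≤s⁻¹ e))) (s≤s⁻¹ d))) (≤-trans c a)))
    where
    arith : ∀ {p r l} → p + suc (r + l) ≤ 5 + p + r → l ≤ 4
    arith {p} {r} {l} a = ≮⇒≥ less
      where
      less : suc 4 ≤ l → ⊥
      less h = clash 0 (h ⊕ a) (solve (p ∷ₗ r ∷ₗ l ∷ₗ []ₗ))

  degree-lower : ∀ {n D k a d} → n ≡ suc (D + k) → suc a ≡ k → n ≤ 2 + D + d → a ≤ d
  degree-lower {n} {D} {k} {a} {d} refl refl b = +-cancelˡ-≤ (2 + D) a d (≤-trans (≤-reflexive (cong suc (sym (+-suc D a)))) b)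

  degree-large : ∀ {n D k a d d'} → n ≡ suc (D + k) → suc a ≡ k → d ≤ a → n ≤ 2 + d + d' → D ≤ d'
  degree-large {n} {D} {k} {a} {d} {d'} refl refl b c = ≮⇒≥ less
    where
    less : suc d' ≤ D → ⊥
    less h = clash 0 (h ⊕ b ⊕ c) (solve (D ∷ₗ a ∷ₗ d ∷ₗ d' ∷ₗ []ₗ))

open Ineqs

-- Neighbours and non-neighbours of a vertex of maximum degree

module Initial {n : ℕ} (G : Graph n) (σ : DegreeSum G) (conn : Connected G)
  (u : Fin n) (max : ∀ v → # (adj G v) ≤ # (adj G u)) (low : 2 * # (adj G u) ≤ n + 2) (11≤n : 11 ≤ n) where

  open Build G σ conn public

  N W : Sub n
  N = adj G u
  W = ∁ (⁅ u ⁆ ∪ N)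

  Δ k : ℕ
  Δ = # N
  k = # W

  W-elim : ∀ {v} → v ∈ W → v ≢ u × v ∉ N
  W-elim {v} e with bool (v == u) | bool (N v)
  ... | inj₂ a | inj₂ b = ==⇒≢ a , b
  ... | inj₁ a | _ rewrite a = case e of λ ()
  ... | inj₂ a | inj₁ b rewrite a | b = case e of λ ()

  W-intro : ∀ {v} → v ≢ u → v ∉ N → v ∈ W
  W-intro a b rewrite ≢⇒== a | b = refl

  #closed : # (⁅ u ⁆ ∪ N) ≡ suc Δ
  #closed = trans (#-⊎ ⁅ u ⁆ N λ v e → subst (λ z → adj G u z ≡ false) (sym (==⇒≡ e)) (adj-irrefl G u)) (cong (_+ Δ) (#-⁅⁆ u))

  size : n ≡ suc (Δ + k)
  size = sym (trans (cong (_+ k) (sym #closed)) (#-∁ (⁅ u ⁆ ∪ N)))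

  private
    Δ-small : suc Δ < n
    Δ-small = ≮⇒≥ less
      where
      less : suc n ≤ suc (suc Δ) → ⊥
      less h = arith low 11≤n h
        where
        arith : ∀ {D m} → 2 * D ≤ m + 2 → 11 ≤ m → suc m ≤ suc (suc D) → ⊥
        arith {D} {m} a b c = clash 6 (a ⊕ b ⊕ double c) (solve (D ∷ₗ m ∷ₗ []ₗ))

  -- As `Δ + 1` is less than `n`, each `v` has a non-neighbour besides itself, whose degree is at
  -- most `Δ`.
  δ : ∀ v → n ≤ 2 + Δ + # (adj G v)
  δ v with pick (∁ (adj G v)) (v ∷ []) (+-cancelˡ-≤ (# (adj G v)) _ _ (≤-trans (≤-trans (≤-reflexive (+-comm _ 2)) (≤-trans (s≤s (s≤s (max v))) Δ-small))
             (≤-reflexive (sym (#-∁ (adj G v))))))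
  ... | z , z∈ , z≢ ∷ _ = ≤-trans (σ z≢ (trans (adj-sym G z v) (not-true z∈))) (+-monoˡ-≤ _ (s≤s (s≤s (max z))))

  δ3 : ∀ v → 3 ≤ # (adj G v)
  δ3 v = at-least-three low (δ v) 11≤n

  Δ≥5 : 5 ≤ Δ
  Δ≥5 = arith (δ u) 11≤n
    where
    arith : ∀ {D m} → m ≤ 2 + D + D → 11 ≤ m → 5 ≤ D
    arith {D} {m} a b = ≮⇒≥ less
      where
      less : suc D ≤ 5 → ⊥
      less h = clash 0 (a ⊕ b ⊕ double h) (solve (D ∷ₗ m ∷ₗ []ₗ))

  -- The failure of the threshold in `few-nonleaves-A` and `few-nonleaves-B`.
  Sparse : Fin n → Set
  Sparse x = 2 * # (W ∩ adj G x) + 2 * Δ ≤ n + 4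

  split : ∀ w → w ∈ W → # (adj G w) ≡ # (W ∩ adj G w) + # (N ∩ adj G w)
  split w w∈ = trans (#-split (adj G w) W) (cong₂ _+_ (#-cong {P = adj G w ∩ W} {Q = W ∩ adj G w} λ v → ∧-comm (adj G w v) (W v))
    (#-cong {P = adj G w ∖ W} {Q = N ∩ adj G w} λ v → bool-ext
      (λ e → let (a , b) = ∖-elim {adj G w v} e in ∧-intro
         (not-false (¬true λ c → true≢false (W-intro (λ { refl → true≢false (~-sym a) (proj₂ (W-elim w∈)) }) (not-true c)) b)) a)
      (λ e → let (a , b) = ∧-elim {N v} e in ∖-intro b (¬true λ c → true≢false a (proj₂ (W-elim c))))))

  sparse? : ∀ x → Sparse x ⊎ (n + 5 ≤ 2 * # (W ∩ adj G x) + 2 * Δ)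
  sparse? x with 2 * # (W ∩ adj G x) + 2 * Δ ≤? n + 4
  ... | yes h = inj₁ h
  ... | no h = inj₂ (≤-trans (≤-reflexive (+-suc n 4)) (≰⇒> h))

  -- If `x` is not sparse, the star at `u`, extended by the neighbours of `x` in `W`, has enough
  -- leaves.
  N-sparse : ∀ x → x ∈ N → Goal ⊎ Sparse x
  N-sparse x x∈ with sparse? x
  ... | inj₁ h = inj₂ h
  ... | inj₂ h = inj₁ (done T₁.add (few-nonleaves-A {n} {Δ} {# (W ∩ adj G x)} {HIT.nl T₀.star} h T₀.star-nl T₁.add-nl))
    where
    module T₀ = Star u N (≤-trans (s≤s (s≤s (s≤s z≤n))) Δ≥5) id
    module T₁ = Add T₀.star x (∨-introʳ {x == u} x∈) (~⇒≢ x∈ ∘ sym) (W ∩ adj G x) (at-least-two {n} {Δ} h low)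
                    (λ {v} e → not-true (proj₁ (∧-elim {W v} e))) (λ {v} e → proj₂ (∧-elim {W v} e))

  -- u has children N \ {y}, x has children w and y, and w adopts its neighbours in W.
  module Adopt {w x y : Fin n} (w∈ : w ∈ W) (x∈ : x ∈ N) (xw : Adj G x w) (xy : Adj G x y) (y≢u : y ≢ u) (y≢w : y ≢ w) where
    P Q : Sub n
    P = N ∖ ⁅ y ⁆
    Q = (W ∩ adj G w) ∖ ⁅ y ⁆

    w≢u = proj₁ (W-elim w∈)
    w∉N = proj₂ (W-elim w∈)
    j = # (W ∩ adj G w)

    P-all : y ∉ N → # N ≤ # P
    P-all y∉ = #-mono {P = N} {Q = P} (λ v e → ∖-intro e (≢⇒== {a = v} {y} λ { refl → true≢false e y∉ }))

    Q-all : (y ∈ W → Adj G w y → ⊥) → j ≤ # Q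
    Q-all y∉ = #-mono {P = W ∩ adj G w} {Q = Q} λ v e → let (a , b) = ∧-elim {W v} e in ∖-intro e (≢⇒== {a = v} {y} λ { refl → y∉ a b })

    N∌ : y ∈ N → y ∈ W → Adj G w y → ⊥
    N∌ y∈N y∈W _ = true≢false y∈N (proj₂ (W-elim {y} y∈W))

    -- `N` and `W` are disjoint, so leaving out `y` costs at most one vertex in total.
    PQ : Δ + j ≤ suc (# P + # Q)
    PQ = case bool (N y) of λ where
      (inj₁ y∈) → ≤-reflexive (#-remove N y∈) ⊕ Q-all (N∌ y∈)
      (inj₂ y∉) → ≤-trans (P-all y∉ ⊕ #-remove-≤ (W ∩ adj G w) y) (≤-reflexive (+-suc (# P) (# Q)))

    P-elim : ∀ {v} → v ∈ P → v ∈ N × v ≢ y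
    P-elim {v} e = let (a , b) = ∖-elim {N v} e in a , ==⇒≢ b

    Q-elim : ∀ {v} → v ∈ Q → v ∈ W × Adj G w v × v ≢ y
    Q-elim {v} e = let (a , b) = ∖-elim {(W ∩ adj G w) v} e ; (c , d) = ∧-elim {W v} a in c , d , ==⇒≢ b

    module T₀ = Star u P (s≤s⁻¹ (≤-trans (≤-trans (s≤s (s≤s (s≤s (s≤s z≤n)))) Δ≥5) (#-remove-≤ N y))) (λ {v} e → proj₁ (P-elim {v} e))

    S₀∉ : ∀ {v} → v ≢ u → v ∉ P → v ∉ HIT.S T₀.star
    S₀∉ a b = ∨-false (≢⇒== a) b

    P∌ : ∀ {v} → v ∉ N → v ∉ P
    P∌ e rewrite e = refl

    new₁ : ∀ {v} → v ∈ pair w y → v ∉ HIT.S T₀.star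
    new₁ = pair-all {R = _∉ HIT.S T₀.star} w y (S₀∉ w≢u (P∌ w∉N)) (S₀∉ y≢u (¬true λ p → proj₂ (P-elim {y} p) refl))

    module T₁ = Add T₀.star x (∨-introʳ {x == u} (∖-intro x∈ (≢⇒== (~⇒≢ xy)))) (~⇒≢ x∈ ∘ sym) (pair w y) (≤-reflexive (sym (#-pair (y≢w ∘ sym))))
                    new₁ (pair-all {R = Adj G x} w y xw xy)

    S₁∉ : ∀ {v} → v ∈ W → v ≢ w → v ≢ y → v ∉ HIT.S T₁.add
    S₁∉ {v} v∈ v≢w v≢y = ∨-false (S₀∉ (proj₁ (W-elim {v} v∈)) (P∌ {v} (proj₂ (W-elim {v} v∈))))
              (∨-false (≢⇒== {a = v} {w} v≢w) (≢⇒== {a = v} {y} v≢y))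

    new₂ : ∀ {v} → v ∈ Q → v ∉ HIT.S T₁.add
    new₂ {v} e = let (v∈W , wv , v≢y) = Q-elim {v} e in S₁∉ {v} v∈W (~⇒≢ wv ∘ sym) v≢y

    module Last (2≤Q : 2 ≤ # Q) where
      module T₂ = Add T₁.add w (∨-introʳ {(⁅ u ⁆ ∪ P) w} (∈-pairˡ w y)) w≢u Q 2≤Q (λ {v} → new₂ {v}) (λ {v} e → proj₁ (proj₂ (Q-elim {v} e)))

      total : # P + # Q + HIT.nl T₂.add ≤ n
      total = chain {n} {# P} {# Q} {HIT.nl T₀.star} {HIT.nl T₁.add} {HIT.nl T₂.add} T₀.star-nl
                (≤-trans (≤-reflexive (cong (_+ HIT.nl T₁.add) (sym (#-pair (y≢w ∘ sym))))) T₁.add-nl) T₂.add-nl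

    goal : n + 5 ≤ 2 * # (W ∩ adj G w) + 2 * Δ → Sparse x → Goal
    goal h Ax = done T₂.add (few-nonleaves-B {n} {Δ} {j} {# P + # Q} {HIT.nl T₂.add} h PQ total)
      where
      j≥2 : 2 ≤ j
      j≥2 = at-least-two {n} {Δ} h low
      arith : ∀ {m D j t} → m + 5 ≤ 2 * j + 2 * D → 2 * t + 2 * D ≤ m + 4 → 2 ≤ t → j ≤ 2 → ⊥
      arith {m} {D} {j} {t} a b c d = clash 0 (a ⊕ b ⊕ double c ⊕ double d) (solve (m ∷ₗ D ∷ₗ j ∷ₗ t ∷ₗ []ₗ))
      -- The critical case is `j = 2` with `y` in `W`: then `w` and `y` are two neighbours of `x` in
      -- `W`, and `x` would fail to be sparse as well.
      2≤Q : 2 ≤ # Q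
      2≤Q = case _,′_ {A = (N y ≡ true) ⊎ (N y ≡ false)} {B = Dec (3 ≤ j)} (bool (N y)) (3 ≤? j) of λ where
        (inj₁ y∈ , _) → ≤-trans j≥2 (Q-all (N∌ y∈))
        (inj₂ y∉ , yes 3≤j) → s≤s⁻¹ (≤-trans 3≤j (#-remove-≤ (W ∩ adj G w) y))
        (inj₂ y∉ , no j≤2) → ⊥-elim (arith {n} {Δ} {j} {# (W ∩ adj G x)} h Ax (≤-trans (≤-reflexive (sym (#-pair (y≢w ∘ sym))))
           (#-mono {P = pair w y} {Q = W ∩ adj G x} λ v →
             pair-all {R = _∈ (W ∩ adj G x)} w y (∧-intro w∈ xw) (∧-intro (W-intro y≢u y∉) xy))) (s≤s⁻¹ (≰⇒> j≤2)))
      open Last 2≤Q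

  W-sparse-via : ∀ w x → w ∈ W → x ∈ N → Adj G x w → Goal ⊎ Sparse w
  W-sparse-via w x w∈ x∈ xw = [ inj₂ , (λ h → [ inj₁ , (λ Ax → inj₁ (adopt h Ax (pick (adj G x) (u ∷ w ∷ []) (δ3 x)))) ]′ (N-sparse x x∈)) ]′ (sparse? w)
    where
    adopt : n + 5 ≤ 2 * # (W ∩ adj G w) + 2 * Δ → Sparse x → (∃ λ y → Adj G x y × All (y ≢_) (u ∷ w ∷ [])) → Goal
    adopt h Ax (y , xy , y≢u ∷ y≢w ∷ []) = Adopt.goal w∈ x∈ xw xy y≢u y≢w h Ax

-- Non-neighbours of `u` without neighbours in `N`

module Isolation {n : ℕ} (G : Graph n) (σ : DegreeSum G) (conn : Connected G)
  (u : Fin n) (max : ∀ v → # (adj G v) ≤ # (adj G u)) (low : 2 * # (adj G u) ≤ n + 2) (11≤n : 11 ≤ n) where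

  open Initial G σ conn u max low 11≤n public

  module Isolated {w : Fin n} (w∈ : w ∈ W) (none : ∀ {v} → v ∈ N → adj G w v ≡ false) where

    private
      w≢u = proj₁ (W-elim {w} w∈)
      w∉N = proj₂ (W-elim {w} w∈)

      adj-w : ∀ {v} → Adj G w v → v ∈ W ∖ ⁅ w ⁆
      adj-w {v} a = ∖-intro (W-intro (λ { refl → true≢false (~-sym a) w∉N }) (¬true λ b → true≢false a (none b))) (≢⇒== (~⇒≢ a ∘ sym))

      rest : suc (# (W ∖ ⁅ w ⁆)) ≡ k
      rest = sym (#-remove W w∈)

      -- The neighbours of `w` lie among the `k - 1` other vertices of `W`, and by `δ` there are
      -- that many of them.
      w-full : ∀ {v} → v ∈ W → v ≢ w → Adj G w v
      w-full {v} v∈ v≢ = all∈ {P = adj G w} {Q = W ∖ ⁅ w ⁆} adj-w (degree-lower {n} {Δ} {k} size rest (δ w)) (∖-intro v∈ (≢⇒== v≢))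

      -- No vertex of `N` is adjacent to `w`, whose degree is at most `k - 1`.
      N-big : ∀ {y} → y ∈ N → Δ ≤ # (adj G y)
      N-big {y} y∈ = degree-large {n} {Δ} {k} size rest (#-mono {P = adj G w} {Q = W ∖ ⁅ w ⁆} λ v → adj-w)
                       (σ (λ { refl → true≢false y∈ w∉N }) (none y∈))

    -- All of W ∖ {w} is adjacent to w, so a path u, x, w₀, w dominates everything.
    module Path {x w₀ v y : Fin n} (x∈ : x ∈ N) (w₀∈ : w₀ ∈ W) (xw₀ : Adj G x w₀) (w₀v : Adj G w₀ v) (v≢x : v ≢ x) (v≢w : v ≢ w)
                (xy : Adj G x y) (y≢u : y ≢ u) (y≢w₀ : y ≢ w₀) (y≢v : y ≢ v) where
      P : Sub n
      P = (N ∖ ⁅ y ⁆) ∖ ⁅ v ⁆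

      P-elim : ∀ {z} → z ∈ P → z ∈ N × z ≢ y × z ≢ v
      P-elim {z} e = let (a , b) = ∖-elim {(N ∖ ⁅ y ⁆) z} e ; (c , d) = ∖-elim {N z} a in c , ==⇒≢ d , ==⇒≢ b

      P-intro : ∀ {z} → z ∈ N → z ≢ y → z ≢ v → z ∈ P
      P-intro {z} a b c = ∖-intro (∖-intro a (≢⇒== {a = z} {y} b)) (≢⇒== {a = z} {v} c)

      Δ≤ : Δ ≤ 2 + # P
      Δ≤ = ≤-trans (#-remove-≤ N y) (s≤s (#-remove-≤ (N ∖ ⁅ y ⁆) v))

      w₀≢u = proj₁ (W-elim {w₀} w₀∈)
      w₀∉N = proj₂ (W-elim {w₀} w₀∈)

      w₀≢w : w₀ ≢ w
      w₀≢w refl = true≢false (~-sym xw₀) (none x∈)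

      y≢w : y ≢ w
      y≢w refl = true≢false (~-sym xy) (none x∈)

      v≢u : v ≢ u
      v≢u refl = true≢false (~-sym w₀v) w₀∉N

      module T₀ = Star u P (s≤s⁻¹ (s≤s⁻¹ (≤-trans Δ≥5 Δ≤))) (λ {z} e → proj₁ (P-elim {z} e))
      S₀ = HIT.S T₀.star

      outside₀ : ∀ {z} → z ≢ u → z ∉ P → z ∉ S₀
      outside₀ {z} a b = ∨-false (≢⇒== {a = z} {u} a) b

      new₁ : ∀ {z} → z ∈ pair w₀ y → z ∉ S₀
      new₁ = pair-all {R = _∉ S₀} w₀ y (outside₀ {w₀} w₀≢u (¬true λ e → true≢false (proj₁ (P-elim {w₀} e)) w₀∉N))
               (outside₀ {y} y≢u (¬true λ e → proj₁ (proj₂ (P-elim {y} e)) refl))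

      module T₁ = Add T₀.star x (∨-introʳ {x == u} (P-intro {x} x∈ (~⇒≢ xy) (v≢x ∘ sym))) (~⇒≢ x∈ ∘ sym) (pair w₀ y)
                      (≤-reflexive (sym (#-pair (y≢w₀ ∘ sym)))) (λ {z} → new₁ {z}) (pair-all {R = Adj G x} w₀ y xw₀ xy)
      S₁ = HIT.S T₁.add

      outside₁ : ∀ {z} → z ∉ S₀ → z ≢ w₀ → z ≢ y → z ∉ S₁
      outside₁ {z} a b c = ∨-false a (∨-false (≢⇒== {a = z} {w₀} b) (≢⇒== {a = z} {y} c))

      new₂ : ∀ {z} → z ∈ pair w v → z ∉ S₁
      new₂ {z} = pair-all {R = _∉ S₁} w v
        (outside₁ {w} (outside₀ {w} w≢u (¬true λ e → true≢false (proj₁ (P-elim {w} e)) w∉N)) (w₀≢w ∘ sym) (y≢w ∘ sym))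
        (outside₁ {v} (outside₀ {v} v≢u (¬true λ e → proj₂ (proj₂ (P-elim {v} e)) refl)) (~⇒≢ w₀v ∘ sym) (y≢v ∘ sym)) {z}

      module T₂ = Add T₁.add w₀ (∨-introʳ {S₀ w₀} (∈-pairˡ w₀ y)) w₀≢u (pair w v) (≤-reflexive (sym (#-pair (v≢w ∘ sym)))) (λ {z} → new₂ {z})
                      (pair-all {R = Adj G w₀} w v (~-sym (w-full w₀∈ w₀≢w)) w₀v)
      S₂ = HIT.S T₂.add

      w~rest : ∀ {z} → z ∈ ∁ S₂ → Adj G w z
      w~rest {z} e = w-full (W-intro z≢u (¬true λ z∈ → true≢false (P-intro {z} z∈ z≢y z≢v) z∉P)) z≢w
        where
        in₂ : z ∉ S₂
        in₂ = not-true e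
        z∉S₁ : z ∉ S₁
        z∉S₁ = ¬true λ a → true≢false (∨-introˡ a) in₂
        z∉S₀ : z ∉ S₀
        z∉S₀ = ¬true λ a → true≢false (∨-introˡ a) z∉S₁
        z∉P : z ∉ P
        z∉P = ¬true λ a → true≢false (∨-introʳ {z == u} a) z∉S₀
        z≢u : z ≢ u
        z≢u refl = true≢false (∨-introˡ (==-refl u)) z∉S₀
        z≢y : z ≢ y
        z≢y refl = true≢false (∨-introʳ {S₀ y} (∈-pairʳ w₀ y)) z∉S₁
        z≢v : z ≢ v
        z≢v refl = true≢false (∨-introʳ {S₁ v} (∈-pairʳ w v)) in₂
        z≢w : z ≢ w
        z≢w refl = true≢false (∨-introʳ {S₁ w} (∈-pairˡ w v)) in₂

      few : n ≤ 5 + # P + # (∁ S₂)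
      few = ≤-trans (≤-reflexive (sym (#-∁ S₂))) (+-monoˡ-≤ (# (∁ S₂)) (≤-trans (#-∪ S₁ (pair w v))
        (≤-trans (≤-trans (#-∪ S₀ (pair w₀ y)) (#-∪ ⁅ u ⁆ P ⊕ ≤-reflexive (#-pair (y≢w₀ ∘ sym))) ⊕ ≤-reflexive (#-pair (v≢w ∘ sym)))
          (≤-reflexive (trans (cong (λ a → a + # P + 2 + 2) (#-⁅⁆ u)) (arith (# P)))))))
        where
        arith : ∀ p → 1 + p + 2 + 2 ≡ 5 + p
        arith p = solve (p ∷ₗ []ₗ)

      nl₁ : 2 + HIT.nl T₁.add ≤ suc (HIT.nl T₀.star)
      nl₁ = ≤-trans (≤-reflexive (cong (_+ HIT.nl T₁.add) (sym (#-pair (y≢w₀ ∘ sym))))) T₁.add-nl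

      nl₂ : 2 + HIT.nl T₂.add ≤ suc (HIT.nl T₁.add)
      nl₂ = ≤-trans (≤-reflexive (cong (_+ HIT.nl T₂.add) (sym (#-pair (v≢w ∘ sym))))) T₂.add-nl

      many : 2 ≤ # (∁ S₂) → Goal
      many h = done T₃.add (few-nonleaves-D {n} {# P} {# (∁ S₂)} {HIT.nl T₀.star} {HIT.nl T₁.add} {HIT.nl T₂.add} {HIT.nl T₃.add}
                 few T₀.star-nl nl₁ nl₂ T₃.add-nl 11≤n)
        where
        module T₃ = Add T₂.add w (∨-introʳ {S₁ w} (∈-pairˡ w v)) w≢u (∁ S₂) h (λ {z} → not-true) (λ {z} → w~rest {z})

      goal : Goal
      goal = case 2 ≤? # (∁ S₂) of λ where
        (yes h) → many h
        -- At most one vertex is left. It stays outside, where it costs one non-leaf, while `w`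
        -- remains a leaf.
        (no h) → done T₂.add (few-nonleaves-C {n} {# P} {# (∁ S₂)} {HIT.nl T₀.star} {HIT.nl T₁.add} {HIT.nl T₂.add}
                   few (s≤s⁻¹ (≰⇒> h)) T₀.star-nl nl₁ nl₂ 11≤n)

    isolated-goal : Goal
    isolated-goal = from-edge (boundary-edge G (⁅ u ⁆ ∪ N) (conn u w) (∨-introˡ (==-refl u)) (not-true w∈))
      where
      from-y : ∀ {x w₀ v} → x ∈ N → w₀ ∈ W → Adj G x w₀ → Adj G w₀ v → v ≢ x → v ≢ w →
               (∃ λ y → Adj G x y × All (y ≢_) (u ∷ w₀ ∷ v ∷ [])) → Goal
      from-y x∈ w₀∈ a b v≢x v≢w (y , xy , y≢u ∷ y≢w₀ ∷ y≢v ∷ []) = Path.goal x∈ w₀∈ a b v≢x v≢w xy y≢u y≢w₀ y≢v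
      from-v : ∀ {x w₀} → x ∈ N → w₀ ∈ W → Adj G x w₀ → (∃ λ v → Adj G w₀ v × All (v ≢_) (x ∷ w ∷ [])) → Goal
      from-v {x} {w₀} x∈ w₀∈ a (v , b , v≢x ∷ v≢w ∷ []) = from-y x∈ w₀∈ a b v≢x v≢w
        -- Three vertices are to be avoided, so `δ3` is too weak; `N-big` provides degree at least
        -- 5.
        (pick (adj G x) (u ∷ w₀ ∷ v ∷ []) (≤-trans (s≤s (s≤s (s≤s (s≤s z≤n)))) (≤-trans Δ≥5 (N-big x∈))))
      from-edge : (∃ λ a → ∃ λ b → a ∈ (⁅ u ⁆ ∪ N) × b ∉ (⁅ u ⁆ ∪ N) × Adj G a b) → Goal
      from-edge (x , w₀ , x∈ , w₀∉ , a) = from-v x∈N (∉S-intro {⁅ u ⁆ ∪ N} {w₀} w₀∉) a (pick (adj G w₀) (x ∷ w ∷ []) (δ3 w₀))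
        where
        x∈N : x ∈ N
        x∈N = case ∨-elim {x == u} x∈ of λ where
          (inj₂ e) → e
          (inj₁ e) → ⊥-elim (true≢false (subst (λ z → Adj G z w₀) (==⇒≡ e) a) (proj₂ (W-elim {w₀} (∉S-intro {⁅ u ⁆ ∪ N} {w₀} w₀∉))))

  W-sparse : ∀ w → w ∈ W → Goal ⊎ Sparse w
  W-sparse w w∈ = case search (N ∩ adj G w) of λ where
    (inj₂ none) → inj₁ (Isolated.isolated-goal w∈ λ {v} v∈ → ¬true λ a → true≢false (∧-intro v∈ a) (none v))
    (inj₁ (x , e)) → let (x∈ , wx) = ∧-elim {N x} e in
      W-sparse-via w x w∈ x∈ (~-sym wx)

-- Numerical cases of the degree sum over `W`

module Cases where

  -- Each of the `k` vertices of `W` has degree at least `k - 1`, which is written as `c`.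
  Lower : ℕ → ℕ → Set
  Lower k s = ∀ c → suc c ≡ k → c * k ≤ s

  -- In case e we have 2 Δ + e = n + 2 and n = 1 + Δ + k; s is the degree sum over W.
  case₀ : ∀ {k s} → 11 ≤ suc ((3 + k) + k) → Lower k s → s ≤ 1 * k + 1 * (3 + k) → ⊥
  case₀ {0} h _ _ = from-no (11 ≤? 4) h
  case₀ {1} h _ _ = from-no (11 ≤? 6) h
  case₀ {2} h _ _ = from-no (11 ≤? 8) h
  case₀ {3} h _ _ = from-no (11 ≤? 10) h
  case₀ {suc (suc (suc (suc m)))} {s} _ l b = clash (m * m + 5 * m) (≤-trans lo b) (solve (m ∷ₗ []ₗ))
    where
    lo : (3 + m) * (4 + m) ≤ s
    lo = l (3 + m) refl

  case₁ : ∀ {k s} → 11 ≤ suc ((2 + k) + k) → Lower k s → s ≤ 1 * k + 1 * (2 + k) → ⊥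
  case₁ {0} h _ _ = from-no (11 ≤? 3) h
  case₁ {1} h _ _ = from-no (11 ≤? 5) h
  case₁ {2} h _ _ = from-no (11 ≤? 7) h
  case₁ {3} h _ _ = from-no (11 ≤? 9) h
  case₁ {suc (suc (suc (suc m)))} {s} _ l b = clash (m * m + 5 * m + 1) (≤-trans lo b) (solve (m ∷ₗ []ₗ))
    where
    lo : (3 + m) * (4 + m) ≤ s
    lo = l (3 + m) refl

  case₂ : ∀ {k s} → 11 ≤ suc ((1 + k) + k) → Lower k s → s ≤ 2 * k + 2 * (1 + k) → k ≡ 5
  case₂ {0} h _ _ = ⊥-elim (from-no (11 ≤? 2) h)
  case₂ {1} h _ _ = ⊥-elim (from-no (11 ≤? 4) h)
  case₂ {2} h _ _ = ⊥-elim (from-no (11 ≤? 6) h)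
  case₂ {3} h _ _ = ⊥-elim (from-no (11 ≤? 8) h)
  case₂ {4} h _ _ = ⊥-elim (from-no (11 ≤? 10) h)
  case₂ {5} _ _ _ = refl
  case₂ {suc (suc (suc (suc (suc (suc m)))))} {s} _ l b = ⊥-elim (clash (m * m + 7 * m + 3) (≤-trans lo b) (solve (m ∷ₗ []ₗ)))
    where
    lo : (5 + m) * (6 + m) ≤ s
    lo = l (5 + m) refl

  case₃ : ∀ {k s} → 11 ≤ suc (k + k) → Lower k s → s ≤ 2 * k + 2 * k → k ≡ 5
  case₃ {0} h _ _ = ⊥-elim (from-no (11 ≤? 1) h)
  case₃ {1} h _ _ = ⊥-elim (from-no (11 ≤? 3) h)
  case₃ {2} h _ _ = ⊥-elim (from-no (11 ≤? 5) h)
  case₃ {3} h _ _ = ⊥-elim (from-no (11 ≤? 7) h)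
  case₃ {4} h _ _ = ⊥-elim (from-no (11 ≤? 9) h)
  case₃ {5} _ _ _ = refl
  case₃ {suc (suc (suc (suc (suc (suc m)))))} {s} _ l b = ⊥-elim (clash (m * m + 7 * m + 5) (≤-trans lo b) (solve (m ∷ₗ []ₗ)))
    where
    lo : (5 + m) * (6 + m) ≤ s
    lo = l (5 + m) refl

  case₄ : ∀ {d s} → 11 ≤ suc (d + suc d) → Lower (suc d) s → s ≤ 3 * suc d + 3 * d → d ≡ 5
  case₄ {0} h _ _ = ⊥-elim (from-no (11 ≤? 2) h)
  case₄ {1} h _ _ = ⊥-elim (from-no (11 ≤? 4) h)
  case₄ {2} h _ _ = ⊥-elim (from-no (11 ≤? 6) h)
  case₄ {3} h _ _ = ⊥-elim (from-no (11 ≤? 8) h)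
  case₄ {4} h _ _ = ⊥-elim (from-no (11 ≤? 10) h)
  case₄ {5} _ _ _ = refl
  case₄ {suc (suc (suc (suc (suc (suc m)))))} {s} _ l b = ⊥-elim (clash (m * m + 7 * m + 2) (≤-trans lo b) (solve (m ∷ₗ []ₗ)))
    where
    lo : (6 + m) * (7 + m) ≤ s
    lo = l (6 + m) refl

  halve : ∀ {d t} → 2 * d ≤ suc (2 * t) → d ≤ t
  halve {d} {t} h = ≮⇒≥ less
    where
    less : suc t ≤ d → ⊥
    less g = clash 0 (double g ⊕ h) (solve (d ∷ₗ t ∷ₗ []ₗ))

  -- The parameters that the count leaves open, each with the resulting bound on the number of
  -- neighbours in `W` of a sparse vertex.
  data Special (k D : ℕ) : Set where
    five : k ≡ 5 → D ≤ 6 → (∀ {d} → 2 * d + 2 * D ≤ suc (D + k) + 4 → d ≤ 2) → Special k D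
    six  : k ≡ 6 → D ≡ 5 → (∀ {d} → 2 * d + 2 * D ≤ suc (D + k) + 4 → d ≤ 3) → Special k D

  -- If every vertex of `W` and `N` has at most `t` neighbours in `W`, then the degrees within `W`
  -- contribute at most `t * k` and the edges to `N` at most `t * D`.
  Upper : ℕ → ℕ → ℕ → Set
  Upper k D s = ∀ t → (∀ {d} → 2 * d + 2 * D ≤ suc (D + k) + 4 → d ≤ t) → s ≤ t * k + t * D

  -- Sparsity becomes `2 * d ≤ e + 2`. So `t` may be half of `e + 2` rounded down, namely 1, 1, 2,
  -- 2, 3 for `e` from 0 to 4.
  sparse-≤ : ∀ {k D e d} t → D + e ≡ 3 + k → e + 2 ≤ suc (2 * t) → 2 * d + 2 * D ≤ suc (D + k) + 4 → d ≤ t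
  sparse-≤ {k} {D} {e} {d} t eq et h = halve (≤-trans (bound eq h) et)
    where
    bound : D + e ≡ 3 + k → 2 * d + 2 * D ≤ suc (D + k) + 4 → 2 * d ≤ e + 2
    bound eq h = ≮⇒≥ less
      where
      less : suc (e + 2) ≤ 2 * d → ⊥
      less g = clash 0 (≤-reflexive (sym eq) ⊕ g ⊕ h) (solve (k ∷ₗ D ∷ₗ e ∷ₗ d ∷ₗ []ₗ))

  special : ∀ {k D s} e → D + e ≡ 3 + k → e ≤ 4 → 11 ≤ suc (D + k) → Lower k s → Upper k D s → Special k D
  special {k} {D} 0 eq _ h lo up with trans (sym (+-identityʳ D)) eq
  ... | refl = ⊥-elim (case₀ {k} h lo (up 1 (sparse-≤ {k} {D} {0} 1 eq (s≤s (s≤s z≤n)))))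
  special {k} {D} 1 eq _ h lo up with suc-injective (trans (sym (+-comm D 1)) eq)
  ... | refl = ⊥-elim (case₁ {k} h lo (up 1 (sparse-≤ {k} {D} {1} 1 eq ≤-refl)))
  special {k} {D} {s} 2 eq _ h lo up with suc-injective (suc-injective (trans (sym (+-comm D 2)) eq))
  ... | refl with case₂ {k} {s} h lo (up 2 (sparse-≤ {k} {D} {2} 2 eq (n≤1+n 4)))
  ... | refl = five refl ≤-refl (sparse-≤ {k} {D} {2} 2 eq (n≤1+n 4))
  special {k} {D} {s} 3 eq _ h lo up with suc-injective (suc-injective (suc-injective (trans (sym (+-comm D 3)) eq)))
  ... | refl with case₃ {k} {s} h lo (up 2 (sparse-≤ {k} {D} {3} 2 eq ≤-refl))
  ... | refl = five refl (n≤1+n 5) (sparse-≤ {k} {D} {3} 2 eq ≤-refl)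
  special {k} {D} {s} 4 eq _ h lo up with suc-injective (suc-injective (suc-injective (trans (sym (+-comm D 4)) eq)))
  ... | refl with case₄ {D} {s} h lo (up 3 (sparse-≤ {k} {D} {4} 3 eq (n≤1+n 6)))
  ... | refl = six refl refl (sparse-≤ {k} {D} {4} 3 eq (n≤1+n 6))
  special (suc (suc (suc (suc (suc e))))) _ (s≤s (s≤s (s≤s (s≤s ())))) _ _ _

open Cases

-- The edge count and the parameters that survive it

module Counting {n : ℕ} (G : Graph n) (σ : DegreeSum G) (conn : Connected G)
  (u : Fin n) (max : ∀ v → # (adj G v) ≤ # (adj G u)) (low : 2 * # (adj G u) ≤ n + 2) (11≤n : 11 ≤ n) where

  open Isolation G σ conn u max low 11≤n public

  dW dN : Fin n → ℕ
  dW v = # (W ∩ adj G v)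
  dN v = # (N ∩ adj G v)

  s : ℕ
  s = sumOver W (λ w → # (adj G w))

  lower : Lower k s
  lower c sc = sumOver-≥ W (λ {w} _ → degree-lower {n} {Δ} {k} size sc (δ w))

  module Dense (FN : ∀ {x} → x ∈ N → Sparse x) (FW : ∀ {w} → w ∈ W → Sparse w) where

    sparse′ : ∀ {v} → Sparse v → 2 * dW v + 2 * Δ ≤ suc (Δ + k) + 4
    sparse′ {v} = subst (λ m → 2 * dW v + 2 * Δ ≤ m + 4) size

    ∑dN : ∀ t → (∀ {d} → 2 * d + 2 * Δ ≤ suc (Δ + k) + 4 → d ≤ t) → sumOver W dN ≤ t * Δ
    ∑dN t h = ≤-trans (≤-reflexive (double-count G W N)) (sumOver-≤ N (λ {x} x∈ → h (sparse′ {x} (FN x∈))))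

    upper : Upper k Δ s
    upper t h = ≤-trans (sumOver-mono W (λ {w} w∈ → ≤-reflexive (split w w∈))) (≤-trans (≤-reflexive (sumOver-+ W dW dN))
                  (sumOver-≤ W (λ {w} w∈ → h (sparse′ {w} (FW w∈))) ⊕ ∑dN t h))

    spec : Special k Δ
    spec = special {k} {Δ} {s} e eq e≤4 (subst (11 ≤_) size 11≤n) lower upper
      where
      e = n + 2 ∸ 2 * Δ
      eq₀ : 2 * Δ + e ≡ n + 2
      eq₀ = m+[n∸m]≡n low
      shift : ∀ {D e k m} → 2 * D + e ≡ m + 2 → m ≡ suc (D + k) → D + e ≡ 3 + k
      shift {D} {e} {k} a refl = +-cancelˡ-≡ D _ _ (trans (sym re₁) (trans a re₂))
        where
        re₁ : 2 * D + e ≡ D + (D + e)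
        re₁ = solve (D ∷ₗ e ∷ₗ []ₗ)
        re₂ : suc (D + k) + 2 ≡ D + (3 + k)
        re₂ = solve (D ∷ₗ k ∷ₗ []ₗ)
      eq : Δ + e ≡ 3 + k
      eq = shift eq₀ size
      small : ∀ {D e m} → 2 * D + e ≡ m + 2 → m ≤ 2 + D + D → e ≤ 4
      small {D} {e} {m} a b = ≮⇒≥ less
        where
        less : suc 4 ≤ e → ⊥
        less h = clash 0 (h ⊕ ≤-reflexive a ⊕ b) (solve (D ∷ₗ e ∷ₗ m ∷ₗ []ₗ))
      -- `δ` at `u` itself gives `n ≤ 2 + 2 * Δ`.
      e≤4 : e ≤ 4
      e≤4 = small {Δ} {e} {n} eq₀ (δ u)

    -- If all of `W` had degree at least 5, then `s` would be at least 25, but it is at most 22. If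
    -- `w` has degree 4, then two of the other four vertices of `W` are not adjacent to `w` and so
    -- have degree at least `Δ`. With 4 for each of the remaining three, `s` is at least
    -- `2 * Δ + 12`, again too large.
    module Five (k5 : k ≡ 5) (Δ≤6 : Δ ≤ 6) (τ : ∀ {d} → 2 * d + 2 * Δ ≤ suc (Δ + k) + 4 → d ≤ 2) where

      s≤ : s ≤ 2 * 5 + 2 * Δ
      s≤ = subst (λ m → s ≤ 2 * m + 2 * Δ) k5 (upper 2 τ)

      five-low : ∀ {w} → w ∈ W → 4 ≤ # (adj G w)
      five-low {w} _ = degree-lower {n} {Δ} {k} size (sym k5) (δ w)

      from-w : ∀ {w} → w ∈ W → # (adj G w) ≤ 4 → ⊥
      from-w {w} w∈ d≤ = two (pick R [] (<⇒≤ R≥2))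
        where
        R = (W ∖ ⁅ w ⁆) ∖ adj G w
        R≥2 : 2 ≤ # R
        R≥2 = arith (trans (sym (#-remove W w∈)) k5) (#-split (W ∖ ⁅ w ⁆) (adj G w))
                (≤-trans (#-mono {P = (W ∖ ⁅ w ⁆) ∩ adj G w} {Q = W ∩ adj G w} λ v e → let (a , b) = ∧-elim {(W ∖ ⁅ w ⁆) v} e in
                   ∧-intro (proj₁ (∖-elim {W v} a)) b) (τ (sparse′ {w} (FW w∈))))
          where
          arith : ∀ {a b c} → suc a ≡ 5 → a ≡ b + c → b ≤ 2 → 2 ≤ c
          arith {b = b} {c} refl eq b≤ = +-cancelˡ-≤ 2 2 c (≤-trans (≤-reflexive eq) (+-monoˡ-≤ c b≤))
        big : ∀ {v} → v ∈ R → Δ ≤ # (adj G v)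
        big {v} v∈ = arith size k5 (σ (==⇒≢ (proj₂ b) ∘ sym) (proj₂ a)) d≤
          where
          a = ∖-elim {(W ∖ ⁅ w ⁆) v} v∈
          b = ∖-elim {W v} (proj₁ a)
          arith : ∀ {m D l x y} → m ≡ suc (D + l) → l ≡ 5 → m ≤ 2 + x + y → x ≤ 4 → D ≤ y
          arith {D = D} {x = x} {y} refl refl h g = +-cancelˡ-≤ 6 D y (≤-trans (≤-reflexive (cong suc (+-comm 5 D))) (≤-trans h (+-monoˡ-≤ y (s≤s (s≤s g)))))
        R⊂W : ∀ {v} → v ∈ R → v ∈ W
        R⊂W {v} v∈ = proj₁ (∖-elim {W v} (proj₁ (∖-elim {(W ∖ ⁅ w ⁆) v} v∈)))
        three : ∀ {w₁} → w₁ ∈ R → (∃ λ w₂ → w₂ ∈ R × All (w₂ ≢_) (w₁ ∷ [])) → ⊥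
        three {w₁} w₁∈ (w₂ , w₂∈ , w₂≢ ∷ []) = arith {# (adj G w₁)} {# (adj G w₂)} {Δ} {# W₂} k5 (#-remove W (R⊂W w₁∈)) (#-remove (W ∖ ⁅ w₁ ⁆) w₂∈′)
              (big w₁∈) (big w₂∈)
              (sumOver-≥ W₂ (λ {v} e → five-low {v} (proj₁ (∖-elim {W v} (proj₁ (∖-elim {(W ∖ ⁅ w₁ ⁆) v} e))))))
              (≤-trans (≤-reflexive (sym (trans (sumOver-remove W deg′ (R⊂W w₁∈)) (cong (deg′ w₁ +_) (sumOver-remove (W ∖ ⁅ w₁ ⁆) deg′ w₂∈′))))) s≤)
          where
          deg′ : Fin n → ℕ
          deg′ v = # (adj G v)
          w₂∈′ : w₂ ∈ W ∖ ⁅ w₁ ⁆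
          w₂∈′ = ∖-intro (R⊂W w₂∈) (≢⇒== w₂≢)
          W₂ = (W ∖ ⁅ w₁ ⁆) ∖ ⁅ w₂ ⁆
          arith : ∀ {x y D r l l′ q} → l ≡ 5 → l ≡ suc l′ → l′ ≡ suc r → D ≤ x → D ≤ y → 4 * r ≤ q → x + (y + q) ≤ 2 * 5 + 2 * D → ⊥
          arith {x} {y} {D} {q = q} refl refl refl a b c h = clash 1 (a ⊕ b ⊕ c ⊕ h) (solve (x ∷ₗ y ∷ₗ D ∷ₗ q ∷ₗ []ₗ))
        two : (∃ λ w₁ → w₁ ∈ R × All (w₁ ≢_) []) → ⊥
        two (w₁ , w₁∈ , _) = three w₁∈ (pick R (w₁ ∷ []) R≥2)

      sum-arith : ∀ {D} → D ≤ 6 → 5 * 5 ≤ 2 * 5 + 2 * D → ⊥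
      sum-arith {D} a b = clash 2 (double a ⊕ b) (solve (D ∷ₗ []ₗ))

      five-⊥ : ⊥
      five-⊥ = case search (λ w → W w ∧ does (# (adj G w) ≤? 4)) of λ where
        (inj₁ (w , e)) → let (a , b) = ∧-elim {W w} e in from-w a (does-true (# (adj G w) ≤? 4) b)
        (inj₂ none) → sum-arith Δ≤6 (≤-trans (subst (λ m → 5 * m ≤ s) k5 (sumOver-≥ W (λ {w} w∈ → ≰⇒> λ h → true≢false
                        (∧-intro w∈ (dec-true (# (adj G w) ≤? 4) h)) (none w)))) s≤)

    -- Here `n` is 12, so four non-leaves are allowed. At most 15 edges join `N` to the six vertices
    -- of `W`, so some `w` in `W` has only two neighbours in `N`, hence three in `W`, and `Z` holds
    -- the other two vertices of `W`.
    module Six (k6 : k ≡ 6) (Δ5 : Δ ≡ 5) (τ : ∀ {d} → 2 * d + 2 * Δ ≤ suc (Δ + k) + 4 → d ≤ 3) where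

      n12 : n ≡ 12
      n12 = trans size (cong₂ (λ a b → suc (a + b)) Δ5 k6)

      deg≥5 : ∀ v → 5 ≤ # (adj G v)
      deg≥5 v = degree-lower {n} {Δ} {k} size (sym k6) (δ v)

      dW≤3 : ∀ {w} → w ∈ W → dW w ≤ 3
      dW≤3 {w} w∈ = τ (sparse′ {w} (FW w∈))

      dN≥2 : ∀ {w} → w ∈ W → 2 ≤ dN w
      dN≥2 {w} w∈ = +-cancelˡ-≤ 3 2 (dN w) (≤-trans (deg≥5 w) (≤-trans (≤-reflexive (split w w∈)) (+-monoˡ-≤ (dN w) (dW≤3 w∈))))

      good : ∀ (T : HIT) → HIT.nl T ≤ 4 → Goal
      good T h = done T (≤-trans (double h ⊕ ≤-refl {3}) (≤-trans (n≤1+n 11) (≤-reflexive (sym n12))))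

      module _ {w} (w∈ : w ∈ W) (dN≤2 : dN w ≤ 2) where

        dW≥3 : 3 ≤ dW w
        dW≥3 = +-cancelʳ-≤ 2 3 (dW w) (≤-trans (deg≥5 w) (≤-trans (≤-reflexive (split w w∈)) (+-monoʳ-≤ (dW w) dN≤2)))

        Z : Sub n
        Z = (W ∖ ⁅ w ⁆) ∖ adj G w

        Z-elim : ∀ {z} → z ∈ Z → z ∈ W × z ≢ w × adj G w z ≡ false
        Z-elim {z} e = let (a , b) = ∖-elim {(W ∖ ⁅ w ⁆) z} e ; (c , d) = ∖-elim {W z} a in c , ==⇒≢ d , b

        Z≥2 : 2 ≤ # Z
        Z≥2 = arith (trans (sym (#-remove W w∈)) k6) (#-split (W ∖ ⁅ w ⁆) (adj G w))
                (≤-trans (#-mono {P = (W ∖ ⁅ w ⁆) ∩ adj G w} {Q = W ∩ adj G w} λ v e → let (a , b) = ∧-elim {(W ∖ ⁅ w ⁆) v} e in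
                   ∧-intro (proj₁ (∖-elim {W v} a)) b) (dW≤3 w∈))
          where
          arith : ∀ {a b c} → suc a ≡ 6 → a ≡ b + c → b ≤ 3 → 2 ≤ c
          arith {b = b} {c} refl eq b≤ = +-cancelˡ-≤ 3 2 c (≤-trans (≤-reflexive eq) (+-monoˡ-≤ c b≤))

        -- x adopts both w and z.
        through : ∀ {x z} → x ∈ N → Adj G x w → z ∈ Z → Adj G x z → Goal
        through {x} {z} x∈ xw z∈ xz = good T₂.add (arith {# P} {# Q} {HIT.nl T₂.add}
            (≤-trans (≤-reflexive (sym Δ5)) (P-all z∉N)) (≤-trans dW≥3 (Q-all apart)) (≤-trans total (≤-reflexive n12)))
          where
          z∈W = proj₁ (Z-elim {z} z∈)
          z≢w = proj₁ (proj₂ (Z-elim {z} z∈))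
          w≁z = proj₂ (proj₂ (Z-elim {z} z∈))
          z∉N = proj₂ (W-elim {z} z∈W)
          open Adopt {w} {x} {z} w∈ x∈ xw xz (proj₁ (W-elim {z} z∈W)) z≢w using (P; Q; P-all; Q-all; module Last)
          apart : z ∈ W → Adj G w z → ⊥
          apart _ a = true≢false a w≁z
          open Last (≤-trans (s≤s (s≤s z≤n)) (≤-trans dW≥3 (Q-all apart)))
          arith : ∀ {p q l} → 5 ≤ p → 3 ≤ q → p + q + l ≤ 12 → l ≤ 4
          arith {p} {q} {l} a b c = ≮⇒≥ less
            where
            less : suc 4 ≤ l → ⊥
            less h = clash 0 (h ⊕ a ⊕ b ⊕ c) (solve (p ∷ₗ q ∷ₗ l ∷ₗ []ₗ))

        -- u, x, w and a common neighbour a of the two remaining vertices are the internal vertices.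
        module Cover {x a y z₁ z₂} (x∈ : x ∈ N) (xw : Adj G x w) (a∈ : a ∈ N) (a≢x : a ≢ x) (az₁ : Adj G a z₁) (az₂ : Adj G a z₂)
                     (z₁∈ : z₁ ∈ Z) (z₂∈ : z₂ ∈ Z) (z₁≢z₂ : z₁ ≢ z₂) (x≁z₁ : adj G x z₁ ≡ false) (x≁z₂ : adj G x z₂ ≡ false)
                     (xy : Adj G x y) (y≢u : y ≢ u) (y≢w : y ≢ w) (y≢a : y ≢ a) where
          open Adopt {w} {x} {y} w∈ x∈ xw xy y≢u y≢w using (P; Q; PQ; S₁∉; module Last)

          open Last (s≤s⁻¹ (≤-trans dW≥3 (#-remove-≤ (W ∩ adj G w) y)))

          S₂ = HIT.S T₂.add

          z∉ : ∀ {z} → z ∈ Z → adj G x z ≡ false → z ∉ S₂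
          z∉ {z} z∈ x≁z = ∨-false (S₁∉ {z} (proj₁ (Z-elim {z} z∈)) (proj₁ (proj₂ (Z-elim {z} z∈))) (λ { refl → true≢false xy x≁z }))
              (¬true λ q → true≢false (proj₂ (∧-elim {W z} (proj₁ (∖-elim {(W ∩ adj G w) z} q)))) (proj₂ (proj₂ (Z-elim {z} z∈))))

          new : ∀ {z} → z ∈ pair z₁ z₂ → z ∉ S₂
          new {z} = pair-all {R = _∉ S₂} z₁ z₂ (z∉ {z₁} z₁∈ x≁z₁) (z∉ {z₂} z₂∈ x≁z₂) {z}

          module T₃ = Add T₂.add a (∨-introˡ (∨-introˡ (∨-introʳ {a == u} (∖-intro a∈ (≢⇒== {a = a} {y} (y≢a ∘ sym)))))) (~⇒≢ a∈ ∘ sym)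
                          (pair z₁ z₂) (≤-reflexive (sym (#-pair z₁≢z₂))) (λ {z} → new {z}) (pair-all {R = Adj G a} z₁ z₂ az₁ az₂)

          cover : Goal
          cover = good T₃.add (arith {# P} {# Q} {HIT.nl T₂.add} {HIT.nl T₃.add}
                    (≤-trans (≤-reflexive (sym Δ5) ⊕ dW≥3) PQ) (≤-trans total (≤-reflexive n12))
                    (≤-trans (≤-reflexive (cong (_+ HIT.nl T₃.add) (sym (#-pair z₁≢z₂)))) T₃.add-nl))
            where
            arith : ∀ {p q l m} → 5 + 3 ≤ suc (p + q) → p + q + l ≤ 12 → 2 + m ≤ suc l → m ≤ 4
            arith {p} {q} {l} {m} a b c = ≮⇒≥ less
              where
              less : suc 4 ≤ m → ⊥
              less h = clash 0 (h ⊕ a ⊕ b ⊕ c) (solve (p ∷ₗ q ∷ₗ l ∷ₗ m ∷ₗ []ₗ))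

        -- Neither `z₁` nor `z₂` is adjacent to `x₁` or `x₂`, so each has two neighbours among the
        -- three other vertices of `N`, and two such pairs intersect.
        module Common {x₁ x₂ z₁ z₂} (x₁∈ : x₁ ∈ N) (x₂∈ : x₂ ∈ N) (x₂≢x₁ : x₂ ≢ x₁) (x₁w : Adj G x₁ w)
                      (z₁∈ : z₁ ∈ Z) (z₂∈ : z₂ ∈ Z) (z₁≢z₂ : z₁ ≢ z₂)
                      (a₁₁ : adj G x₁ z₁ ≡ false) (a₁₂ : adj G x₁ z₂ ≡ false) (a₂₁ : adj G x₂ z₁ ≡ false) (a₂₂ : adj G x₂ z₂ ≡ false) where

          N′ : Sub n
          N′ = (N ∖ ⁅ x₁ ⁆) ∖ ⁅ x₂ ⁆

          in-N′ : ∀ {z v} → adj G x₁ z ≡ false → adj G x₂ z ≡ false → v ∈ N ∩ adj G z → v ∈ N′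
          in-N′ {z} {v} b c e = let (v∈ , zv) = ∧-elim {N v} e in
            ∖-intro (∖-intro v∈ (≢⇒== {a = v} {x₁} λ { refl → true≢false (~-sym zv) b })) (≢⇒== {a = v} {x₂} λ { refl → true≢false (~-sym zv) c })

          N′3 : # N′ ≡ 3
          N′3 = suc-injective (suc-injective (trans (cong suc (sym (#-remove (N ∖ ⁅ x₁ ⁆) (∖-intro x₂∈ (≢⇒== x₂≢x₁))))) (trans (sym (#-remove N x₁∈)) Δ5)))

          common : (∀ v → v ∉ ((N ∩ adj G z₁) ∩ (N ∩ adj G z₂))) → ⊥
          common none = case ≤-trans (dN≥2 (proj₁ (Z-elim {z₁} z₁∈)) ⊕ dN≥2 (proj₁ (Z-elim {z₂} z₂∈)))
              (≤-trans (≤-reflexive (sym (#-⊎ (N ∩ adj G z₁) (N ∩ adj G z₂) λ v a → ¬true λ b → true≢false (∧-intro a b) (none v))))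
                (≤-trans (#-mono {P = (N ∩ adj G z₁) ∪ (N ∩ adj G z₂)} {Q = N′} λ v e →
                    [ in-N′ {z₁} {v} a₁₁ a₂₁ , in-N′ {z₂} {v} a₁₂ a₂₂ ]′ (∨-elim {(N ∩ adj G z₁) v} e)) (≤-reflexive N′3))) of λ { (s≤s (s≤s (s≤s ()))) }

          from-y : ∀ {a} → a ∈ N → Adj G z₁ a → Adj G z₂ a → (∃ λ y → Adj G x₁ y × All (y ≢_) (u ∷ w ∷ a ∷ [])) → Goal
          from-y a∈ za₁ za₂ (y , xy , y≢u ∷ y≢w ∷ y≢a ∷ []) = Cover.cover x₁∈ x₁w a∈ (λ { refl → true≢false (~-sym za₁) a₁₁ }) (~-sym za₁) (~-sym za₂)
            z₁∈ z₂∈ z₁≢z₂ a₁₁ a₁₂ xy y≢u y≢w y≢a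

          common-goal : Goal
          common-goal = case search ((N ∩ adj G z₁) ∩ (N ∩ adj G z₂)) of λ where
            (inj₂ none) → ⊥-elim (common none)
            (inj₁ (a , e)) → let (b , c) = ∧-elim {(N ∩ adj G z₁) a} e ; (a∈ , za₁) = ∧-elim {N a} b ; (_ , za₂) = ∧-elim {N a} c in
              from-y a∈ za₁ za₂ (pick (adj G x₁) (u ∷ w ∷ a ∷ []) (≤-trans (n≤1+n 4) (deg≥5 x₁)))

        from-pairs : ∀ {x₁ x₂ z₁ z₂} → x₁ ∈ N ∩ adj G w → x₂ ∈ N ∩ adj G w → x₂ ≢ x₁ → z₁ ∈ Z → z₂ ∈ Z → z₂ ≢ z₁ → Goal
        from-pairs {x₁} {x₂} {z₁} {z₂} e₁ e₂ x≢ z₁∈ z₂∈ z≢ =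
          [ through x₁∈ x₁w z₁∈ , (λ b₁ → [ through x₁∈ x₁w z₂∈ , (λ b₂ → [ through x₂∈ x₂w z₁∈ , (λ b₃ → [ through x₂∈ x₂w z₂∈ , (λ b₄ →
            Common.common-goal x₁∈ x₂∈ x≢ x₁w z₁∈ z₂∈ (z≢ ∘ sym) b₁ b₂ b₃ b₄) ]′ (bool (adj G x₂ z₂))) ]′ (bool (adj G x₂ z₁))) ]′
            (bool (adj G x₁ z₂))) ]′ (bool (adj G x₁ z₁))
          where
          x₁∈ = proj₁ (∧-elim {N x₁} e₁)
          x₂∈ = proj₁ (∧-elim {N x₂} e₂)
          x₁w = ~-sym (proj₂ (∧-elim {N x₁} e₁))
          x₂w = ~-sym (proj₂ (∧-elim {N x₂} e₂))

        two-of : ∀ (P : Sub n) → 2 ≤ # P → ∃ λ a → ∃ λ b → a ∈ P × b ∈ P × b ≢ a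
        two-of P h = let (a , a∈ , _) = pick P [] (<⇒≤ h) ; (b , b∈ , b≢) = pick P (a ∷ []) h in a , b , a∈ , b∈ , (case b≢ of λ { (q ∷ []) → q })

        w-goal : Goal
        w-goal = let (x₁ , x₂ , e₁ , e₂ , x≢) = two-of (N ∩ adj G w) (dN≥2 w∈) ; (z₁ , z₂ , z₁∈ , z₂∈ , z≢) = two-of Z Z≥2 in
          from-pairs e₁ e₂ x≢ z₁∈ z₂∈ z≢

      six-goal : Goal
      six-goal = case search (λ w → W w ∧ does (dN w ≤? 2)) of λ where
        (inj₁ (w , e)) → let (a , b) = ∧-elim {W w} e in w-goal a (does-true (dN w ≤? 2) b)
        (inj₂ none) → ⊥-elim (from-no (18 ≤? 15) (≤-trans (subst (λ m → 3 * m ≤ sumOver W dN) k6 (sumOver-≥ W (λ {w} w∈ → ≰⇒> λ h → true≢false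
                        (∧-intro w∈ (dec-true (dN w ≤? 2) h)) (none w)))) (subst (λ m → sumOver W dN ≤ 3 * m) Δ5 (∑dN 3 τ))))

    dense-goal : Goal
    dense-goal = case spec of λ where
      (five k5 Δ≤6 τ) → ⊥-elim (Five.five-⊥ k5 Δ≤6 τ)
      (six k6 Δ5 τ) → Six.six-goal k6 Δ5 τ

  initial : Goal
  initial = [ id , (λ FN → [ id , (λ FW → Dense.dense-goal (λ {x} → FN x) (λ {w} → FW w)) ]′ (collect {A = Goal} {B = λ w → w ∈ W → Sparse w} on-W)) ]′
              (collect {A = Goal} {B = λ x → x ∈ N → Sparse x} on-N)
    where
    on-N : ∀ x → Goal ⊎ (x ∈ N → Sparse x)
    on-N x = [ (λ x∈ → [ inj₁ , (λ h → inj₂ λ _ → h) ]′ (N-sparse x x∈)) , (λ x∉ → inj₂ λ x∈ → ⊥-elim (true≢false x∈ x∉)) ]′ (bool (N x))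
    on-W : ∀ w → Goal ⊎ (w ∈ W → Sparse w)
    on-W w = [ (λ w∈ → [ inj₁ , (λ h → inj₂ λ _ → h) ]′ (W-sparse w w∈)) , (λ w∉ → inj₂ λ w∈ → ⊥-elim (true≢false w∈ w∉)) ]′ (bool (W w))

-- The exceptional graph

⌊⌋-true : ∀ {A : Set} (d : Dec A) → A → ⌊ d ⌋ ≡ true
⌊⌋-true d a = trans (isYes≗does d) (dec-true d a)

⌊⌋-false : ∀ {A : Set} (d : Dec A) → ¬ A → ⌊ d ⌋ ≡ false
⌊⌋-false d a = trans (isYes≗does d) (dec-false d a)

⌊⌋-elim : ∀ {A : Set} (d : Dec A) → ⌊ d ⌋ ≡ true → A
⌊⌋-elim d e = does-true d (trans (sym (isYes≗does d)) e)

-- In order `3 + m` the labels `2 + m`, `1 + m` and `m` belong to the end of the path, its middle,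
-- and the clique vertex that carries it.
module Tail (m : ℕ) where

  V : Set
  V = Fin (3 + m)

  adjD : V → V → Bool
  adjD = Dadj (3 + m)

  private
    <⇒¬ : ∀ {a b} → a < b → a ≢ b
    <⇒¬ h refl = <-irrefl refl h

    >⇒¬ : ∀ {a b} → b < a → a ≢ b
    >⇒¬ h refl = <-irrefl refl h

    no≟ : ∀ {a b} → a ≢ b → ⌊ a ≟ℕ b ⌋ ≡ false
    no≟ {a} {b} = ⌊⌋-false (a ≟ℕ b)

    yes≟ : ∀ {a b} → a ≡ b → ⌊ a ≟ℕ b ⌋ ≡ true
    yes≟ {a} {b} = ⌊⌋-true (a ≟ℕ b)

    no<? : ∀ {a b} → b ≤ a → ⌊ a <? b ⌋ ≡ false
    no<? {a} {b} h = ⌊⌋-false (a <? b) λ g → <-irrefl refl (≤-trans g h)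

    yes<? : ∀ {a b} → a < b → ⌊ a <? b ⌋ ≡ true
    yes<? {a} {b} = ⌊⌋-true (a <? b)

  last-row : ∀ i j → toℕ i ≡ 2 + m → adjD i j ≡ ⌊ toℕ j ≟ℕ 1 + m ⌋
  last-row i j e rewrite e | no<? {2 + m} {1 + m} (n≤1+n _) | no≟ {2 + m} {m} (>⇒¬ (n≤1+n _)) | no≟ {2 + m} {1 + m} (>⇒¬ ≤-refl)
    | yes≟ {2 + m} refl = refl

  middle-row : ∀ i j → toℕ i ≡ 1 + m → adjD i j ≡ ⌊ toℕ j ≟ℕ m ⌋ ∨ ⌊ toℕ j ≟ℕ 2 + m ⌋
  middle-row i j e rewrite e | no<? {1 + m} {1 + m} ≤-refl | no≟ {1 + m} {m} (>⇒¬ ≤-refl) | yes≟ {1 + m} refl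
    | no≟ {1 + m} {2 + m} (<⇒¬ ≤-refl) = cong (⌊ toℕ j ≟ℕ m ⌋ ∨_) (∨-identityʳ _)

  clique-last : ∀ i j → toℕ i ≤ m → toℕ j ≡ 2 + m → adjD i j ≡ false
  clique-last i j a e rewrite e | yes<? {toℕ i} {1 + m} (s≤s a) | no<? {2 + m} {1 + m} (n≤1+n _) | no≟ {2 + m} {1 + m} (>⇒¬ ≤-refl)
    | no≟ {2 + m} {m} (>⇒¬ (n≤1+n _)) | no≟ {toℕ i} {1 + m} (<⇒¬ (s≤s a)) | no≟ {toℕ i} {2 + m} (<⇒¬ (s≤s (≤-trans a (n≤1+n m)))) with ⌊ toℕ i ≟ℕ m ⌋
  ... | true = refl
  ... | false = refl

  clique-middle : ∀ i j → toℕ i ≤ m → toℕ j ≡ 1 + m → adjD i j ≡ ⌊ toℕ i ≟ℕ m ⌋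
  clique-middle i j a e rewrite e | yes<? {toℕ i} {1 + m} (s≤s a) | no<? {1 + m} {1 + m} ≤-refl | yes≟ {1 + m} refl
    | no≟ {1 + m} {m} (>⇒¬ ≤-refl) | no≟ {toℕ i} {1 + m} (<⇒¬ (s≤s a)) | no≟ {toℕ i} {2 + m} (<⇒¬ (s≤s (≤-trans a (n≤1+n m)))) with ⌊ toℕ i ≟ℕ m ⌋
  ... | true = refl
  ... | false = refl

  clique : ∀ i j → toℕ i ≤ m → toℕ j ≤ m → toℕ i ≢ toℕ j → adjD i j ≡ true
  clique i j a b e rewrite yes<? {toℕ i} {1 + m} (s≤s a) | yes<? {toℕ j} {1 + m} (s≤s b) | no≟ e = refl

  diagonal : ∀ i → toℕ i ≤ m → adjD i i ≡ false
  diagonal i a rewrite yes<? {toℕ i} {1 + m} (s≤s a) | yes≟ {toℕ i} refl | no≟ {toℕ i} {1 + m} (<⇒¬ (s≤s a))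
    | no≟ {toℕ i} {2 + m} (<⇒¬ (s≤s (≤-trans a (n≤1+n m)))) with ⌊ toℕ i ≟ℕ m ⌋
  ... | true = refl
  ... | false = refl

  pW pX pP : V
  pW = fromℕ< {2 + m} ≤-refl
  pX = fromℕ< {1 + m} (n≤1+n _)
  pP = fromℕ< {m} (≤-trans (n≤1+n _) (n≤1+n _))

  toℕ-pW : toℕ pW ≡ 2 + m
  toℕ-pW = toℕ-fromℕ< {2 + m} ≤-refl

  toℕ-pX : toℕ pX ≡ 1 + m
  toℕ-pX = toℕ-fromℕ< {1 + m} (n≤1+n _)

  toℕ-pP : toℕ pP ≡ m
  toℕ-pP = toℕ-fromℕ< {m} (≤-trans (n≤1+n _) (n≤1+n _))

  pW≢pX : pW ≢ pX
  pW≢pX e = >⇒¬ ≤-refl (trans (sym toℕ-pW) (trans (cong toℕ e) toℕ-pX))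

  pW≢pP : pW ≢ pP
  pW≢pP e = >⇒¬ (n≤1+n _) (trans (sym toℕ-pW) (trans (cong toℕ e) toℕ-pP))

  pX≢pP : pX ≢ pP
  pX≢pP e = >⇒¬ ≤-refl (trans (sym toℕ-pX) (trans (cong toℕ e) toℕ-pP))

  -- In D_n the end of the path is a leaf of T, hence its neighbour has degree 2 in T.
  no-HIST : (G : Graph (3 + m)) → HasHIST G → ¬ (G ≅ᵃ adjD)
  no-HIST G (T , (T⊆G , connected , _) , no-2) (f , iso) = [ both , separated ]′ (bool (adj T x p))
    where
    w x p : V
    w = f ⟨$⟩ˡ pW
    x = f ⟨$⟩ˡ pX
    p = f ⟨$⟩ˡ pP

    at : ∀ {v q} → toℕ (f ⟨$⟩ʳ v) ≡ toℕ q → v ≡ f ⟨$⟩ˡ q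
    at e = trans (sym (inverseˡ f)) (cong (f ⟨$⟩ˡ_) (toℕ-injective e))

    row-w : ∀ {v} → Adj G w v → v ≡ x
    row-w {v} a = at (trans (⌊⌋-elim (toℕ (f ⟨$⟩ʳ v) ≟ℕ 1 + m)
      (trans (sym (last-row (f ⟨$⟩ʳ w) (f ⟨$⟩ʳ v) (trans (cong toℕ (inverseʳ f)) toℕ-pW))) (trans (sym (iso w v)) a))) (sym toℕ-pX))

    row-x : ∀ {v} → Adj G x v → (v ≡ p) ⊎ (v ≡ w)
    row-x {v} a = case ∨-elim {⌊ toℕ (f ⟨$⟩ʳ v) ≟ℕ m ⌋}
        (trans (sym (middle-row (f ⟨$⟩ʳ x) (f ⟨$⟩ʳ v) (trans (cong toℕ (inverseʳ f)) toℕ-pX))) (trans (sym (iso x v)) a)) of λ where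
      (inj₁ e) → inj₁ (at (trans (⌊⌋-elim (toℕ (f ⟨$⟩ʳ v) ≟ℕ m) e) (sym toℕ-pP)))
      (inj₂ e) → inj₂ (at (trans (⌊⌋-elim (toℕ (f ⟨$⟩ʳ v) ≟ℕ 2 + m) e) (sym toℕ-pW)))

    apart : ∀ {q r} → q ≢ r → f ⟨$⟩ˡ q ≢ f ⟨$⟩ˡ r
    apart q≢r e = q≢r (trans (sym (inverseʳ f)) (trans (cong (f ⟨$⟩ʳ_) e) (inverseʳ f)))

    T-sym : ∀ {a b} → Adj T a b → Adj T b a
    T-sym {a} {b} e = trans (adj-sym T b a) e

    -- Any walk from `w` to another vertex starts with an edge of `T`, and `x` is the only neighbour
    -- of `w`.
    wx : Walk T w p → Adj T w x
    wx here' = first here' refl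
      where
      first : ∀ {q} → Walk T w q → q ≡ p → Adj T w x
      first here e = ⊥-elim (apart pW≢pP e)
      first (step {w = v} a _) _ = subst (Adj T w) (row-w (T⊆G w v a)) a

    both : Adj T x p → ⊥
    both a = no-2 x (trans (degree-# T x) (trans (#-cong {P = adj T x} {Q = pair w p} λ v → bool-ext
        (λ b → case row-x (T⊆G x v b) of λ { (inj₁ refl) → ∈-pairʳ w p ; (inj₂ refl) → ∈-pairˡ w p })
        (pair-all {R = Adj T x} w p (T-sym (wx (connected w p))) a))
      (#-pair (apart pW≢pP))))

    -- Without the edge from `x` to `p`, no edge of `T` leaves the pair `w`, `x`, although `T` is
    -- connected.
    separated : adj T x p ≡ false → ⊥
    separated na with boundary-edge T (pair w x) (connected w p) (∈-pairˡ w x)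
                        (∨-false (≢⇒== (apart (pW≢pP ∘ sym))) (≢⇒== (apart (pX≢pP ∘ sym))))
    ... | a , b , a∈ , b∉ , ab with pair-elim {a = w} {x} {a} a∈
    ... | inj₁ refl = true≢false (subst (_∈ pair w x) (sym (row-w (T⊆G _ b ab))) (∈-pairʳ w x)) b∉
    ... | inj₂ refl with row-x (T⊆G _ b ab)
    ... | inj₁ refl = true≢false ab na
    ... | inj₂ refl = true≢false (∈-pairˡ w x) b∉

  private
    transpose-at : ∀ (i j : V) → transpose i j ⟨$⟩ʳ i ≡ j
    transpose-at i j rewrite ==-refl i = refl

    transpose-off : ∀ {i j k : V} → k ≢ i → k ≢ j → transpose i j ⟨$⟩ʳ k ≡ k
    transpose-off k≢i k≢j rewrite ≢⇒== k≢i | ≢⇒== k≢j = refl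

  perm-injective : (π : Perm (3 + m)) → ∀ {a b} → π ⟨$⟩ʳ a ≡ π ⟨$⟩ʳ b → a ≡ b
  perm-injective π e = trans (sym (inverseˡ π)) (trans (cong (π ⟨$⟩ˡ_) e) (inverseˡ π))

  -- Three transpositions in turn. The targets are distinct and permutations are injective, so a
  -- later transposition does not move what has been placed.
  place : ∀ {w x p : V} → w ≢ x → w ≢ p → x ≢ p → Σ (Perm (3 + m)) λ π → π ⟨$⟩ʳ w ≡ pW × π ⟨$⟩ʳ x ≡ pX × π ⟨$⟩ʳ p ≡ pP
  place {w} {x} {p} w≢x w≢p x≢p = (π₁ ∘ₚ π₂) ∘ₚ π₃
      , trans (cong (π₃ ⟨$⟩ʳ_) w₂) (transpose-off (λ e → w≢p (perm-injective (π₁ ∘ₚ π₂) (trans w₂ e))) pW≢pP)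
      , trans (cong (π₃ ⟨$⟩ʳ_) x₂) (transpose-off (λ e → x≢p (perm-injective (π₁ ∘ₚ π₂) (trans x₂ e))) pX≢pP)
      , transpose-at ((π₁ ∘ₚ π₂) ⟨$⟩ʳ p) pP
    where
    π₁ = transpose w pW
    π₂ = transpose (π₁ ⟨$⟩ʳ x) pX
    π₃ = transpose ((π₁ ∘ₚ π₂) ⟨$⟩ʳ p) pP
    w₁ : π₁ ⟨$⟩ʳ w ≡ pW
    w₁ = transpose-at w pW
    w₂ : (π₁ ∘ₚ π₂) ⟨$⟩ʳ w ≡ pW
    w₂ = trans (cong (π₂ ⟨$⟩ʳ_) w₁) (transpose-off (λ e → w≢x (perm-injective π₁ (trans w₁ e))) pW≢pX)
    x₂ : (π₁ ∘ₚ π₂) ⟨$⟩ʳ x ≡ pX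
    x₂ = transpose-at (π₁ ⟨$⟩ʳ x) pX

  module Placed (G : Graph (3 + m)) (P : Pendant G) (π : Perm (3 + m)) (fw : π ⟨$⟩ʳ Pendant.w P ≡ pW)
                (fx : π ⟨$⟩ʳ Pendant.x P ≡ pX) (fp : π ⟨$⟩ʳ Pendant.p P ≡ pP) where
    open Pendant P

    f : V → V
    f = π ⟨$⟩ʳ_

    tw = trans (cong toℕ fw) toℕ-pW
    tx = trans (cong toℕ fx) toℕ-pX
    tp = trans (cong toℕ fp) toℕ-pP

    same : ∀ {a v l} → toℕ (f a) ≡ l → (v == a) ≡ ⌊ toℕ (f v) ≟ℕ l ⌋
    same {a} {v} {l} e = bool-ext
      (λ h → ⌊⌋-true (toℕ (f v) ≟ℕ l) (trans (cong (toℕ ∘ f) (==⇒≡ h)) e))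
      (λ h → subst (λ z → (v == z) ≡ true) (perm-injective π (toℕ-injective (trans (⌊⌋-elim (toℕ (f v) ≟ℕ l) h) (sym e)))) (==-refl v))

    -- The two largest labels are already taken by `w` and `x`.
    low : ∀ {v} → v ≢ w → v ≢ x → toℕ (f v) ≤ m
    low {v} v≢w v≢x = s≤s⁻¹ (strict (s≤s⁻¹ (strict (s≤s⁻¹ (toℕ<n (f v))) λ e → v≢w (inj (trans e (sym tw))))) λ e → v≢x (inj (trans e (sym tx))))
      where
      inj : ∀ {b} → toℕ (f v) ≡ toℕ (f b) → v ≡ b
      inj e = perm-injective π (toℕ-injective e)
      strict : ∀ {a b} → a ≤ b → a ≢ b → a < b
      strict h ne = case m≤n⇒m<n∨m≡n h of λ { (inj₁ l) → l ; (inj₂ e) → ⊥-elim (ne e) }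

    iso : ∀ a b → adj G a b ≡ adjD (f a) (f b)
    iso a b with a ≟ w | a ≟ x
    ... | yes refl | _ = trans (adj-w b) (trans (same tx) (sym (last-row (f a) (f b) tw)))
    ... | no _ | yes refl = trans (adj-x b) (trans (∨-comm (b == w) (b == p)) (trans (cong₂ _∨_ (same tp) (same tw)) (sym (middle-row (f a) (f b) tx))))
    ... | no a≢w | no a≢x with b ≟ w | b ≟ x
    ... | yes refl | _ = trans (adj-sym G a b) (trans (adj-w a) (trans (≢⇒== a≢x) (sym (clique-last (f a) (f b) (low a≢w a≢x) tw))))
    ... | no _ | yes refl = trans (adj-sym G a b) (trans (adj-x a) (trans (cong (_∨ (a == p)) (≢⇒== a≢w))
            (trans (same tp) (sym (clique-middle (f a) (f b) (low a≢w a≢x) tx)))))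
    ... | no b≢w | no b≢x with a ≟ b
    ... | yes refl = trans (adj-irrefl G a) (sym (diagonal (f a) (low a≢w a≢x)))
    ... | no a≢b = trans (rest a≢w a≢x b≢w b≢x a≢b) (sym (clique (f a) (f b) (low a≢w a≢x) (low b≢w b≢x)
            (λ e → a≢b (perm-injective π (toℕ-injective e)))))

  pendant⇒≅D : (G : Graph (3 + m)) → Pendant G → G ≅ᵃ adjD
  pendant⇒≅D G P = let (π , fw , fx , fp) = place w≢x w≢p x≢p in π , Placed.iso G P π fw fx fp
    where open Pendant P

-- Order 10

module Certificates where

  Vertex : Set
  Vertex = Fin 10

  -- Partial knowledge of an adjacency relation; `nothing` marks an undecided pair.
  State : Set
  State = Vertex → Vertex → Maybe Bool

  update : State → Vertex → Vertex → Bool → State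
  update s i j b x y = if ((x == i) ∧ (y == j)) ∨ ((x == j) ∧ (y == i)) then just b else s x y

  possible : Maybe Bool → Bool
  possible (just false) = false
  possible _ = true

  ub : State → Vertex → ℕ
  ub s v = ∑ (λ w → [ possible (s v w) ]ᵇ)

  -- Fuel 10 suffices for ten vertices. On a vertex that never reaches the root, both it and its
  -- parent get depth 10, and `isTree` rejects the map.
  depth : ℕ → Vertex → Vec Vertex 10 → Vertex → ℕ
  depth zero _ _ _ = 0
  depth (suc f) r p v = if v == r then 0 else suc (depth f r p (lookupᵛ p v))

  treeDeg : Vertex → Vec Vertex 10 → Vertex → ℕ
  -- The sum has the shape of `child` for the full vertex set, so that `degs` holds by unfolding.
  treeDeg r p q = ∑ (λ c → [ (true ∧ not (c == r)) ∧ (lookupᵛ p c == q) ]ᵇ) + [ not (q == r) ]ᵇ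

  allᵇ : ∀ {n} → (Fin n → Bool) → Bool
  allᵇ {zero} f = true
  allᵇ {suc n} f = f zero ∧ allᵇ (f ∘ suc)

  allᵇ-elim : ∀ {n} (f : Fin n → Bool) → allᵇ f ≡ true → ∀ v → f v ≡ true
  allᵇ-elim f e zero = proj₁ (∧-elim {f zero} e)
  allᵇ-elim f e (suc v) = allᵇ-elim (f ∘ suc) (proj₂ (∧-elim {f zero} e)) v

  isTree : Vertex → Vec Vertex 10 → Bool
  isTree r p = allᵇ (λ v → ((v == r) ∨ does (depth 10 r p (lookupᵛ p v) <? depth 10 r p v)) ∧ not (treeDeg r p v isᵇ 2))

  isAbsent : Maybe Bool → Bool
  isAbsent (just false) = true
  isAbsent _ = false

  -- A refutation is a decision tree in preorder, written as a list of digits. Two different digits a, b claim that the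
  -- vertices a and b are known to be non-adjacent and have fewer than 8 possible neighbours in total. Two equal digits r
  -- propose the spanning tree with root r whose parent map is given by the next ten digits; they are followed, for every
  -- edge of that tree that is not yet known, by a refutation of the absence of that edge.
  take-parents : ∀ k → List Vertex → Maybe (Vec Vertex k × List Vertex)
  take-parents zero ds = just ([] , ds)
  take-parents (suc k) [] = nothing
  take-parents (suc k) (d ∷ ds) = map-Maybe (λ (p , ds') → d ∷ p , ds') (take-parents k ds)

  check : ℕ → State → List Vertex → Maybe (List Vertex)
  checkTree : ℕ → State → Vertex → Maybe (Vec Vertex 10 × List Vertex) → Maybe (List Vertex)
  checkEdges : ℕ → State → Vertex → Vec Vertex 10 → List Vertex → List Vertex → Maybe (List Vertex)
  checkEdge : Maybe Bool → ℕ → State → Vertex → Vec Vertex 10 → Vertex → List Vertex → List Vertex → Maybe (List Vertex)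

  contradictory : State → Vertex → Vertex → Bool
  -- The 8 is `n - 2` for order 10, the least degree sum that a non-adjacent pair may have.
  contradictory s a b = isAbsent (s a b) ∧ does (ub s a + ub s b <? 8)

  check (suc f) s (a ∷ b ∷ ds) =
    if a == b then checkTree f s a (take-parents 10 ds) else (if contradictory s a b then just ds else nothing)
  check _ _ _ = nothing

  checkTree f s r (just (p , ds)) = if isTree r p then checkEdges f s r p (allFin 10) ds else nothing
  checkTree f s r nothing = nothing

  checkEdges f s r p [] ds = just ds
  checkEdges f s r p (v ∷ vs) ds = if v == r then checkEdges f s r p vs ds else checkEdge (s v (lookupᵛ p v)) f s r p v vs ds

  checkEdge (just true) f s r p v vs ds = checkEdges f s r p vs ds
  checkEdge (just false) f s r p v vs ds = nothing
  checkEdge nothing f s r p v vs ds =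
    -- The remaining edges are treated with this one taken to be present, so later refutations may
    -- rely on it.
    check f (update s v (lookupᵛ p v) false) ds >>= λ ds' → checkEdges f (update s v (lookupᵛ p v) true) r p vs ds'

  module Soundness (G : Graph 10) (σ : DegreeSum G) where

    open HITs G

    Found : Set
    Found = Σ Vertex λ ρ → Σ (Rooted (λ _ → true) ρ) λ U → ∀ {v} → deg U v ≢ 2

    Consistent : State → Set
    Consistent s = ∀ x y {b} → s x y ≡ just b → adj G x y ≡ b

    update-consistent : ∀ {s} i j b → Consistent s → adj G i j ≡ b → Consistent (update s i j b)
    update-consistent {s} i j b con e x y {b'} eq with x ≟ i | y ≟ j | x ≟ j | y ≟ i
    ... | yes refl | yes refl | _ | _ = trans e (just-injective eq)
    ... | yes refl | no _ | yes refl | yes refl = trans e (just-injective eq)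
    ... | no _ | _ | yes refl | yes refl = trans (adj-sym G x y) (trans e (just-injective eq))
    ... | yes refl | no _ | yes _ | no _ = con x y eq
    ... | yes refl | no _ | no _ | _ = con x y eq
    ... | no _ | _ | yes _ | no _ = con x y eq
    ... | no _ | _ | no _ | _ = con x y eq

    ub-bound : ∀ {s} → Consistent s → ∀ v → # (adj G v) ≤ ub s v
    ub-bound {s} con v = ≤-trans (≤-reflexive (#-∑ {P = adj G v})) (∑-mono pt)
      where
      pt : ∀ w → [ adj G v w ]ᵇ ≤ [ possible (s v w) ]ᵇ
      pt w with s v w in eq
      ... | nothing = []ᵇ-mono (λ _ → refl)
      ... | just true = []ᵇ-mono (λ _ → refl)
      ... | just false rewrite con v w eq = z≤n

    isAbsent-elim : ∀ {m} → isAbsent m ≡ true → m ≡ just false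
    isAbsent-elim {just false} _ = refl

    absurd-sound : ∀ {s} → Consistent s → ∀ a b → a ≢ b → contradictory s a b ≡ true → ⊥
    absurd-sound {s} con a b a≢b e = <-irrefl refl (≤-trans (s≤s (ub-bound con a ⊕ ub-bound con b))
        (≤-trans (does-true (ub s a + ub s b <? 8) (proj₂ parts)) (+-cancelˡ-≤ 2 8 _ (σ a≢b (con a b (isAbsent-elim (proj₁ parts)))))))
      where
      parts = ∧-elim {isAbsent (s a b)} e

    tree-found : ∀ r p → isTree r p ≡ true → (∀ v → v ≢ r → Adj G v (lookupᵛ p v)) → Found
    tree-found r p e edges = r , U , λ {v} d → case trans (sym (proj₂ (at v))) (cong not (isᵇ-intro (trans (sym (degs v)) d))) of λ ()
      where
      rank : Vertex → ℕ
      rank = depth 10 r p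
      at : ∀ v → ((v == r) ∨ does (rank (lookupᵛ p v) <? rank v) ≡ true) × (not (treeDeg r p v isᵇ 2) ≡ true)
      at v = ∧-elim {(v == r) ∨ does (rank (lookupᵛ p v) <? rank v)} (allᵇ-elim (λ z → ((z == r) ∨ does (rank (lookupᵛ p z) <? rank z)) ∧ not (treeDeg r p z isᵇ 2)) e v)
      rk< : ∀ {v} → v ≢ r → rank (lookupᵛ p v) < rank v
      rk< {v} v≢ = does-true (rank (lookupᵛ p v) <? rank v) (case ∨-elim {v == r} (proj₁ (at v)) of λ { (inj₁ q) → ⊥-elim (v≢ (==⇒≡ q)) ; (inj₂ q) → q })
      rank-root : rank r ≡ 0
      rank-root = cong (λ b → if b then 0 else suc (depth 9 r p (lookupᵛ p r))) (==-refl r)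
      U : Rooted (λ _ → true) r
      U = record { par = lookupᵛ p ; rk = rank ; root∈ = refl ; par∈ = λ _ _ → refl
                 ; par~ = λ {v} _ v≢ → trans (adj-sym G _ v) (edges v v≢) ; rk-par = λ _ v≢ → rk< v≢
                 ; rk-root = λ _ v≢ → ≤-trans (≤-reflexive (cong suc rank-root)) (≤-trans (s≤s z≤n) (rk< v≢)) }
      degs : ∀ v → deg U v ≡ treeDeg r p v
      degs v = cong (_+ [ not (v == r) ]ᵇ) (#-∑ {P = child U v})

    bind-just : ∀ {A B : Set} (m : Maybe A) {k : A → Maybe B} {d} → (m >>= k) ≡ just d → ∃ λ x → m ≡ just x × k x ≡ just d
    bind-just (just x) e = x , refl , e

    -- The loop invariant of `checkEdges`: the edge to the parent is confirmed for every vertex that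
    -- has left the list.
    Unlisted : Vertex → Vec Vertex 10 → List Vertex → Set
    Unlisted r p vs = ∀ z → z ≢ r → (z ∈ᴸ vs) ⊎ Adj G z (lookupᵛ p z)

    skip : ∀ {r v vs} p → (v ≢ r → Adj G v (lookupᵛ p v)) → Unlisted r p (v ∷ vs) → Unlisted r p vs
    skip p e known z z≢ = case known z z≢ of λ where
      (inj₁ (here refl)) → inj₂ (e z≢)
      (inj₁ (there q)) → inj₁ q
      (inj₂ a) → inj₂ a

    -- Follows the actual graph through the decision tree. An absent edge leads into its refutation
    -- and a present one to the next edge, so the descent ends in a complete tree, contradictions
    -- being impossible.
    sound : ∀ f {s ds ds'} → check f s ds ≡ just ds' → Consistent s → Found
    sound-tree : ∀ f {s ds'} r m → checkTree f s r m ≡ just ds' → Consistent s → Found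
    sound-edges : ∀ f {s ds ds'} r p vs → checkEdges f s r p vs ds ≡ just ds' → Consistent s → isTree r p ≡ true → Unlisted r p vs → Found
    sound-edge : ∀ f {s ds ds'} r p v vs m → s v (lookupᵛ p v) ≡ m → checkEdge m f s r p v vs ds ≡ just ds' → Consistent s →
      isTree r p ≡ true → Unlisted r p (v ∷ vs) → Found

    sound (suc f) {s} {a ∷ b ∷ ds} e con with a ≟ b
    ... | yes _ = sound-tree f a (take-parents 10 ds) e con
    ... | no a≢b with contradictory s a b in c
    ... | true = ⊥-elim (absurd-sound con a b a≢b c)

    sound-tree f r (just (p , ds)) e con with isTree r p in t
    ... | true = sound-edges f r p (allFin 10) e con t (λ v _ → inj₁ (∈-allFin v))

    sound-edges f r p [] e con t known = tree-found r p t λ v v≢ → case known v v≢ of λ { (inj₂ a) → a }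
    sound-edges f r p (v ∷ vs) e con t known with v ≟ r
    ... | yes v≡r = sound-edges f r p vs e con t (skip p (λ v≢r → ⊥-elim (v≢r v≡r)) known)
    ... | no _ = sound-edge f r p v vs _ refl e con t known

    sound-edge f r p v vs (just true) eq e con t known = sound-edges f r p vs e con t (skip p (λ _ → con v _ eq) known)
    sound-edge f {s} {ds} r p v vs nothing eq e con t known with bind-just (check f (update s v (lookupᵛ p v) false) ds) e
    ... | ds' , e₁ , e₂ = case bool (adj G v (lookupᵛ p v)) of λ where
      (inj₂ a) → sound f e₁ (update-consistent v _ false con a)
      (inj₁ a) → sound-edges f r p vs e₂ (update-consistent v _ true con a) t (skip p (λ _ → a) known)

  nth : ∀ {A : Set} → List A → ℕ → A → A
  nth [] _ d = d
  nth (x ∷ xs) zero d = x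
  nth (x ∷ xs) (suc k) d = nth xs k d

  -- Adjacencies to the vertices 0 and 1: these two are followed by a, b, c, e vertices of the four possible kinds.
  rows : ℕ → ℕ → ℕ → ℕ → List (Bool × Bool)
  rows a b c e = (false , true) ∷ (true , false) ∷
    replicate a (true , true) ++ replicate b (true , false) ++ replicate c (false , true) ++ replicate e (false , false)

  row : Vertex → Bool × Bool → Maybe Bool → Maybe Bool
  row zero (p , q) m = just p
  row (suc zero) (p , q) m = just q
  row (suc (suc _)) _ m = m

  -- The default for `nth` is the kind of vertex 0, in agreement with the default `u` in `vertex`.
  start : List (Bool × Bool) → State
  start K i j = if i == j then just false else row i (nth K (toℕ j) (false , true)) (row j (nth K (toℕ i) (false , true)) nothing)

  start-consistent : (G : Graph 10) (σ : DegreeSum G) → ∀ K →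
    (∀ i → (adj G zero i , adj G (suc zero) i) ≡ nth K (toℕ i) (false , true)) → Soundness.Consistent G σ (start K)
  start-consistent G σ K key x y e with x ≟ y
  ... | yes refl = trans (adj-irrefl G x) (just-injective e)
  start-consistent G σ K key zero y e | no _ = trans (cong proj₁ (key y)) (just-injective e)
  start-consistent G σ K key (suc zero) y e | no _ = trans (cong proj₂ (key y)) (just-injective e)
  start-consistent G σ K key (suc (suc x)) zero e | no _ = trans (adj-sym G _ zero) (trans (cong proj₁ (key (suc (suc x)))) (just-injective e))
  start-consistent G σ K key (suc (suc x)) (suc zero) e | no _ = trans (adj-sym G _ (suc zero)) (trans (cong proj₂ (key (suc (suc x)))) (just-injective e))

  -- Sorting and relabelling vertices

  elements : ∀ {n} → Sub n → List (Fin n)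
  elements {zero} P = []
  elements {suc n} P = if P zero then zero ∷ map suc (elements (P ∘ suc)) else map suc (elements (P ∘ suc))

  map-elements : ∀ {n} {A : Set} (h : Fin n → A) {k} (P : Sub n) → (∀ {v} → v ∈ P → h v ≡ k) → map h (elements P) ≡ replicate (# P) k
  map-elements h {k} P all = trans (go h P all) (cong (λ m → replicate m k) (sym (#-∑ {P = P})))
    where
    go : ∀ {n} (h : Fin n → _) (P : Sub n) → (∀ {v} → v ∈ P → h v ≡ k) → map h (elements P) ≡ replicate (∑ (λ v → [ P v ]ᵇ)) k
    go {zero} h P all = refl
    go {suc n} h P all with P zero in e
    ... | true = cong₂ _∷_ (all e) (trans (sym (map-∘ (elements (P ∘ suc)))) (go (h ∘ suc) (P ∘ suc) all))
    ... | false = trans (sym (map-∘ (elements (P ∘ suc)))) (go (h ∘ suc) (P ∘ suc) all)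

  ∈-elements : ∀ {n} (P : Sub n) {v} → v ∈ P → v ∈ᴸ elements P
  ∈-elements {suc n} P {zero} v∈ rewrite v∈ = here refl
  ∈-elements {suc n} P {suc v} v∈ with P zero
  ... | true = there (∈-map⁺ suc (∈-elements (P ∘ suc) v∈))
  ... | false = ∈-map⁺ suc (∈-elements (P ∘ suc) v∈)

  nth-∈ : ∀ {A : Set} {x : A} {xs} d → x ∈ᴸ xs → ∃ λ k → k < length xs × nth xs k d ≡ x
  nth-∈ d (here refl) = 0 , s≤s z≤n , refl
  nth-∈ d (there p) = let (k , l , e) = nth-∈ d p in suc k , s≤s l , e

  nth-map : ∀ {A B : Set} (h : A → B) xs k {d} → nth (map h xs) k (h d) ≡ h (nth xs k d)
  nth-map h [] k = refl
  nth-map h (x ∷ xs) zero = refl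
  nth-map h (x ∷ xs) (suc k) = nth-map h xs k

  #-perm : ∀ {n} (π : Perm n) (P : Sub n) → # (P ∘ (π ⟨$⟩ʳ_)) ≡ # P
  #-perm π P = ≤-antisym
    (#-injective {P = P ∘ (π ⟨$⟩ʳ_)} {Q = P} (π ⟨$⟩ʳ_) (λ _ v∈ → v∈) (λ _ _ e → trans (sym (inverseˡ π)) (trans (cong (π ⟨$⟩ˡ_) e) (inverseˡ π))))
    (#-injective {P = P} {Q = P ∘ (π ⟨$⟩ʳ_)} (π ⟨$⟩ˡ_) (λ _ v∈ → trans (cong P (inverseʳ π)) v∈)
      (λ _ _ e → trans (sym (inverseʳ π)) (trans (cong (π ⟨$⟩ʳ_) e) (inverseʳ π))))

  -- The right inverse `inv` is injective and therefore, by counting, reaches every vertex.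
  surjection⇒perm : ∀ {n} (ℓ inv : Fin n → Fin n) → (∀ v → ℓ (inv v) ≡ v) → Perm n
  surjection⇒perm {n} ℓ inv ℓ-inv = permutation ℓ inv ℓ-inv (λ i → ==⇒≡ (all∈ {P = λ j → inv (ℓ j) == j} {Q = λ _ → true} (λ _ → refl)
      (#-injective {P = λ _ → true} {Q = λ j → inv (ℓ j) == j} inv
        (λ v _ → trans (cong (λ z → inv z == inv v) (ℓ-inv v)) (==-refl (inv v)))
        (λ {a} {b} _ _ e → trans (sym (ℓ-inv a)) (trans (cong ℓ e) (ℓ-inv b)))) {i} refl))

  relabel : ∀ {n} → Graph n → Perm n → Graph n
  relabel G π = record { adj = λ i j → adj G (π ⟨$⟩ʳ i) (π ⟨$⟩ʳ j) ; sym = λ i j → adj-sym G _ _ ; irrefl = λ i → adj-irrefl G _ }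

  module Relabel {n} (G : Graph n) (π : Perm n) where
    private
      module H = HITs G
      module H′ = HITs (relabel G π)

    relabel-HIST : ∀ {ρ} (U : H′.Rooted (λ _ → true) ρ) → (∀ {v} → H′.deg U v ≢ 2) → HasHIST G
    relabel-HIST {ρ} U irr = H.spanning-HIST V (λ _ → refl) (λ {v} _ d → irr (trans (sym (degs v)) d))
      where
      from : Fin n → Fin n
      from = π ⟨$⟩ˡ_
      from≢ : ∀ {v} → v ≢ π ⟨$⟩ʳ ρ → from v ≢ ρ
      from≢ v≢ e = v≢ (trans (sym (inverseʳ π)) (cong (π ⟨$⟩ʳ_) e))
      V : H.Rooted (λ _ → true) (π ⟨$⟩ʳ ρ)
      V = record
        { par = λ v → π ⟨$⟩ʳ H′.par U (from v) ; rk = λ v → H′.rk U (from v) ; root∈ = refl ; par∈ = λ _ _ → refl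
        ; par~ = λ {v} _ v≢ → subst (λ z → Adj G (π ⟨$⟩ʳ H′.par U (from v)) z) (inverseʳ π) (H′.par~ U refl (from≢ v≢))
        ; rk-par = λ {v} _ v≢ → subst (λ z → H′.rk U z < H′.rk U (from v)) (sym (inverseˡ π)) (H′.rk-par U refl (from≢ v≢))
        ; rk-root = λ {v} _ v≢ → subst (λ z → H′.rk U z < H′.rk U (from v)) (sym (inverseˡ π)) (H′.rk-root U refl (from≢ v≢)) }
      ==-from : ∀ a b → (a == π ⟨$⟩ʳ b) ≡ (from a == b)
      ==-from a b = bool-ext (λ e → ≡⇒== (trans (cong from (==⇒≡ e)) (inverseˡ π)))
                             (λ e → ≡⇒== (trans (sym (inverseʳ π)) (cong (π ⟨$⟩ʳ_) (==⇒≡ e))))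
      degs : ∀ v → H.deg V v ≡ H′.deg U (from v)
      degs v = cong₂ _+_ (trans (sym (#-perm π (H.child V v))) (#-cong {P = H.child V v ∘ (π ⟨$⟩ʳ_)} {Q = H′.child U (from v)} λ j → cong₂ (λ p q → not p ∧ q)
                   (trans (==-from (π ⟨$⟩ʳ j) ρ) (cong (_== ρ) (inverseˡ π)))
                   (trans (cong (λ z → π ⟨$⟩ʳ H′.par U z == v) (inverseˡ π)) (bool-ext
                     (λ e → ≡⇒== (trans (sym (inverseˡ π)) (cong from (==⇒≡ e))))
                     (λ e → ≡⇒== (trans (cong (π ⟨$⟩ʳ_) (==⇒≡ e)) (inverseʳ π)))))))
                 (cong (λ b → [ not b ]ᵇ) (==-from v ρ))

-- The certificates and their verification

module Order10 where
  open Certificates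

  expand : List ℕ → List Vertex
  expand [] = []
  -- Each number carries 110 digits, and the fuel stops just before its leading 1.
  expand (c ∷ cs) = go 110 c
    where
    go : ℕ → ℕ → List Vertex
    go zero _ = expand cs
    go (suc k) c = (c mod 10) ∷ go k (c / 10)

  -- Found by computer search. Every number has a leading 1, followed by digits to be read from right to left.
  certificate : ℕ → ℕ → ℕ → List ℕ
  certificate 0 3 3 =
    110007000261210006000251120005000087711100000000866111000000008551110000000441110000000331110000000221110000000 ∷
    188400000000877111000000008661110000000551110000000090909121209050512351135335333251512000000122551120000002721 ∷
    100848480000000087711100000006611100000000809090908091208091229119020000029119200000027211000700026121000600084 ∷
    110006000251120005000844880000000771110000000080909090809120809122919102000002919120000002721100070002511200050 ∷
    130000000087711100000000866111000000055111000000044111000000009080909090809120809122991102000002991120000002612 ∷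
    100838380000000087711100000006611100000000809090908091212122311200300002911920000002721100070002612100060008388 ∷
    112100060002511200050008338800000007711100000000809090908091212122312100300002919120000002721100070002511200050 ∷
    119120000000909292990000000087711100000006611100000005511100000000908090909080912121223211003000029911200000026 ∷
    108091259911005000029911020000029911200000009299290000000771110000000090809080908081259191005000029191020000029 ∷
    108090908090908091269911006000029911020000029911200000029992000000077111000000066111000000009090809090809090809 ∷
    110200000828112000000828820000000087711100000000866111000000055111000000044111000000033111000000009090908090909 ∷
    108080808128581100500008281102000008281120000008282800000000877111000000066111000000008080808128681100600008281 ∷
    108771110000000661110000000551110000000090808080812851810050000821810200000821812000000822880000000771110000000 ∷
    120005000093993900000007711100000000908080912123221100300008281120000006212100060005211200050000909393990000000 ∷
    170006212100060003999300000007711100000006611100000000909080909080912123212100300008218120000007221100070005211 ∷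
    100000877111000000066111000000055111000000044111000000009090908090909090809121232112003000082118200000072211000 ∷
    100521120005000094994900000007711100000000908080812828110200000828112000000621210006000521120005000090949499000 ∷
    172211000700062121000600049994000000077111000000066111000000009090809090808128218102000008218120000007221100070 ∷
    170006212100060005211200050007711100000006611100000005511100000000909090809090909080812821180200000821182000000 ∷
    100000000000000000000000000000000000000000909090909090909050505125311155311115215120000001252511200000072211000 ∷ []
  certificate 0 4 2 =
    119186611000000001855110000000044110000000019186611000000001855110000000018441100000000331100000000221100000000 ∷
    118661100000000551100000000191866110000000018551100000000441100000000331100000000191918661100000000551100000000 ∷
    100000000000000000000000000000000000000000000000000000000000000191919186611000000005511000000004411000000001919 ∷ []
  certificate 0 4 3 =
    100191351110050000061110060000013411100400000131313311133001111311300000000331100000000711100700000311100030000 ∷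
    131000000001913411100400000196393393963331919192299090000001913611100600000134111004000005111005000008111008000 ∷
    100000066110000000019411100040000121221210000000021110200000081810000000055110000000021120000000022110000000031 ∷
    100000000511105000000818100000000441100000000211100200000198111000800001961110006000019811180000000191989441100 ∷
    119829929228222811100800000411100040000195511000000008908088111000800008111008000008111800000005111000500008118 ∷
    100000000000000000000000000001981110800000019771100000000194111400000001966110000000019191908287929292272221919 ∷ []
  certificate 0 4 4 =
    100000000000000000000000000000000000000000000000000000000000000000000000000000000000000000000000000111100000000 ∷ []
  certificate 0 5 1 =
    112121212071622990000000016228800000000828200000000666000000000555000000000444000000000333000000000222000000000 ∷
    100007000181818161212626020000000828200000000191822880000000018181283800003000019123990000300001807299200000000 ∷
    100001974400000700018181812121222400004000082820000000019755000007000181818121212225000050000828200000000197660 ∷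
    100000000000000197220000070001912121212772222227222182720000070001973300000700018181812121222300003000082820000 ∷ []
  certificate 0 5 2 =
    100003113000000005110000500001941100004000012311000030000121212222000000000211002000000211020000000211200000000 ∷
    113131333300000000031100300000031103000000031130000000061100006000019191913131333300000000031100300000031103000 ∷
    100000000000000000000000000000000000000000000000000000000000000000000000000000000000000000000000000000000191919 ∷ []
  certificate 0 5 3 =
    100000000000000000000000000000000000000000000000000000000000000000000000000000000000000000000000000111000000000 ∷ []
  certificate 1 2 2 =
    170010000073731700100007731100300007731130000000777337000000007775115711111222110022222666110011111444110011111 ∷
    172222237317001000007075751107000000707080708087338780000000775511007000077211000200007070707070707070707137331 ∷
    100555110011111333110011111626110002000090907095951197711113231100020000707722170010000722110700000090909272979 ∷
    177611886111173637000600084811004000007676170010000845115811411080708082991188112118777788722770707077721100020 ∷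
    100877788772277858118511111088484800000000909090969611991111175571001000025511000200008080808062626835528222322 ∷
    100000073371001000023311000200008080808080808080808080808080806876118761111086761107000008585100100008581100500 ∷
    172879892222208082281188222225581100800000708088551100800000707733770000000828110002000222110022222090909696119 ∷
    100766110070000766170010000266110002000090907323110002000090959511991111172271001000009090909229119911111090909 ∷
    121100020006661100111113331100111115551100000004241100020000909090959511991111109070737371001000007077661107000 ∷
    108080808080707070707070714774480800000738783000000774110040000088581158111118777878722770883838000000007070777 ∷
    185811005000085383000500085851771111108474110700000877887772277090909074647949764447661170000002661100020000808 ∷
    183883000000008868116811111090909094949900000007331170000002331100020000808080808080808080808050508558817711111 ∷
    100002551100020007551170000000808080808080808080808080808050808575817811111875117851111868160010000877877872277 ∷
    108558110080000668110080000070808833110080000070776611771111182811000200052511000200022211002222209090949491001 ∷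
    109090977797799227707070873317001000007755117711111828110002000626110002000090909279117911211090909279117911211 ∷
    100008448100100002441100020000909090752297792522209696110900000090939399000000072211700000009090922977792222209 ∷
    100000000000000000909096691109000000909095591109000000908090909339990000000080884411080000084411008000084418001 ∷ []
  certificate 1 3 1 =
    122733170010000181818188288000020001717171777270000200033310001000017171717772700002000555100010000444100010000 ∷
    121000100001925550000200019171919191999390999039917177551007100007557000000006555000060001917171919192729997222 ∷
    187228819171717377777700377755107010000181818188288000020001718181718828800002000171773370000000055510001000022 ∷
    124420000200074470000000064440000600084480000000054450000000019191919199949999004997221070100001818181818888887 ∷
    100992299191919244900902000192444000020001919196961900100001918195599009000001919198292989222220606644100610000 ∷
    100000000000000000000000000000000000000000000000000000000000000000000000000000000000000000000000019191919199999 ∷ []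
  certificate 1 3 2 =
    118551100000000221100002000181818821180002000331100000000181818821100802000771100010000441100000000661100000000 ∷
    188181882110800200033110000000018188211080020007711000100005511000100001919191988899988228818191919888989892288 ∷
    144110001000019191919888988992288191919198899888922881818821180002000331100010000771100010000191919198889988922 ∷
    100000000331100000000191919198898898922881818821100802000551100000000181818821180002000331100010000771100000000 ∷
    118821108002000551100000000771100010000331100000000191919198888998922881919191988888999228818188288000020005588 ∷
    100000000000000000000000000000000000000000000000019191919889898892288191919198888989922881919191988988899228818 ∷ []
  certificate 1 3 3 =
    140011111598111800000001515511100050000551100000000511105011111711170011111511100511111511500000000211100002000 ∷
    111006111113939131333110001000031110003000031130000000031310001000031110300000051510001000059598111800000004111 ∷
    155095981118000000059595959595985995955855541114001111141410001000071117001111131113000000009411100411111093961 ∷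
    101111133110000000031310000000061116000000009090979818100010000616100000000094949000000000959090959598599555585 ∷
    100818100000000399300000000093941110041111139391335351335355553050555311300000000311130011111311100030000411140 ∷
    100000000000000000000000000000000000000000000000971110071111109811100811111090909090909698118000100007117000000 ∷ []
  certificate 1 4 1 =
    100010000551000010000191919299000002000181818828000002000331000010000181818828000002000551000010000661000010000 ∷
    100000000000000000000000000000000000000000019191919199998899922991919191919999898992299181818188888008822884410 ∷ []
  certificate 1 4 2 =
    140000019811000800000137110007000001313313000010000331000010000311003000000311030000000311300000000211000002000 ∷
    110004000004110400000004114000000005110005000001919191515515000010000551000010000511005000000511500000000411000 ∷
    141400001000044100001000041100040000041104000000041140000000061100060000019191919141441400001000044100001000041 ∷
    100000000000000000000000000000000000000000000000000000000000000000000000000000000000000000000000000191919191414 ∷ []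
  certificate 1 4 3 =
    100000000000000000000000000000000000000000000000000000000000000000000000000000000000000000000000000111000000000 ∷ []
  certificate 2 1 1 =
    134441414666424442444064664100100000664641010000006664410010000666440000000333310310333555550015155222210022122 ∷
    177288000200006664410100000636310010000060606060606060606050508558812111211525880002000050585581010000066643444 ∷
    130000664641001000036631001000006060707070607070707050556991615111107675336375333775440005000060706269916111211 ∷
    166631311111166661661336666633000000006080809086993863833332989866222228289900020008284121114110808060839898000 ∷
    113110606061434666377333333665315111311060565631511131106051434666322333333566315111311662770002000626818111211 ∷
    109090909090914140959944449544426641211141186631811131129971711121146641010000006060608083886638833333366831811 ∷
    106623316111211663310010000090909094994900000002363161112110606366316313333090909299330002000064664100100000909 ∷
    106263316111211060663631010000063331631333309090929331911121176371611131106063663163133330608080808848480000000 ∷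
    138333306060666446000000007763367373333722527725222070775351711131185851010000065651010000009090909499490000000 ∷
    177353000500005070757251711121105533530303333772520005000848540005000070708080808833818313333070708080608833366 ∷
    185151112110905373537375333572527722222070727252772522207070606066644600000000777331711111105050707573537373333 ∷
    140003000444515111111070777251511121154451511111109368366383333060622886662222208628860002000080883851511131182 ∷
    109090935951911131152858000200009090955951911111163886000300008083388800000002285800050005585181111110909093499 ∷
    108060582899000200084854000500062652000500006636360000000646460000000566510100000090909448980900000258518111211 ∷
    164600444080808060608080806080814638767383333838413111411626515111211626412111411088383663833330606080808080808 ∷
    111466540005000090909669529522222052665205000000536653000500066651511111109090909399366393333546460005000064464 ∷
    155101000000945646000500025651611121109090925951911121155636000300006063663603033335565161111110909092995151112 ∷
    100300007373770303333272770022222060706060767337637333357571010000057551711111108080882551811121177551010000066 ∷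
    109090959555919515576637000300006063663603033335655161111110947457000500027551711121109090939551911131109673760 ∷
    111143555133133331414144554131113114555400000002555121222228555181111117555171111110926551611121146546000500009 ∷
    112111211097929721111117535730000003555131111114555244424441445553444344465551611111145555514515509146555161111 ∷
    111121109339988393333090909229988922222355513111111445510010000093555551153550909094994121112111414090909076565 ∷
    110100000299210100000090909090909141409394944493444655516111111855518111111255512111111454510010000090908255818 ∷
    100000926627772222236377736333309525217711111323277000000080808844280002000626277722222070707076666777622668282 ∷
    147371311141109090969627792222257571711111107074747700000000927321711131107373217111211070747427000200037371001 ∷
    180000000228218111111096737131611110909094469900600000908668280002000080808833810010000873780003000873718111311 ∷
    133991001000022929002222222921911111109090942829892242209090955891918111109080909338899383333082288100100002282 ∷
    111449910010000093292900030000923929000300008080808558818111111339290002000090908080866821811121122991010000009 ∷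
    136333309449990000000095599191111113292191113110808086682800020000909239290003000080808084488800000003392191112 ∷
    166929000200075571010000055521212222239923000200059922000500069921611121159951010000059921511121109080808638899 ∷
    100095993300050000606060606060605866280002000669290002000066262100100006662121111116993300600000505050505060605 ∷
    100095962269252223994131114113662300020000939939636333349941001000009090606066662200000006992296222223992200030 ∷
    111131106793719111311366530005000369269223222499460060000093993193133336992600020000909060609060606057662700020 ∷
    109395915111311699515161111399220003000399913111111399930303333499240002000090906090606090607868260002000399717 ∷
    126621010000006063663101000002622600222222622161222220808088322800030006622100100007722101000000909090909090905 ∷
    127100100002722700000002722171222220936221611131146221611141109090909599519111111362260003000090909766399373333 ∷
    122161111110909090949499000000037221711131109090909595919111111372270003000090909676299722222073737100100000727 ∷
    109329290003000442210100000091472221711111152221512222214141442421311131142224000000082221811111142221212242262 ∷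
    100000009090932929000300042241010000009090909068228121111116262121222226222620202225222200252223222121223220909 ∷ []
  certificate 2 2 1 =
    157000000007757050000001717755700000000776176111111775500000000775700050000222100122222444100111111333100010000 ∷
    127000000001717575700000000171718181876617881111117177557000000007721001020001717171717171717171717171717151757 ∷
    185000000004341000130004241001020001919191969619911111117177721001020007227000020003221000130001967617001000027 ∷
    144000030001818181818181818181818181818181518158588005000008588050000008588000500008681861111111885580000000085 ∷
    100181818838800003000554400000000191855880000000018338800003000181817177661070100001885580000000083810001300033 ∷
    181800100002288000000001717187661771111111717755700000000828100102000224400002000222100111111191919192999000020 ∷
    130001919191969919611111118181882880000200033440000300055440000000019191972889792222219181919193399903033331822 ∷
    111744700000000195959000000006991961111112441001020003441000130001919197921971112113221000130001919191939990000 ∷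
    100181818181785580000000018844800000000181886618811111132310010200077310001300019191919191919171917197921971112 ∷
    170100000373700003000191919829189111211181818181786610810000018822808000000188448000000005531000130002231000130 ∷
    167610071000019191917494900000000191929290902222257510071000019191929290000000037310017000017174741001700003731 ∷
    100633300006000833800000000533500003000433400003000233100102000191919175757007000001919292199111111474700700000 ∷
    100000019191919699196111111191919196991691111111919191966919911111119697337000000006906066361000130006331001600 ∷ []
  certificate 2 2 2 =
    181006100008681061000008681601000000877110000000008661100000000551100000000441100000000331100000000221100000000 ∷
    100000085810510000087118711111185850000000008771100000000661100000000080808086908696929119911121186810016000086 ∷
    118001500008518005100008518051000008611861111118558000000000808084859594859351133151111084829110900200048455400 ∷
    100000084814010000087117811111184840000000008771100000000661100000000551100000000898989898945451545450000000085 ∷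
    118001400008418004100008418401000008611681111118448000000000808085849584949341133141111085829119000200058544500 ∷
    149494949299900002000841180040000841180400000841480100000844180100000661100000000898989898945451454540000000084 ∷
    144110000000089898989896969696929920000000086618811111186116811111186118611111185580000000084480000000089898989 ∷
    100005511000000008311080030008989661100000000831180003000898318000130000808838100013000661100000000551100000000 ∷
    120008982180010200008088281001020006611000000005511000000004411000000003311000000000989661100000000898966110000 ∷
    100000044110000000082110080200009896611000000008989661100000000551100000000821108002000898966110000000082118000 ∷
    100000000000000000000000000000000000000000009098966110000000055110000000009896611000000008989661100000000551100 ∷ []
  certificate 2 3 1 =
    118828000002000668008000000181818828800002000441000010000181818821008102000771000010000331000110000551000110000 ∷
    122228380000030001918191966900009000083100801300018188318000130004410001100007710001100001919191988889899338818 ∷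
    119229989822222831080013000181818821800102000331000010000441000110000771000010000191844100011000019191922199912 ∷
    122100010200044808000000019191919299900002000191919299000002000181882108010200066100001000033100011000019181919 ∷
    188992288191919198889899822881919191988898989228818181819191988888999338818661000110000871887111111331000013000 ∷
    100000000000000000000000000000000000000000000000000000000000000000000000000000000000000000000000000191919198889 ∷ []
  certificate 2 3 2 =
    199111111691616611000600000611000060000661000110000611006111111616000110000511500111111211000102000311000003000 ∷
    100110000195950090000004110000400004110004000004140000100007117000000001969811800000000411400000000696969698198 ∷
    100000000000000000019191919191969711700111111499400000000711000700000811800111111611060111111191919191919798180 ∷ []
  certificate 2 3 3 =
    100000000000000000000000000000000000000000000000000000000000000000000000000000000000000000000000000111000000000 ∷ []
  certificate 3 1 1 =
    107666100111111776101060000776106100000776101600000776161111111333100313333444104014444222100122222555100100000 ∷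
    118618877310100300007070707070707070707070769690769499191111411366101003000066807686868888188184488636101003000 ∷
    101300077410001400079070777310100300073370000000043310010400079797969619111111107373700003000780778787878886888 ∷
    190990399074741017000004747000000007978077878788868818861887331070100003341000140007878787878866181181111434100 ∷
    107774100104000744100710000744700000000244100102000344101003000797979797939379739333367610701000079797979799939 ∷
    141911111110727210710000037310107000027270000000008087808866181111111772101002000232100013000242100014000797907 ∷
    181010030003321001020008908085858585857275555255586816111111187278000200089080887280070200087218171121179797949 ∷
    140008481001040007441010700004421001020008989896681818111118978787886618111111108780883318111111183380000000083 ∷
    100090979096961911111113441010030007977210010200079787878788661811111117331010700007878077886618111111134310001 ∷
    100535100013000090909696191111111797907077721001020007221017000007221070100007227000020003221000130004221001040 ∷
    167676171111111868100160000868106010000874871111411873870003000088728711112118681611111115451000140005251001020 ∷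
    111111158585884880000400044514111151144550000000008080808080808080808080808087979797999889999229976617111111108 ∷
    145558281001020002251211115117221711111112255000000008908088651681115118481001040008908085858845844554444848141 ∷
    189448800000000890808785884414118111182580005200082812111121159582288080222225858445141111511585858585884585558 ∷
    155080020008908088281010020008651611815114455000040008909593221311113114221001040008228000000002221010111118989 ∷
    151411115114341411113115959595959999929090299153351010500003351051000003351311115117331711113113355000030008982 ∷
    163613111131159595959592999211111115959595959299920022222595858228800000000585878585882282582252283810001300044 ∷
    110200033310031333309797947470000000073570050300079735131171511790778077878744874884444775101500000232131111311 ∷
    161811111835508003000898381000130008908088651618115118255008020007755000000004455000000000959433131111411233100 ∷
    100006551061000006551016000007557000000008558000000006551611111112551010020003551010030004551000140000989896681 ∷
    100000000000000000000000000000000000000000000000000000000000000000000000000000000000000000909090909060665510106 ∷ []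
  certificate 3 2 1 =
    180006000008680060000008680600000001877100100000018661001000000551001000000441000100000331001000000221001000000 ∷
    180000500008580005000008580050000008585000000001877100100000066100100000018181818691626600000200086800006000086 ∷
    189898959595929900000200085180105000085180150000085180510000086608000000085580000000018181818591525500000200085 ∷
    155100100000044100010000089896610010000008410801040008984180010400018188480000040006610010000005510010000008989 ∷
    189896610010000005510010000008310080130008989661001000000831081003000898318010030001818838000003000661001000000 ∷
    100008210810020008982180100200018188280000020006610010000005510010000004410001000003310010000001989661001000000 ∷
    100000055100100000044100010000082100180200019896610010000008989661001000000551001000000821008102000898966100100 ∷
    100000000000000000000000000000000000000000000000000000019198966100100000055100100000019896610010000008989661001 ∷ []
  certificate 3 2 2 =
    100511000050000511000500000511005000000515001000000551001000000511500000000411000004000311000003000211000002000 ∷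
    160000000095971107000000081108000000059711070000000595959098118000000005671170000000056566160010000006610010000 ∷
    100000000000000000000000000000000000000000000000000000000000000000000000000000909698118000000007117000000006110 ∷ []
  certificate 4 1 1 =
    100787878787824777777247729900000200008441000010000221001000000771010111111551000105000331001003000661011101111 ∷
    168686266006626665215111112118410100840007878787477717174777440000070000809685414111115116460000040003430000040 ∷
    119111115118280000020004410111011116760000070008909726666667266686868326666662366684212111114116210601020006868 ∷
    111141127171111121137171111131189848000004000897968686879673366373333391911111311491911111411291911111211086859 ∷
    111141189851000185000896868686865660066566685800000500022101000200025151111121144101000400009571711111511471711 ∷
    111115510010050008989221001000000841080104000890969696969756666667566351511111311858511111511651511111611451511 ∷
    166636000003000787878237777772377784340000030007878787873777711737773300000700084101080400022101011121177101101 ∷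
    189892210001020007710101111118310800130008989898989228998822222838000003000898310010830008909686868685366666635 ∷
    169696769692920990222225615111116117710000100003613111116112612111116114614111116115660000050008989221001111111 ∷
    169499000004000361001063000561001065000696969696959955900555526100160200069695615111116116969696969999009992299 ∷
    175558318111113118418111114118218111112118680000600006969697636666673663610060130005610061050002610160020006969 ∷
    100000000000000000000000000000009266000002000466000004000366000003000761711111611090909090978787878397875555757 ∷ []
  certificate _ _ _ = []

  -- The vertices 0 and 1 have degrees `a + b + 1` and `a + c + 1`. The first degree is the maximum
  -- and lies between 4 and 6, hence `c ≤ b`; the 6 comes from `10 ≤ 2 + (a + b + 1) + (a + c + 1)`;
  -- and `1 ≤ c` says that vertex 1 has a neighbour that is neither 0 nor adjacent to 0.
  admissible : ℕ → ℕ → ℕ → Bool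
  admissible a b c = does (3 ≤? a + b) ∧ does (a + b ≤? 5) ∧ does (1 ≤? c) ∧ does (c ≤? b) ∧ does (6 ≤? a + b + (a + c)) ∧ does (a + b + c ≤? 8)

  startState : ℕ → ℕ → ℕ → State
  startState a b c = start (rows a b c (8 ∸ (a + b + c)))

  -- Unread digits are accepted, because the last number is padded with zeros. Each nested call of
  -- `check` decides a further one of the 45 pairs, so fuel 60 is ample.
  verify : ℕ → ℕ → ℕ → Bool
  verify a b c = not (admissible a b c) ∨ is-just (check 60 (startState a b c) (expand (certificate a b c)))

  -- Evaluated by the type checker. Entries up to 5 cover all admissible triples, as `a + b ≤ 5` and
  -- `c ≤ b`.
  verified : allᵇ {6} (λ a → allᵇ {6} λ b → allᵇ {6} λ c → verify (toℕ a) (toℕ b) (toℕ c)) ≡ true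
  verified = refl

-- Labelling a graph of order 10 to match a certificate

module Order10Graphs (G : Graph 10) (σ : DegreeSum G)
  {u x : Fin 10} (ux : Adj G u x) where

  open Certificates
  open Order10

  N W A B C E : Sub 10
  N = adj G u
  W = ∁ (⁅ u ⁆ ∪ N)
  A = N ∩ adj G x
  B = (N ∖ adj G x) ∖ ⁅ x ⁆
  C = W ∩ adj G x
  E = W ∖ adj G x

  a b c e : ℕ
  a = # A
  b = # B
  c = # C
  e = # E

  xu : Adj G x u
  xu = trans (adj-sym G x u) ux

  x∈ : x ∈ N ∖ adj G x
  x∈ = ∖-intro ux (adj-irrefl G x)

  #N : # N ≡ a + suc b
  #N = trans (#-split N (adj G x)) (cong (a +_) (#-remove (N ∖ adj G x) x∈))

  #W : # W ≡ c + e
  #W = #-split W (adj G x)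

  #all : suc (# N) + # W ≡ 10
  #all = trans (cong (_+ # W) (sym (trans (#-⊎ ⁅ u ⁆ N λ v h → subst (λ z → adj G u z ≡ false) (sym (==⇒≡ h)) (adj-irrefl G u))
           (cong (_+ # N) (#-⁅⁆ u))))) (#-∁ (⁅ u ⁆ ∪ N))

  total : a + b + c + e ≡ 8
  total = arith {a} {b} {c} {e} (trans (sym (cong₂ (λ n w → suc n + w) #N #W)) #all)
    where
    arith : ∀ {a b c e} → suc (a + suc b) + (c + e) ≡ 10 → a + b + c + e ≡ 8
    arith {a} {b} {c} {e} h = +-cancelˡ-≡ 2 _ _ (trans r h)
      where
      r : 2 + (a + b + c + e) ≡ suc (a + suc b) + (c + e)
      r = solve (a ∷ₗ b ∷ₗ c ∷ₗ e ∷ₗ []ₗ)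

  -- The classes are listed in the order that `rows` presupposes.
  L : List (Fin 10)
  L = u ∷ x ∷ elements A ++ elements B ++ elements C ++ elements E

  key : Fin 10 → Bool × Bool
  key v = adj G u v , adj G x v

  W≁ : ∀ {v} → v ∈ W → adj G u v ≡ false
  W≁ {v} h = ¬true λ n → true≢false (∨-introʳ {v == u} n) (not-true h)

  keys : map key L ≡ rows a b c e
  keys = cong₂ _∷_ (cong₂ _,_ (adj-irrefl G u) xu) (cong₂ _∷_ (cong₂ _,_ ux (adj-irrefl G x))
    (trans (map-++ key (elements A) _) (cong₂ _++_ (map-elements key A λ {v} h → let (p , q) = ∧-elim {N v} h in cong₂ _,_ p q)
    (trans (map-++ key (elements B) _) (cong₂ _++_ (map-elements key B λ {v} h →
       let (p , q) = ∖-elim {N v} (proj₁ (∖-elim {(N ∖ adj G x) v} h)) in cong₂ _,_ p q)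
    (trans (map-++ key (elements C) _) (cong₂ _++_ (map-elements key C λ {v} h → let (p , q) = ∧-elim {W v} h in cong₂ _,_ (W≁ {v} p) q)
      (map-elements key E λ {v} h → let (p , q) = ∖-elim {W v} h in cong₂ _,_ (W≁ {v} p) q))))))))

  length-L : length L ≡ 10
  length-L = trans (sym (length-map key L)) (trans (cong length keys) (cong (2 +_) (trans lengths total)))
    where
    lengths : length (replicate a (true , true) ++ replicate b (true , false) ++ replicate c (false , true) ++ replicate e (false , false)) ≡ a + b + c + e
    lengths = trans (length-++ (replicate a _)) (trans (cong₂ _+_ (length-replicate a) (trans (length-++ (replicate b _))
      (cong₂ _+_ (length-replicate b) (trans (length-++ (replicate c _)) (cong₂ _+_ (length-replicate c) (length-replicate e))))))
      (trans (sym (+-assoc a b (c + e))) (sym (+-assoc (a + b) c e))))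

  complete : ∀ v → v ∈ᴸ L
  complete v = case v ≟ u of λ where
      (yes p) → here p
      (no v≢u) → there (case v ≟ x of λ where
        (yes p) → here p
        (no v≢x) → there ([ in-N v≢x , (λ n → in-W (cong not (∨-false (≢⇒== v≢u) n))) ]′ (bool (N v))))
    where
    Rest = v ∈ᴸ elements A ++ elements B ++ elements C ++ elements E
    in-N : v ≢ x → v ∈ N → Rest
    in-N v≢x n = [ (λ q → ∈-++⁺ˡ (∈-elements A (∧-intro n q)))
                 , (λ q → ∈-++⁺ʳ (elements A) (∈-++⁺ˡ (∈-elements B (∖-intro (∖-intro n q) (≢⇒== v≢x))))) ]′ (bool (adj G x v))
    in-W : v ∈ W → Rest
    in-W h = ∈-++⁺ʳ (elements A) (∈-++⁺ʳ (elements B) ([ (λ q → ∈-++⁺ˡ (∈-elements C (∧-intro h q)))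
                 , (λ q → ∈-++⁺ʳ (elements C) (∈-elements E (∖-intro h q))) ]′ (bool (adj G x v))))

  position : Fin 10 → Fin 10
  position v = fromℕ< (subst (proj₁ (nth-∈ u (complete v)) <_) length-L (proj₁ (proj₂ (nth-∈ u (complete v)))))

  vertex : Fin 10 → Fin 10
  vertex i = nth L (toℕ i) u

  π : Perm 10
  π = surjection⇒perm vertex position λ v → trans
        (cong (λ k → nth L k u) (toℕ-fromℕ< (subst (proj₁ (nth-∈ u (complete v)) <_) length-L (proj₁ (proj₂ (nth-∈ u (complete v)))))))
        (proj₂ (proj₂ (nth-∈ u (complete v))))

  G′ : Graph 10
  G′ = relabel G π

  σ′ : ∀ {i j} → i ≢ j → adj G′ i j ≡ false → 10 ≤ 2 + # (adj G′ i) + # (adj G′ j)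
  σ′ {i} {j} i≢j h = ≤-trans (σ (λ q → i≢j (trans (sym (inverseˡ π)) (trans (cong (π ⟨$⟩ˡ_) q) (inverseˡ π)))) h)
    (≤-reflexive (sym (cong₂ (λ p q → 2 + p + q) (#-perm π (adj G (vertex i))) (#-perm π (adj G (vertex j))))))

  key-vertex : ∀ i → (adj G′ zero i , adj G′ (suc zero) i) ≡ nth (rows a b c e) (toℕ i) (false , true)
  key-vertex i = trans (sym (nth-map key L (toℕ i))) (cong₂ (λ ks d → nth ks (toℕ i) d) keys (cong₂ _,_ (adj-irrefl G u) xu))

  found : admissible a b c ≡ true → a ≤ 5 → b ≤ 5 → c ≤ 5 → HasHIST G
  found ok a≤ b≤ c≤ = conclude (check 60 (startState a b c) (expand (certificate a b c))) refl (case ∨-elim {not (admissible a b c)} checked of λ where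
      (inj₁ h) → ⊥-elim (true≢false ok (not-true h))
      (inj₂ h) → h)
    where
    at : ∀ {k} (l : k ≤ 5) → toℕ (fromℕ< (s≤s l)) ≡ k
    at l = toℕ-fromℕ< (s≤s l)
    ia = fromℕ< (s≤s a≤)
    ib = fromℕ< (s≤s b≤)
    ic = fromℕ< (s≤s c≤)
    checked : verify a b c ≡ true
    checked = subst₂ (λ p q → verify p q c ≡ true) (at a≤) (at b≤) (subst (λ r → verify (toℕ ia) (toℕ ib) r ≡ true) (at c≤)
      (allᵇ-elim {6} (λ k → verify (toℕ ia) (toℕ ib) (toℕ k)) (allᵇ-elim {6} (λ j → allᵇ {6} λ k → verify (toℕ ia) (toℕ j) (toℕ k))
        (allᵇ-elim {6} (λ i → allᵇ {6} λ j → allᵇ {6} λ k → verify (toℕ i) (toℕ j) (toℕ k)) verified ia) ib) ic))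
    eq-e : 8 ∸ (a + b + c) ≡ e
    eq-e = trans (cong (_∸ (a + b + c)) (sym total)) (m+n∸m≡n (a + b + c) e)
    conclude : ∀ m → check 60 (startState a b c) (expand (certificate a b c)) ≡ m → is-just m ≡ true → HasHIST G
    conclude (just _) eq _ = let (ρ , U , irr) = Soundness.sound G′ σ′ 60 {startState a b c} {expand (certificate a b c)} eq
                                   (start-consistent G′ σ′ (rows a b c (8 ∸ (a + b + c)))
                                     (subst (λ r → ∀ i → (adj G′ zero i , adj G′ (suc zero) i) ≡ nth (rows a b c r) (toℕ i) (false , true)) (sym eq-e) key-vertex)) in
      Relabel.relabel-HIST G π U (λ {v} → irr {v})

-- Connectedness yields a neighbour `x` of `u` that has a neighbour outside the closed neighbourhood
-- of `u`; the certificates start from this pair.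
order-10 : (G : Graph 10) → DegreeSum G → Connected G →
  (u : Fin 10) → (∀ v → # (adj G v) ≤ # (adj G u)) → # (adj G u) ≤ 6 → HasHIST G
order-10 G σ conn u max Δ≤6 = from-outside (pick (∁ (adj G u)) (u ∷ []) (≤-trans (s≤s (s≤s z≤n)) (far u)))
  where
  Δ = # (adj G u)

  far : ∀ v → 4 ≤ # (∁ (adj G v))
  far v = +-cancelˡ-≤ 6 4 _ (≤-trans (≤-reflexive (sym (#-∁ (adj G v)))) (+-monoˡ-≤ _ (≤-trans (max v) Δ≤6)))

  δ : ∀ v → 10 ≤ 2 + Δ + # (adj G v)
  δ v = let (z , z∈ , z≢) = pick (∁ (adj G v)) (v ∷ []) (≤-trans (s≤s (s≤s z≤n)) (far v)) in
    ≤-trans (σ (case z≢ of λ { (q ∷ []) → q }) (trans (adj-sym G z v) (not-true z∈))) (+-monoˡ-≤ _ (s≤s (s≤s (max z))))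

  Δ≥4 : 4 ≤ Δ
  Δ≥4 = arith (δ u)
    where
    arith : ∀ {D} → 10 ≤ 2 + D + D → 4 ≤ D
    arith {D} h = ≮⇒≥ less
      where
      less : suc D ≤ 4 → ⊥
      less g = clash 1 (double g ⊕ h) (solve (D ∷ₗ []ₗ))

  from-edge : ∀ {x w} → Adj G u x → w ∉ (⁅ u ⁆ ∪ adj G u) → Adj G x w → HasHIST G
  from-edge {x} {w} ux w∉ xw = found
      (∧-intro (dec-true (3 ≤? a + b) (s≤s⁻¹ (≤-trans Δ≥4 (≤-reflexive Δ≡)))) (∧-intro (dec-true (a + b ≤? 5) ab≤5)
        (∧-intro (dec-true (1 ≤? c) c≥1) (∧-intro (dec-true (c ≤? b) c≤b)
          (∧-intro (dec-true (6 ≤? a + b + (a + c)) (sum-low (δ x) Δ≡ dx)) (dec-true (a + b + c ≤? 8) (≤-trans (m≤m+n _ e) (≤-reflexive total))))))))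
      (≤-trans (m≤m+n a b) ab≤5) b≤5 (≤-trans c≤b b≤5)
    where
    open Order10Graphs G σ ux
    Δ≡ : Δ ≡ suc (a + b)
    Δ≡ = trans #N (+-suc a b)
    ab≤5 : a + b ≤ 5
    ab≤5 = s≤s⁻¹ (≤-trans (≤-reflexive (sym Δ≡)) Δ≤6)
    b≤5 : b ≤ 5
    b≤5 = ≤-trans (m≤n+m b a) ab≤5
    c≥1 : 1 ≤ c
    c≥1 = ∈⇒#>0 C {w} (∧-intro (cong not w∉) xw)
    dx : # (adj G x) ≡ suc (a + c)
    dx = trans (#-split (adj G x) (⁅ u ⁆ ∪ N)) (cong₂ _+_
      (trans (#-step {P = A} {Q = adj G x ∩ (⁅ u ⁆ ∪ N)} u (cong (_∧ adj G x u) (adj-irrefl G u)) (∧-intro xu (∨-introˡ (==-refl u)))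
        (λ v v≢ → trans (∧-comm (adj G x v) _) (cong (λ h → (h ∨ N v) ∧ adj G x v) (≢⇒== v≢)))) refl)
      (#-cong {P = adj G x ∖ (⁅ u ⁆ ∪ N)} {Q = C} λ v → ∧-comm (adj G x v) _))
    c≤b : c ≤ b
    c≤b = +-cancelˡ-≤ (suc a) c b (≤-trans (≤-reflexive (sym dx)) (≤-trans (max x) (≤-reflexive Δ≡)))
    sum-low : ∀ {d D} → 10 ≤ 2 + D + d → D ≡ suc (a + b) → d ≡ suc (a + c) → 6 ≤ a + b + (a + c)
    sum-low h refl refl = +-cancelˡ-≤ 4 6 _ (≤-trans h (≤-reflexive (cong (3 +_) (+-suc (a + b) (a + c)))))

  from-outside : (∃ λ w → w ∈ ∁ (adj G u) × All (w ≢_) (u ∷ [])) → HasHIST G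
  from-outside (w , w∈ , w≢u ∷ []) = let (x , w' , x∈ , w'∉ , xw') = boundary-edge G (⁅ u ⁆ ∪ adj G u) (conn u w) (∨-introˡ (==-refl u))
                                           (∨-false (≢⇒== w≢u) (not-true w∈)) in
    case ∨-elim {x == u} x∈ of λ where
      (inj₂ ux) → from-edge ux w'∉ xw'
      (inj₁ x≡u) → ⊥-elim (true≢false (∨-introʳ {w' == u} (subst (λ z → Adj G z w') (==⇒≡ x≡u) xw')) w'∉)

-- Assembly of the cases

star-goal : ∀ {n} (G : Graph n) (σ : DegreeSum G) → Connected G →
  10 ≤ n → (u : Fin n) → n + 3 ≤ 2 * # (adj G u) → HasHIST G ⊎ Pendant G
star-goal {n} G σ conn 10≤n u h = done T.star (arith {n} {# (adj G u)} {HIT.nl T.star} h T.star-nl)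
  where
  open Build G σ conn
  three : ∀ {n D} → 10 ≤ n → n + 3 ≤ 2 * D → 3 ≤ D
  three {n} {D} a b = ≮⇒≥ less
    where
    less : suc D ≤ 3 → ⊥
    less g = clash 8 (a ⊕ b ⊕ double g) (solve (n ∷ₗ D ∷ₗ []ₗ))
  module T = Star u (adj G u) (three {n} {# (adj G u)} 10≤n h) id
  arith : ∀ {n D l} → n + 3 ≤ 2 * D → D + l ≤ n → 2 * l + 3 ≤ n
  arith {n} {D} {l} a b = ≮⇒≥ less
    where
    less : suc n ≤ 2 * l + 3 → ⊥
    less g = clash 0 (g ⊕ a ⊕ double b) (solve (n ∷ₗ D ∷ₗ l ∷ₗ []ₗ))

HIST-or-pendant : ∀ m (G : Graph (3 + m)) → 10 ≤ 3 + m → Connected G →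
  DegreeSum G → HasHIST G ⊎ Pendant G
HIST-or-pendant m G 10≤n conn σ = go (argmax (λ v → # (adj G v)))
  where
  tight : ∀ {D} → 2 * D ≤ 10 + 2 → D ≤ 6
  tight {D} h = ≮⇒≥ less
    where
    less : suc 6 ≤ D → ⊥
    less g = clash 1 (double g ⊕ h) (solve (D ∷ₗ []ₗ))

  -- Stated for a variable `k`, so that matching on the equality of 10 and `3 + k` specialises the
  -- graph to order 10.
  sparse : ∀ k (G : Graph (3 + k)) → 10 ≤ 3 + k → Connected G →
    DegreeSum G →
    (u : Fin (3 + k)) → (∀ v → # (adj G v) ≤ # (adj G u)) → 2 * # (adj G u) ≤ 3 + k + 2 → HasHIST G ⊎ Pendant G
  sparse k G 10≤n conn σ u max low with m≤n⇒m<n∨m≡n 10≤n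
  ... | inj₁ 11≤n = Counting.initial G σ conn u max low 11≤n
  ... | inj₂ refl = inj₁ (order-10 G σ conn u max (tight low))

  go : (∃ λ u → ∀ v → # (adj G v) ≤ # (adj G u)) → HasHIST G ⊎ Pendant G
  go (u , max) = case 3 + m + 3 ≤? 2 * # (adj G u) of λ where
    (yes h) → star-goal G σ conn 10≤n u h
    (no h) → sparse m G 10≤n conn σ u max (s≤s⁻¹ (≤-trans (≰⇒> h) (≤-reflexive (+-suc (3 + m) 2))))

theorem2 : (n : ℕ) → 10 ≤ n → (G : Graph n) → Connected G → σ₂≥ G (n ∸ 2) →
    (HasHIST G ⇔ (¬ (G ≅ᵃ Dadj n)))
theorem2 (suc zero) (s≤s ())
theorem2 (suc (suc zero)) (s≤s (s≤s ()))
-- Written as `3 + m`, the order lets the subtractions in `Dadj` and in the degree condition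
-- compute.
theorem2 (suc (suc (suc m))) 10≤n G conn σ₂ = mk⇔ (Tail.no-HIST m G) λ not-D →
    [ id , (λ P → ⊥-elim (not-D (Tail.pendant⇒≅D m G P))) ]′ (HIST-or-pendant m G 10≤n conn σ)
  where
  σ : ∀ {u v} → u ≢ v → adj G u v ≡ false → 3 + m ≤ 2 + # (adj G u) + # (adj G v)
  σ {u} {v} u≢v e = ≤-trans (s≤s (s≤s (σ₂ u v u≢v λ a → true≢false a e)))
    (≤-reflexive (cong₂ (λ p q → 2 + p + q) (degree-# G u) (degree-# G v)))
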